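{- For $n\ge1$ let $P_{n}^{(\mathrm{br},\mathrm{ipk})}(s,t)=\sum_{\pi\in\mathfrak{S}_{n}}s^{\mathrm{br}(\pi)}t^{\mathrm{ipk}(\pi)+1}$ and $P_{n}^{(\mathrm{br},\mathrm{ides})}(s,t)=\sum_{\pi\in\mathfrak{S}_{n}}s^{\mathrm{br}(\pi)}t^{\mathrm{ides}(\pi)+1}$. Then, as formal power series: (a) \begin{multline*} \frac{1}{(1-s)(1-t)}+\frac{2stx}{(1-s)^{2}(1-t)^{2}}+\frac{(1+s)^{3}}{8(1-s)}\sum_{n=2}^{\infty}\frac{(1+s^{2})^{n-1}(1+t)^{n+1}P_{n}^{(\mathrm{br},\mathrm{ipk})}\left(\frac{2s}{1+s^{2}},\frac{4t}{(1+t)^{2}}\right)}{(1-s^{2})^{n}(1-t)^{n+1}}x^{n}\\ =\sum_{i,j=0}^{\infty}\left(\frac{1+x}{1-x}\right)^{2ij}\left(1+s\left(\frac{1+x}{1-x}\right)^{j}\right)s^{2i}t^{j}; \end{multline*} (b) \begin{multline*} \frac{1}{(1-s)(1-t)}+\frac{stx}{(1-s)^{2}(1-t)^{2}}+\frac{(1+s)^{3}}{4(1-s)}\sum_{n=2}^{\infty}\frac{(1+s^{2})^{n-1}P_{n}^{(\mathrm{br},\mathrm{ides})}\left(\frac{2s}{1+s^{2}},t\right)}{(1-s^{2})^{n}(1-t)^{n+1}}x^{n}\\ =\frac{1}{2}\sum_{i,j=0}^{\infty}\left(\frac{1+x}{1-x}\right)^{ij}\left(2+\frac{s}{(1-x)^{j}}+s(1+x)^{j}\right)s^{2i}t^{j}.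 \end{multline*}
   Context: $\mathfrak{S}_n$ is the symmetric group on $[n]$. For $\pi\in\mathfrak{S}_n$: $i\in[n-1]$ is a descent if $\pi(i)>\pi(i+1)$, $\mathrm{des}(\pi)$ the number of descents, $\mathrm{ides}(\pi)=\mathrm{des}(\pi^{ -1})$; $i$ with $2\le i\le n-1$ is a peak if $\pi(i-1)<\pi(i)>\pi(i+1)$, $\mathrm{pk}(\pi)$ the number of peaks, $\mathrm{ipk}(\pi)=\mathrm{pk}(\pi^{ -1})$. A birun of $\pi$ (in one-line notation) is a maximal monotone (increasing or decreasing) consecutive subsequence, and $\mathrm{br}(\pi)$ is the number of biruns of $\pi$. -}

module Defs where

open import Data.Bool using (Bool; true; false; if_then_else_; _∧_; _∨_; not)
open import Data.Nat as ℕ using (ℕ; zero; suc; _∸_; _<ᵇ_; _≡ᵇ_)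
open import Data.List using (List; []; _∷_; map; filter; concatMap; upTo; length; take; drop)
open import Data.Integer using (+_)
open import Data.Rational using (ℚ; 0ℚ; 1ℚ; _/_) renaming (_+_ to _+ℚ_; _*_ to _*ℚ_; -_ to -ℚ_)
import Data.List.Relation.Unary.Unique.DecPropositional as UniqueDec

-- Permutations of [n] in one-line notation, as lists of naturals.

[1‥_] : ℕ → List ℕ
[1‥ n ] = map suc (upTo n)

words : ℕ → ℕ → List (List ℕ)
words zero    n = [] ∷ []
words (suc k) n = concatMap (λ v → map (v ∷_) (words k n)) [1‥ n ]

𝔖 : ℕ → List (List ℕ)
𝔖 n = filter (UniqueDec.unique? ℕ._≟_) (words n n)

pos : ℕ → List ℕ → ℕ
pos v []       = 0
pos v (y ∷ ys) = if v ≡ᵇ y then 1 else suc (pos v ys)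

inverse : List ℕ → List ℕ
inverse w = map (λ v → pos v w) [1‥ length w ]

b2n : Bool → ℕ
b2n true  = 1
b2n false = 0

des : List ℕ → ℕ
des (x ∷ y ∷ r) = b2n (y <ᵇ x) ℕ.+ des (y ∷ r)
des _           = 0

pk : List ℕ → ℕ
pk (x ∷ y ∷ z ∷ r) = b2n ((x <ᵇ y) ∧ (z <ᵇ y)) ℕ.+ pk (y ∷ z ∷ r)
pk _               = 0

ides : List ℕ → ℕ
ides π = des (inverse π)

ipk : List ℕ → ℕ
ipk π = pk (inverse π)

increasing : List ℕ → Bool
increasing (x ∷ y ∷ r) = (x <ᵇ y) ∧ increasing (y ∷ r)
increasing _           = true

decreasing : List ℕ → Bool
decreasing (x ∷ y ∷ r) = (y <ᵇ x) ∧ decreasing (y ∷ r)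
decreasing _           = true

monotone : List ℕ → Bool
monotone l = increasing l ∨ decreasing l

segment : List ℕ → ℕ → ℕ → List ℕ
segment w i j = take (suc (j ∸ i)) (drop i w)

-- [i, j] (0-based, i ≤ j < length w) is a birun: monotone and not properly
-- contained in a longer monotone consecutive segment (it suffices to test
-- one-step extensions, since sub-segments of monotone segments are monotone)
isBirun : List ℕ → ℕ → ℕ → Bool
isBirun w i j =
  (j <ᵇ length w) ∧ ((i <ᵇ j) ∨ (i ≡ᵇ j)) ∧ monotone (segment w i j)
  ∧ not ((0 <ᵇ i) ∧ monotone (segment w (i ∸ 1) j))
  ∧ not ((suc j <ᵇ length w) ∧ monotone (segment w i (suc j)))

countN : ℕ → (ℕ → ℕ) → ℕ
countN zero    f = 0
countN (suc n) f = countN n f ℕ.+ f n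

br : List ℕ → ℕ
br w = countN (length w) λ i → countN (length w) λ j → b2n (isBirun w i j)

-- Formal power series in s, t, x over ℚ:  f a b c = [s^a t^b x^c] f

FPS : Set
FPS = ℕ → ℕ → ℕ → ℚ

Σ< : ℕ → (ℕ → ℚ) → ℚ
Σ< zero    f = 0ℚ
Σ< (suc n) f = Σ< n f +ℚ f n

_≟ₙ_ : ℕ → ℕ → Bool
_≟ₙ_ = _≡ᵇ_

𝟘 𝟙 S T X : FPS
𝟘 a b c = 0ℚ
𝟙 a b c = if (a ≟ₙ 0) ∧ (b ≟ₙ 0) ∧ (c ≟ₙ 0) then 1ℚ else 0ℚ
S a b c = if (a ≟ₙ 1) ∧ (b ≟ₙ 0) ∧ (c ≟ₙ 0) then 1ℚ else 0ℚ
T a b c = if (a ≟ₙ 0) ∧ (b ≟ₙ 1) ∧ (c ≟ₙ 0) then 1ℚ else 0ℚ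
X a b c = if (a ≟ₙ 0) ∧ (b ≟ₙ 0) ∧ (c ≟ₙ 1) then 1ℚ else 0ℚ

infixl 6 _⊕_ _⊖_
infixl 7 _⊛_ _·_
infixr 8 _^^_

_⊕_ : FPS → FPS → FPS
(f ⊕ g) a b c = f a b c +ℚ g a b c

_·_ : ℚ → FPS → FPS
(q · f) a b c = q *ℚ f a b c

_⊖_ : FPS → FPS → FPS
f ⊖ g = f ⊕ (-ℚ 1ℚ) · g

_⊛_ : FPS → FPS → FPS
(f ⊛ g) a b c =
  Σ< (suc a) λ a₁ → Σ< (suc b) λ b₁ → Σ< (suc c) λ c₁ →
    f a₁ b₁ c₁ *ℚ g (a ∸ a₁) (b ∸ b₁) (c ∸ c₁)

_^^_ : FPS → ℕ → FPS
f ^^ zero  = 𝟙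
f ^^ suc k = f ⊛ (f ^^ k)

-- Sum of a family F with F k of order ≥ k (all monomials of total degree
-- ≥ k), so that the coefficient of s^a t^b x^c only receives
-- contributions from k ≤ a + b + c.
Σ∞ : (ℕ → FPS) → FPS
Σ∞ F a b c = Σ< (suc (a ℕ.+ b ℕ.+ c)) λ k → F k a b c

-- 1/(1 - f) = Σ_k f^k, for f with zero constant term
inv1- : FPS → FPS
inv1- f = Σ∞ (λ k → f ^^ k)

ΣL : {A : Set} → List A → (A → FPS) → FPS
ΣL []       F = 𝟘
ΣL (x ∷ xs) F = F x ⊕ ΣL xs F

P-br-ipk : ℕ → FPS → FPS → FPS
P-br-ipk n U V = ΣL (𝔖 n) λ π → (U ^^ br π) ⊛ (V ^^ suc (ipk π))

P-br-ides : ℕ → FPS → FPS → FPS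
P-br-ides n U V = ΣL (𝔖 n) λ π → (U ^^ br π) ⊛ (V ^^ suc (ides π))

-- q m d is the rational m / d (for d ≠ 0; used only with d = 1, 2, 4, 8)
q : ℕ → ℕ → ℚ
q m zero    = 0ℚ
q m (suc d) = (+ m) / suc d

inv1-s inv1-t inv1-s² inv1-x : FPS
inv1-s  = inv1- S
inv1-t  = inv1- T
inv1-s² = inv1- (S ⊛ S)
inv1-x  = inv1- X

sArg : FPS
sArg = q 2 1 · S ⊛ inv1- ((-ℚ 1ℚ) · (S ⊛ S))

tArg : FPS
tArg = q 4 1 · T ⊛ (inv1- ((-ℚ 1ℚ) · T) ^^ 2)

Y : FPS
Y = (𝟙 ⊕ X) ⊛ inv1-x

from2 : (ℕ → FPS) → ℕ → FPS
from2 F zero          = 𝟘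
from2 F (suc zero)    = 𝟘
from2 F (suc (suc m)) = F (suc (suc m))

LHS-a : FPS
LHS-a =
  inv1-s ⊛ inv1-t
  ⊕ q 2 1 · S ⊛ T ⊛ X ⊛ (inv1-s ^^ 2) ⊛ (inv1-t ^^ 2)
  ⊕ q 1 8 · ((𝟙 ⊕ S) ^^ 3) ⊛ inv1-s ⊛
      Σ∞ (from2 λ n →
        ((𝟙 ⊕ S ⊛ S) ^^ (n ∸ 1)) ⊛ ((𝟙 ⊕ T) ^^ suc n)
        ⊛ P-br-ipk n sArg tArg
        ⊛ (inv1-s² ^^ n) ⊛ (inv1-t ^^ suc n) ⊛ (X ^^ n))

RHS-a : FPS
RHS-a =
  Σ∞ λ i → Σ∞ λ j →
    (Y ^^ (2 ℕ.* i ℕ.* j)) ⊛ (𝟙 ⊕ S ⊛ (Y ^^ j)) ⊛ (S ^^ (2 ℕ.* i)) ⊛ (T ^^ j)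

LHS-b : FPS
LHS-b =
  inv1-s ⊛ inv1-t
  ⊕ S ⊛ T ⊛ X ⊛ (inv1-s ^^ 2) ⊛ (inv1-t ^^ 2)
  ⊕ q 1 4 · ((𝟙 ⊕ S) ^^ 3) ⊛ inv1-s ⊛
      Σ∞ (from2 λ n →
        ((𝟙 ⊕ S ⊛ S) ^^ (n ∸ 1))
        ⊛ P-br-ides n sArg T
        ⊛ (inv1-s² ^^ n) ⊛ (inv1-t ^^ suc n) ⊛ (X ^^ n))

RHS-b : FPS
RHS-b =
  q 1 2 · Σ∞ λ i → Σ∞ λ j →
    (Y ^^ (i ℕ.* j))
    ⊛ (q 2 1 · 𝟙 ⊕ S ⊛ (inv1-x ^^ j) ⊕ S ⊛ ((𝟙 ⊕ X) ^^ j))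
    ⊛ (S ^^ (2 ℕ.* i)) ⊛ (T ^^ j)

_≈ₛ_ : FPS → FPS → Set
f ≈ₛ g = ∀ a b c → f a b c ≡ g a b c
  where open import Relation.Binary.PropositionalEquality using (_≡_)

{-# OPTIONS --safe #-}
-- Call a cut of a word along ε ∈ {ascending, descending}ᵏ a division into k
-- consecutive, possibly empty blocks, the a-th of which is monotone of direction εₐ.
--
-- Left-hand sides.  A transfer computation along the ascents of π, one letter at a
-- time, shows that the numbers of cuts of π along the two alternating sequences of
-- length k, halved and summed against sᵏ, give ¼ (1+s)³/(1−s) (1+s²)ⁿ⁻¹/(1−s²)ⁿ
-- (2s/(1+s²))^br(π): two equal consecutive steps contribute the factor
-- (1+s²)/(1−s²), two different ones 2s/(1−s²).  In the same way the cuts of π⁻¹ along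
-- (descending, ascending)ʲ give the factor with ipk, and those along (ascending)ʲ the
-- one with ides.
--
-- Right-hand sides.  A permutation π with a cut of π⁻¹ along δ is the same as a word
-- in the letters of δ: removing the first letter of π removes the minimum of π⁻¹, and
-- a minimum fits into each block of π⁻¹ in exactly one place.  Under this
-- standardization, cuts of π along ε become cuts of the word along ε, for the order in
-- which a repeated letter b is an ascent exactly when δ_b is ascending.  Each block of
-- such a cut is a monotone word, so the generating function of all pairs is the
-- product over (a , b) of 1/(1−x) if εₐ = δ_b and 1+x otherwise.
module Submission where

open import Defs
open import Level using (0ℓ)
open import Algebra.Bundles using (CommutativeRing)
open import Algebra.Structures using (IsCommutativeRing)
open import Data.Bool using (Bool; true; false; if_then_else_; _∧_; _∨_; not)
import Data.Bool.Properties as Bool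
open import Data.List using (List; []; _∷_; _++_; map; length; take; drop; filter; filterᵇ; concatMap; applyUpTo; upTo)
import Data.List.Properties as List
open import Data.List.Relation.Unary.All as All using (All; []; _∷_)
import Data.List.Relation.Unary.All.Properties as All
open import Data.List.Relation.Unary.Linked using (Linked; []; [-]; _∷_)
import Data.List.Relation.Unary.Unique.DecPropositional as UniqueDec
open import Data.Nat as ℕ using (ℕ; zero; suc; _∸_; _≤_; _<_; _<ᵇ_; _≡ᵇ_; z≤n; s≤s)
import Data.Nat.Properties as ℕ
open import Data.Product using (_×_; _,_; proj₁; proj₂; ∃)
open import Data.Rational using (ℚ; 0ℚ; 1ℚ) renaming (_+_ to _+ℚ_; _*_ to _*ℚ_; -_ to -ℚ_)
import Data.Rational.Properties as ℚ
open import Data.Sum using (_⊎_; inj₁; inj₂)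
open import Data.Vec using (Vec; []; _∷_; updateAt; replicate)
open import Function using (_∘_; const)
open import Relation.Binary.PropositionalEquality using (_≡_; _≢_; refl; sym; trans; cong; cong₂; subst; module ≡-Reasoning)
open import Relation.Nullary using (does; contradiction)
open import Relation.Nullary.Decidable using (¬?)
open import Relation.Unary using (Decidable)

-- The two sides meet coefficient by coefficient: at sᵃ tᵇ xᶜ both are half the number of ways to
-- take a permutation π of [c], one of the two alternating sequences of length a, a cut of π along
-- it, and a cut of π⁻¹ along the b-th sequence δ. Hence the left is expanded in powers of x, the
-- right in powers of s and t, and each transfer computation lives in a single variable. Both
-- alternating sequences are taken because cuts along only one of them also detect whether the first
-- step of π goes up or down, which br does not. In (a) every block of π meets as many ascending as
-- descending letters and contributes Yʲ whatever its direction. In (b) only two neighbouring blocks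
-- together do; an odd a leaves one block over, which gives the terms with (1-x)⁻ʲ and (1+x)ʲ. The
-- cases n < 2 stand apart because br is one more than the number of changes of direction only if
-- there is a first step. Fractions never occur as quotients: 1/(1-f) is known through e = 1 + f e,
-- and a generating function through the recursion of its coefficients.

-- The ring of power series in three variables

module PowerSeries (R : CommutativeRing 0ℓ 0ℓ) where
  open CommutativeRing R renaming (refl to ≈-refl; sym to ≈-sym; trans to ≈-trans)
  open import Relation.Binary.Reasoning.Setoid setoid
  open import Algebra.Properties.CommutativeSemigroup +-commutativeSemigroup using (interchange; x∙yz≈y∙xz)

  Series : Set
  Series = ℕ → Carrier

  infix 4 _≋_
  _≋_ : Series → Series → Set
  f ≋ g = ∀ n → f n ≈ g n

  tail : Series → Series
  tail f n = f (suc n)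

  constant : Carrier → Series
  constant r zero    = r
  constant r (suc n) = 0#

  -- The Cauchy product is given by recursion on the left factor rather than as a sum over i + j =
  -- n, so that the ring laws are plain inductions.
  _⊞_ _⋆_ : Series → Series → Series
  (f ⊞ g) n = f n + g n
  (f ⋆ g) zero    = f 0 * g 0
  (f ⋆ g) (suc n) = f 0 * g (suc n) + (tail f ⋆ g) n

  ⋆-cong : ∀ {f f′ g g′} → f ≋ f′ → g ≋ g′ → (f ⋆ g) ≋ (f′ ⋆ g′)
  ⋆-cong p q zero    = *-cong (p 0) (q 0)
  ⋆-cong p q (suc n) = +-cong (*-cong (p 0) (q (suc n))) (⋆-cong (λ k → p (suc k)) q n)

  ⋆-distribʳ : ∀ h f g → ((f ⊞ g) ⋆ h) ≋ ((f ⋆ h) ⊞ (g ⋆ h))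
  ⋆-distribʳ h f g zero    = distribʳ (h 0) (f 0) (g 0)
  ⋆-distribʳ h f g (suc n) = ≈-trans (+-cong (distribʳ _ _ _) (⋆-distribʳ h (tail f) (tail g) n)) (interchange _ _ _ _)

  -- The recursion peels the left factor; commutativity needs the mirror form, which peels the right
  -- one.
  ⋆-sucʳ : ∀ f g n → (f ⋆ g) (suc n) ≈ f (suc n) * g 0 + (f ⋆ tail g) n
  ⋆-sucʳ f g zero    = +-comm _ _
  ⋆-sucʳ f g (suc n) = ≈-trans (+-congˡ (⋆-sucʳ (tail f) g n)) (x∙yz≈y∙xz _ _ _)

  ⋆-comm : ∀ f g → (f ⋆ g) ≋ (g ⋆ f)
  ⋆-comm f g zero    = *-comm _ _
  ⋆-comm f g (suc n) = ≈-trans (+-cong (*-comm _ _) (⋆-comm (tail f) g n)) (≈-sym (⋆-sucʳ g f n))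

  scale-⋆ : ∀ r f g n → ((λ k → r * f k) ⋆ g) n ≈ r * (f ⋆ g) n
  scale-⋆ r f g zero    = *-assoc _ _ _
  scale-⋆ r f g (suc n) = ≈-trans (+-cong (*-assoc _ _ _) (scale-⋆ r (tail f) g n)) (≈-sym (distribˡ _ _ _))

  ⋆-assoc : ∀ f g h → ((f ⋆ g) ⋆ h) ≋ (f ⋆ (g ⋆ h))
  ⋆-assoc f g h zero    = *-assoc _ _ _
  ⋆-assoc f g h (suc n) = begin
    (f 0 * g 0) * h (suc n) + (tail (f ⋆ g) ⋆ h) n
      ≈⟨ +-cong (*-assoc _ _ _) (⋆-distribʳ h (λ k → f 0 * tail g k) (tail f ⋆ g) n) ⟩
    f 0 * (g 0 * h (suc n)) + (((λ k → f 0 * tail g k) ⋆ h) n + ((tail f ⋆ g) ⋆ h) n)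
      ≈⟨ +-congˡ (+-cong (scale-⋆ (f 0) (tail g) h n) (⋆-assoc (tail f) g h n)) ⟩
    f 0 * (g 0 * h (suc n)) + (f 0 * (tail g ⋆ h) n + (tail f ⋆ (g ⋆ h)) n)
      ≈⟨ +-assoc _ _ _ ⟨
    (f 0 * (g 0 * h (suc n)) + f 0 * (tail g ⋆ h) n) + (tail f ⋆ (g ⋆ h)) n
      ≈⟨ +-congʳ (distribˡ _ _ _) ⟨
    f 0 * (g ⋆ h) (suc n) + (tail f ⋆ (g ⋆ h)) n ∎

  ⋆-zeroˡ : ∀ f → ((λ _ → 0#) ⋆ f) ≋ (λ _ → 0#)
  ⋆-zeroˡ f zero    = zeroˡ _
  ⋆-zeroˡ f (suc n) = ≈-trans (+-cong (zeroˡ _) (⋆-zeroˡ f n)) (+-identityˡ _)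

  ⋆-identityˡ : ∀ f → (constant 1# ⋆ f) ≋ f
  ⋆-identityˡ f zero    = *-identityˡ _
  ⋆-identityˡ f (suc n) = ≈-trans (+-cong (*-identityˡ _) (⋆-zeroˡ f n)) (+-identityʳ _)

  series-isCommutativeRing : IsCommutativeRing _≋_ _⊞_ _⋆_ (λ f n → - f n) (λ _ → 0#) (constant 1#)
  series-isCommutativeRing = record
    { isRing = record
      { +-isAbelianGroup = record
        { isGroup = record
          { isMonoid = record
            { isSemigroup = record
              { isMagma = record
                { isEquivalence = record
                  { refl = λ n → ≈-refl ; sym = λ p n → ≈-sym (p n) ; trans = λ p q n → ≈-trans (p n) (q n) }
                ; ∙-cong = λ p q n → +-cong (p n) (q n) }
              ; assoc = λ f g h n → +-assoc _ _ _ }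
            ; identity = (λ f n → +-identityˡ _) , (λ f n → +-identityʳ _) }
          ; inverse = (λ f n → -‿inverseˡ _) , (λ f n → -‿inverseʳ _)
          ; ⁻¹-cong = λ p n → -‿cong (p n) }
        ; comm = λ f g n → +-comm _ _ }
      ; *-cong = ⋆-cong
      ; *-assoc = ⋆-assoc
      ; *-identity = ⋆-identityˡ , (λ f n → ≈-trans (⋆-comm f (constant 1#) n) (⋆-identityˡ f n))
      ; distrib = (λ h f g n → ≈-trans (⋆-comm h (f ⊞ g) n) (≈-trans (⋆-distribʳ h f g n) (+-cong (⋆-comm f h n) (⋆-comm g h n))))
                , ⋆-distribʳ }
    ; *-comm = ⋆-comm }

  seriesRing : CommutativeRing 0ℓ 0ℓ
  seriesRing = record { isCommutativeRing = series-isCommutativeRing }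

-- Series in x, then in t over these, then in s: with this nesting `FPS` is literally the carrier of
-- `PS₃.seriesRing`.
module PS₁ = PowerSeries ℚ.+-*-commutativeRing
module PS₂ = PowerSeries PS₁.seriesRing
module PS₃ = PowerSeries PS₂.seriesRing

Σ<-cong : ∀ n {f g : ℕ → ℚ} → (∀ i → i < n → f i ≡ g i) → Σ< n f ≡ Σ< n g
Σ<-cong zero    p = refl
Σ<-cong (suc n) p = cong₂ _+ℚ_ (Σ<-cong n (λ i i<n → p i (ℕ.m<n⇒m<1+n i<n))) (p n ℕ.≤-refl)

Σ<-sucˡ : ∀ n f → Σ< (suc n) f ≡ f 0 +ℚ Σ< n (λ i → f (suc i))
Σ<-sucˡ zero    f = trans (ℚ.+-identityˡ (f 0)) (sym (ℚ.+-identityʳ (f 0)))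
Σ<-sucˡ (suc n) f = trans (cong (_+ℚ f (suc n)) (Σ<-sucˡ n f)) (ℚ.+-assoc (f 0) (Σ< n (λ i → f (suc i))) (f (suc n)))

-- The induction step shared by the three comparisons below, one for each level of nesting.
Σ<-unroll : ∀ (F : ℕ → ℕ → ℚ) n {r} → r ≡ Σ< (suc n) (λ i → F (suc i) (n ∸ i)) →
            F 0 (suc n) +ℚ r ≡ Σ< (suc (suc n)) (λ i → F i (suc n ∸ i))
Σ<-unroll F n p = trans (cong (F 0 (suc n) +ℚ_) p) (sym (Σ<-sucˡ (suc n) (λ i → F i (suc n ∸ i))))

⋆₁-Σ< : ∀ f g c → (f PS₁.⋆ g) c ≡ Σ< (suc c) (λ i → f i *ℚ g (c ∸ i))
⋆₁-Σ< f g zero    = sym (ℚ.+-identityˡ (f 0 *ℚ g 0))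
⋆₁-Σ< f g (suc c) = Σ<-unroll (λ i k → f i *ℚ g k) c (⋆₁-Σ< (PS₁.tail f) g c)

⋆₂-Σ< : ∀ f g b c → (f PS₂.⋆ g) b c ≡ Σ< (suc b) (λ i → (f i PS₁.⋆ g (b ∸ i)) c)
⋆₂-Σ< f g zero    c = sym (ℚ.+-identityˡ ((f 0 PS₁.⋆ g 0) c))
⋆₂-Σ< f g (suc b) c = Σ<-unroll (λ i k → (f i PS₁.⋆ g k) c) b (⋆₂-Σ< (PS₂.tail f) g b c)

⋆₃-Σ< : ∀ f g a b c → (f PS₃.⋆ g) a b c ≡ Σ< (suc a) (λ i → (f i PS₂.⋆ g (a ∸ i)) b c)
⋆₃-Σ< f g zero    b c = sym (ℚ.+-identityˡ ((f 0 PS₂.⋆ g 0) b c))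
⋆₃-Σ< f g (suc a) b c = Σ<-unroll (λ i k → (f i PS₂.⋆ g k) b c) a (⋆₃-Σ< (PS₃.tail f) g a b c)

-- _≈ₛ_ unfolds to a product, from which Agda cannot recover the two series.
infix 4 _≃_
record _≃_ (f g : FPS) : Set where
  constructor coeffwise
  field coeff : f ≈ₛ g
open _≃_ public

-- Every ring law of `_⊛_` is transported along this equivalence, so that triple sums are never
-- rearranged by hand.
⊛≃⋆ : ∀ f g → f ⊛ g ≃ f PS₃.⋆ g
⊛≃⋆ f g .coeff a b c = sym (trans (⋆₃-Σ< f g a b c)
  (Σ<-cong (suc a) λ i _ → trans (⋆₂-Σ< (f i) (g (a ∸ i)) b c)
  (Σ<-cong (suc b) λ j _ → ⋆₁-Σ< (f i j) (g (a ∸ i) (b ∸ j)) c)))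

𝟙≃one : 𝟙 ≃ PS₃.constant (PS₂.constant (PS₁.constant 1ℚ))
𝟙≃one .coeff zero    zero    zero    = refl
𝟙≃one .coeff zero    zero    (suc c) = refl
𝟙≃one .coeff zero    (suc b) c       = refl
𝟙≃one .coeff (suc a) b       c       = refl

private
  module R₃ = CommutativeRing PS₃.seriesRing

≃-refl : ∀ {f} → f ≃ f
≃-refl .coeff a b c = refl

≃-sym : ∀ {f g} → f ≃ g → g ≃ f
≃-sym p .coeff a b c = sym (coeff p a b c)

≃-trans : ∀ {f g h} → f ≃ g → g ≃ h → f ≃ h
≃-trans p q .coeff a b c = trans (coeff p a b c) (coeff q a b c)

⊛-cong : ∀ {f f′ g g′} → f ≃ f′ → g ≃ g′ → f ⊛ g ≃ f′ ⊛ g′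
⊛-cong {f} {f′} {g} {g′} p q =
  ≃-trans (⊛≃⋆ f g) (≃-trans (coeffwise (R₃.*-cong {f} {f′} {g} {g′} (coeff p) (coeff q))) (≃-sym (⊛≃⋆ f′ g′)))

⊛-comm : ∀ f g → f ⊛ g ≃ g ⊛ f
⊛-comm f g = ≃-trans (⊛≃⋆ f g) (≃-trans (coeffwise (R₃.*-comm f g)) (≃-sym (⊛≃⋆ g f)))

⊛-assoc : ∀ f g h → (f ⊛ g) ⊛ h ≃ f ⊛ (g ⊛ h)
⊛-assoc f g h =
  ≃-trans (⊛-cong {g = h} (⊛≃⋆ f g) ≃-refl) (≃-trans (⊛≃⋆ (f PS₃.⋆ g) h)
  (≃-trans (coeffwise (R₃.*-assoc f g h))
  (≃-trans (≃-sym (⊛≃⋆ f (g PS₃.⋆ h))) (⊛-cong {f} ≃-refl (≃-sym (⊛≃⋆ g h))))))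

⊛-identityˡ : ∀ f → 𝟙 ⊛ f ≃ f
⊛-identityˡ f = ≃-trans (⊛-cong {g = f} 𝟙≃one ≃-refl) (≃-trans (⊛≃⋆ _ f) (coeffwise (R₃.*-identityˡ f)))

⊕-cong : ∀ {f f′ g g′} → f ≃ f′ → g ≃ g′ → f ⊕ g ≃ f′ ⊕ g′
⊕-cong p q .coeff a b c = cong₂ _+ℚ_ (coeff p a b c) (coeff q a b c)

⊛-distribʳ : ∀ h f g → (f ⊕ g) ⊛ h ≃ f ⊛ h ⊕ g ⊛ h
⊛-distribʳ h f g =
  ≃-trans (⊛≃⋆ (f ⊕ g) h) (≃-trans (coeffwise (R₃.distribʳ h f g)) (⊕-cong (≃-sym (⊛≃⋆ f h)) (≃-sym (⊛≃⋆ g h))))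

FPS-isCommutativeRing : IsCommutativeRing _≃_ _⊕_ _⊛_ ((-ℚ 1ℚ) ·_) 𝟘 𝟙
FPS-isCommutativeRing = record
  { isRing = record
    { +-isAbelianGroup = record
      { isGroup = record
        { isMonoid = record
          { isSemigroup = record
            { isMagma = record
              { isEquivalence = record { refl = ≃-refl ; sym = ≃-sym ; trans = ≃-trans }
              ; ∙-cong = ⊕-cong }
            ; assoc = λ f g h → coeffwise λ a b c → ℚ.+-assoc (f a b c) (g a b c) (h a b c) }
          ; identity = (λ f → coeffwise λ a b c → ℚ.+-identityˡ (f a b c))
                     , (λ f → coeffwise λ a b c → ℚ.+-identityʳ (f a b c)) }
        ; inverse = (λ f → coeffwise λ a b c → trans (cong (_+ℚ f a b c) (-1*ℚ (f a b c))) (ℚ.+-inverseˡ (f a b c)))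
                  , (λ f → coeffwise λ a b c → trans (cong (f a b c +ℚ_) (-1*ℚ (f a b c))) (ℚ.+-inverseʳ (f a b c)))
        ; ⁻¹-cong = λ p → coeffwise λ a b c → cong (-ℚ 1ℚ *ℚ_) (coeff p a b c) }
      ; comm = λ f g → coeffwise λ a b c → ℚ.+-comm (f a b c) (g a b c) }
    ; *-cong = ⊛-cong
    ; *-assoc = ⊛-assoc
    ; *-identity = ⊛-identityˡ , (λ f → ≃-trans (⊛-comm f 𝟙) (⊛-identityˡ f))
    ; distrib = (λ h f g → ≃-trans (⊛-comm h (f ⊕ g))
                  (≃-trans (⊛-distribʳ h f g) (⊕-cong (⊛-comm f h) (⊛-comm g h))))
              , ⊛-distribʳ }
  ; *-comm = ⊛-comm }
  where
  -1*ℚ : ∀ x → -ℚ 1ℚ *ℚ x ≡ -ℚ x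
  -1*ℚ x = trans (sym (ℚ.neg-distribˡ-* 1ℚ x)) (cong -ℚ_ (ℚ.*-identityˡ x))

-- Multiplication by scalars and by powers of the variables

module SeriesVariable (R : CommutativeRing 0ℓ 0ℓ) where
  open CommutativeRing R renaming (refl to ≈-refl; sym to ≈-sym; trans to ≈-trans)
  open PowerSeries R

  const-⋆ : ∀ r g n → (constant r ⋆ g) n ≈ r * g n
  const-⋆ r g zero    = ≈-refl
  const-⋆ r g (suc n) = ≈-trans (+-congˡ (⋆-zeroˡ g n)) (+-identityʳ _)

  -- A variable is recognised by its coefficients: zero head, and tail equal to 1. The tail is only
  -- required up to `≋`, because `S`, `T` and `X` are defined by Boolean tests.
  module _ {var : Series} (f₀ : var 0 ≈ 0#) (fₛ : tail var ≋ constant 1#) where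
    var-⋆-zero : ∀ g → (var ⋆ g) 0 ≈ 0#
    var-⋆-zero g = ≈-trans (*-congʳ f₀) (zeroˡ _)

    var-⋆-suc : ∀ g n → (var ⋆ g) (suc n) ≈ g n
    var-⋆-suc g n = ≈-trans (+-cong (≈-trans (*-congʳ f₀) (zeroˡ _)) (≈-trans (⋆-cong fₛ (λ _ → ≈-refl) n) (⋆-identityˡ g n)))
                            (+-identityˡ _)

module V₁ = SeriesVariable ℚ.+-*-commutativeRing
module V₂ = SeriesVariable PS₁.seriesRing
module V₃ = SeriesVariable PS₂.seriesRing

module R = IsCommutativeRing FPS-isCommutativeRing

scalar-⋆ : ∀ r f a b c → (PS₃.constant (PS₂.constant (PS₁.constant r)) PS₃.⋆ f) a b c ≡ r *ℚ f a b c
scalar-⋆ r f a b c =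
  trans (V₃.const-⋆ (PS₂.constant (PS₁.constant r)) f a b c)
  (trans (V₂.const-⋆ (PS₁.constant r) (f a) b c) (V₁.const-⋆ r (f a b) c))

scalar≃ : ∀ r → r · 𝟙 ≃ PS₃.constant (PS₂.constant (PS₁.constant r))
scalar≃ r .coeff zero    zero    zero    = ℚ.*-identityʳ r
scalar≃ r .coeff zero    zero    (suc c) = ℚ.*-zeroʳ r
scalar≃ r .coeff zero    (suc b) c       = ℚ.*-zeroʳ r
scalar≃ r .coeff (suc a) b       c       = ℚ.*-zeroʳ r

·≃⊛ : ∀ r f → r · f ≃ (r · 𝟙) ⊛ f
·≃⊛ r f = ≃-sym (≃-trans (⊛-cong {g = f} (scalar≃ r) ≃-refl)
  (≃-trans (⊛≃⋆ _ f) (coeffwise (scalar-⋆ r f))))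

private
  S-tail : ∀ a b c → S (suc a) b c ≡ PS₃.constant (PS₂.constant (PS₁.constant 1ℚ)) a b c
  S-tail zero    zero    zero    = refl
  S-tail zero    zero    (suc c) = refl
  S-tail zero    (suc b) c       = refl
  S-tail (suc a) b       c       = refl

  T-row : ∀ b c → T 0 (suc b) c ≡ PS₂.constant (PS₁.constant 1ℚ) b c
  T-row zero    zero    = refl
  T-row zero    (suc c) = refl
  T-row (suc b) c       = refl

  T≃const : T ≃ PS₃.constant (T 0)
  T≃const .coeff zero    b c = refl
  T≃const .coeff (suc a) b c = refl

  X-row : ∀ c → X 0 0 (suc c) ≡ PS₁.constant 1ℚ c
  X-row zero    = refl
  X-row (suc c) = refl

  X≃const : X ≃ PS₃.constant (PS₂.constant (X 0 0))
  X≃const .coeff zero    zero    c = refl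
  X≃const .coeff zero    (suc b) c = refl
  X≃const .coeff (suc a) b       c = refl

  T⊛ : ∀ g a b c → (T ⊛ g) a b c ≡ (T 0 PS₂.⋆ g a) b c
  T⊛ g a b c = trans (coeff (⊛-cong {g = g} T≃const ≃-refl) a b c)
    (trans (coeff (⊛≃⋆ (PS₃.constant (T 0)) g) a b c) (V₃.const-⋆ (T 0) g a b c))

  X⊛ : ∀ g a b c → (X ⊛ g) a b c ≡ (X 0 0 PS₁.⋆ g a b) c
  X⊛ g a b c = trans (coeff (⊛-cong {g = g} X≃const ≃-refl) a b c)
    (trans (coeff (⊛≃⋆ (PS₃.constant (PS₂.constant (X 0 0))) g) a b c)
    (trans (V₃.const-⋆ (PS₂.constant (X 0 0)) g a b c) (V₂.const-⋆ (X 0 0) (g a) b c)))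

S⊛-zero : ∀ g b c → (S ⊛ g) 0 b c ≡ 0ℚ
S⊛-zero g b c = trans (coeff (⊛≃⋆ S g) 0 b c) (V₃.var-⋆-zero {S} (λ _ _ → refl) S-tail g b c)

S⊛-suc : ∀ g a b c → (S ⊛ g) (suc a) b c ≡ g a b c
S⊛-suc g a b c = trans (coeff (⊛≃⋆ S g) (suc a) b c) (V₃.var-⋆-suc {S} (λ _ _ → refl) S-tail g a b c)

T⊛-zero : ∀ g a c → (T ⊛ g) a 0 c ≡ 0ℚ
T⊛-zero g a c = trans (T⊛ g a 0 c) (V₂.var-⋆-zero {T 0} (λ _ → refl) T-row (g a) c)

T⊛-suc : ∀ g a b c → (T ⊛ g) a (suc b) c ≡ g a b c
T⊛-suc g a b c = trans (T⊛ g a (suc b) c) (V₂.var-⋆-suc {T 0} (λ _ → refl) T-row (g a) b c)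

X⊛-zero : ∀ g a b → (X ⊛ g) a b 0 ≡ 0ℚ
X⊛-zero g a b = trans (X⊛ g a b 0) (V₁.var-⋆-zero {X 0 0} refl X-row (g a b))

X⊛-suc : ∀ g a b c → (X ⊛ g) a b (suc c) ≡ g a b c
X⊛-suc g a b c = trans (X⊛ g a b (suc c)) (V₁.var-⋆-suc {X 0 0} refl X-row (g a b) c)

S^-< : ∀ u g a b c → a < u → ((S ^^ u) ⊛ g) a b c ≡ 0ℚ
S^-< (suc u) g zero    b c _         = trans (coeff (⊛-assoc S (S ^^ u) g) 0 b c) (S⊛-zero ((S ^^ u) ⊛ g) b c)
S^-< (suc u) g (suc a) b c (s≤s a<u) = trans (coeff (⊛-assoc S (S ^^ u) g) (suc a) b c)
  (trans (S⊛-suc ((S ^^ u) ⊛ g) a b c) (S^-< u g a b c a<u))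

S^-+ : ∀ u g a b c → ((S ^^ u) ⊛ g) (u ℕ.+ a) b c ≡ g a b c
S^-+ zero    g a b c = coeff (⊛-identityˡ g) a b c
S^-+ (suc u) g a b c = trans (coeff (⊛-assoc S (S ^^ u) g) (suc (u ℕ.+ a)) b c)
  (trans (S⊛-suc ((S ^^ u) ⊛ g) (u ℕ.+ a) b c) (S^-+ u g a b c))

T^-< : ∀ u g a b c → b < u → ((T ^^ u) ⊛ g) a b c ≡ 0ℚ
T^-< (suc u) g a zero    c _         = trans (coeff (⊛-assoc T (T ^^ u) g) a 0 c) (T⊛-zero ((T ^^ u) ⊛ g) a c)
T^-< (suc u) g a (suc b) c (s≤s b<u) = trans (coeff (⊛-assoc T (T ^^ u) g) a (suc b) c)
  (trans (T⊛-suc ((T ^^ u) ⊛ g) a b c) (T^-< u g a b c b<u))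

T^-+ : ∀ u g a b c → ((T ^^ u) ⊛ g) a (u ℕ.+ b) c ≡ g a b c
T^-+ zero    g a b c = coeff (⊛-identityˡ g) a b c
T^-+ (suc u) g a b c = trans (coeff (⊛-assoc T (T ^^ u) g) a (suc (u ℕ.+ b)) c)
  (trans (T⊛-suc ((T ^^ u) ⊛ g) a (u ℕ.+ b) c) (T^-+ u g a b c))

X^-< : ∀ u g a b c → c < u → ((X ^^ u) ⊛ g) a b c ≡ 0ℚ
X^-< (suc u) g a b zero    _         = trans (coeff (⊛-assoc X (X ^^ u) g) a b 0) (X⊛-zero ((X ^^ u) ⊛ g) a b)
X^-< (suc u) g a b (suc c) (s≤s c<u) = trans (coeff (⊛-assoc X (X ^^ u) g) a b (suc c))
  (trans (X⊛-suc ((X ^^ u) ⊛ g) a b c) (X^-< u g a b c c<u))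

X^-+ : ∀ u g a b c → ((X ^^ u) ⊛ g) a b (u ℕ.+ c) ≡ g a b c
X^-+ zero    g a b c = coeff (⊛-identityˡ g) a b c
X^-+ (suc u) g a b c = trans (coeff (⊛-assoc X (X ^^ u) g) a b (suc (u ℕ.+ c)))
  (trans (X⊛-suc ((X ^^ u) ⊛ g) a b (u ℕ.+ c)) (X^-+ u g a b c))

-- Truncated sums, order, and geometric series

Σ<-zero : ∀ n {f : ℕ → ℚ} → (∀ i → i < n → f i ≡ 0ℚ) → Σ< n f ≡ 0ℚ
Σ<-zero zero    p = refl
Σ<-zero (suc n) {f} p = trans (cong₂ _+ℚ_ (Σ<-zero n (λ i i<n → p i (ℕ.m<n⇒m<1+n i<n))) (p n ℕ.≤-refl)) (ℚ.+-identityˡ 0ℚ)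

-- The truncation point of `Σ∞` varies with the coefficient; padding by zeros brings two truncations
-- to a common length.
Σ<-pad : ∀ {m n} → m ≤ n → ∀ {f : ℕ → ℚ} → (∀ i → m ≤ i → f i ≡ 0ℚ) → Σ< m f ≡ Σ< n f
Σ<-pad {m} {n} m≤n {f} p = subst (λ k → Σ< m f ≡ Σ< k f) (ℕ.m∸n+n≡m m≤n) (go (n ∸ m))
  where
  go : ∀ k → Σ< m f ≡ Σ< (k ℕ.+ m) f
  go zero    = refl
  go (suc k) = trans (go k) (sym (trans (cong (Σ< (k ℕ.+ m) f +ℚ_) (p (k ℕ.+ m) (ℕ.m≤n+m m k))) (ℚ.+-identityʳ (Σ< (k ℕ.+ m) f))))

Σ<-single : ∀ n {f : ℕ → ℚ} k → k < n → (∀ i → i ≢ k → f i ≡ 0ℚ) → Σ< n f ≡ f k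
Σ<-single n {f} k k<n p = trans (sym (Σ<-pad {suc k} k<n (λ i k<i → p i (ℕ.>⇒≢ k<i))))
  (trans (cong (_+ℚ f k) (Σ<-zero k (λ i i<k → p i (ℕ.<⇒≢ i<k)))) (ℚ.+-identityˡ (f k)))

-- A coefficient of a product sees only coefficients of the factors at smaller or equal exponents.
-- This permits exchanging `Σ∞` for a finite sum inside a product.
⊛-local : ∀ f {g g′ : FPS} a b c →
          (∀ a′ b′ c′ → a′ ≤ a → b′ ≤ b → c′ ≤ c → g a′ b′ c′ ≡ g′ a′ b′ c′) → (f ⊛ g) a b c ≡ (f ⊛ g′) a b c
⊛-local f a b c p =
  Σ<-cong (suc a) λ i _ → Σ<-cong (suc b) λ j _ → Σ<-cong (suc c) λ k _ →
    cong (f i j k *ℚ_) (p (a ∸ i) (b ∸ j) (c ∸ k) (ℕ.m∸n≤m a i) (ℕ.m∸n≤m b j) (ℕ.m∸n≤m c k))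

Order : ℕ → FPS → Set
Order k f = ∀ a b c → a ℕ.+ b ℕ.+ c < k → f a b c ≡ 0ℚ

-- Either the constant term of f is taken, which is zero, or f uses up some degree and what is left
-- for g is strictly below k.
Order-⊛ : ∀ f g {k} → Order 1 f → Order k g → Order (suc k) (f ⊛ g)
Order-⊛ f g {k} of og a b c (s≤s lt) =
  Σ<-zero (suc a) λ i i≤a → Σ<-zero (suc b) λ j j≤b → Σ<-zero (suc c) λ l l≤c → term i j l (ℕ.≤-pred i≤a) (ℕ.≤-pred j≤b) (ℕ.≤-pred l≤c)
  where
  right : ∀ i j l → (a ∸ i) ℕ.+ (b ∸ j) ℕ.+ (c ∸ l) < a ℕ.+ b ℕ.+ c → f i j l *ℚ g (a ∸ i) (b ∸ j) (c ∸ l) ≡ 0ℚ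
  right i j l lt′ = trans (cong (f i j l *ℚ_) (og (a ∸ i) (b ∸ j) (c ∸ l) (ℕ.<-≤-trans lt′ lt))) (ℚ.*-zeroʳ (f i j l))
  term : ∀ i j l → i ≤ a → j ≤ b → l ≤ c → f i j l *ℚ g (a ∸ i) (b ∸ j) (c ∸ l) ≡ 0ℚ
  term zero    zero    zero    _ _ _ = trans (cong (_*ℚ g a b c) (of 0 0 0 (s≤s z≤n))) (ℚ.*-zeroˡ (g a b c))
  term zero    zero    (suc l) _ _ l≤c = right 0 0 (suc l)
    (ℕ.+-monoʳ-< (a ℕ.+ b) (ℕ.∸-monoʳ-< {c} {suc l} {0} (s≤s z≤n) l≤c))
  term zero    (suc j) l       _ j≤b _ = right 0 (suc j) l
    (ℕ.+-mono-<-≤ (ℕ.+-monoʳ-< a (ℕ.∸-monoʳ-< {b} {suc j} {0} (s≤s z≤n) j≤b)) (ℕ.m∸n≤m c l))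
  term (suc i) j       l       i≤a _ _ = right (suc i) j l
    (ℕ.+-mono-<-≤ (ℕ.+-mono-<-≤ (ℕ.∸-monoʳ-< {a} {suc i} {0} (s≤s z≤n) i≤a) (ℕ.m∸n≤m b j)) (ℕ.m∸n≤m c l))

Order-^^ : ∀ f → Order 1 f → ∀ k → Order k (f ^^ k)
Order-^^ f of zero    a b c ()
Order-^^ f of (suc k) = Order-⊛ f (f ^^ k) of (Order-^^ f of k)

Order-⊛X^ : ∀ f k → Order k (f ⊛ (X ^^ k))
Order-⊛X^ f k a b c lt = trans (coeff (⊛-comm f (X ^^ k)) a b c)
  (X^-< k f a b c (ℕ.≤-<-trans (ℕ.m≤n+m c (a ℕ.+ b)) lt))

ΣF< : ℕ → (ℕ → FPS) → FPS
ΣF< zero    F = 𝟘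
ΣF< (suc n) F = ΣF< n F ⊕ F n

ΣF<-coeff : ∀ n F a b c → ΣF< n F a b c ≡ Σ< n (λ k → F k a b c)
ΣF<-coeff zero    F a b c = refl
ΣF<-coeff (suc n) F a b c = cong (_+ℚ F n a b c) (ΣF<-coeff n F a b c)

⊛-ΣF< : ∀ f n F → f ⊛ ΣF< n F ≃ ΣF< n (λ k → f ⊛ F k)
⊛-ΣF< f zero    F = R.zeroʳ f
⊛-ΣF< f (suc n) F = ≃-trans (R.distribˡ f (ΣF< n F) (F n)) (⊕-cong (⊛-ΣF< f n F) (≃-refl {f ⊛ F n}))

-- All coefficients of `Σ∞ F` that enter have total degree at most a + b + c, so by the order
-- hypothesis the single truncation N is right for each of them, and a finite sum distributes.
⊛-Σ∞ : ∀ f F → (∀ k → Order k (F k)) → f ⊛ Σ∞ F ≃ Σ∞ (λ k → f ⊛ F k)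
⊛-Σ∞ f F o .coeff a b c =
  trans (⊛-local f {Σ∞ F} {ΣF< N F} a b c λ a′ b′ c′ a≤ b≤ c≤ →
    trans (Σ<-pad (s≤s (ℕ.+-mono-≤ (ℕ.+-mono-≤ a≤ b≤) c≤)) (λ k lt → o k a′ b′ c′ lt))
          (sym (ΣF<-coeff N F a′ b′ c′)))
  (trans (coeff (⊛-ΣF< f N F) a b c) (ΣF<-coeff N (λ k → f ⊛ F k) a b c))
  where N = suc (a ℕ.+ b ℕ.+ c)

Σ∞-cong : ∀ {F G} → (∀ k → F k ≃ G k) → Σ∞ F ≃ Σ∞ G
Σ∞-cong p .coeff a b c = Σ<-cong (suc (a ℕ.+ b ℕ.+ c)) (λ k _ → coeff (p k) a b c)

-- Multiplying by f shifts the powers by one; the power that the truncation then gains has too high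
-- an order to contribute. Everything later about 1/(1 - f) goes through this equation.
inv1-‿unfold : ∀ f → Order 1 f → inv1- f ≃ 𝟙 ⊕ f ⊛ inv1- f
inv1-‿unfold f of .coeff a b c =
  trans (Σ<-sucˡ N (λ k → (f ^^ k) a b c))
  (cong (𝟙 a b c +ℚ_) (trans (Σ<-pad (ℕ.n≤1+n N) (λ k N≤k → Order-^^ f of (suc k) a b c (s≤s N≤k)))
    (sym (coeff (⊛-Σ∞ f (f ^^_) (Order-^^ f of)) a b c))))
  where N = a ℕ.+ b ℕ.+ c

Order-S : Order 1 S
Order-S zero zero zero _ = refl
Order-S zero zero (suc c) (s≤s ())
Order-S zero (suc b) c (s≤s ())
Order-S (suc a) b c (s≤s ())

Order-T : Order 1 T
Order-T zero zero zero _ = refl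
Order-T zero zero (suc c) (s≤s ())
Order-T zero (suc b) c (s≤s ())
Order-T (suc a) b c (s≤s ())

Order-X : Order 1 X
Order-X zero zero zero _ = refl
Order-X zero zero (suc c) (s≤s ())
Order-X zero (suc b) c (s≤s ())
Order-X (suc a) b c (s≤s ())

Order-S² : Order 1 (S ⊛ S)
Order-S² a b c lt = Order-⊛ S S {1} Order-S Order-S a b c (ℕ.<-≤-trans lt (s≤s z≤n))

Order-· : ∀ r f {k} → Order k f → Order k (r · f)
Order-· r f o a b c lt = trans (cong (r *ℚ_) (o a b c lt)) (ℚ.*-zeroʳ r)

-- Finite sums of natural numbers

module Counting where
  open import Data.Nat using (_+_; _*_)
  open import Data.Fin using (Fin; zero; suc)
  open import Algebra.Properties.CommutativeSemigroup ℕ.+-commutativeSemigroup using (interchange) renaming (x∙yz≈y∙xz to x+[y+z])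

  countN-cong : ∀ n {f g : ℕ → ℕ} → (∀ i → i < n → f i ≡ g i) → countN n f ≡ countN n g
  countN-cong zero    p = refl
  countN-cong (suc n) p = cong₂ _+_ (countN-cong n (λ i i<n → p i (ℕ.m<n⇒m<1+n i<n))) (p n ℕ.≤-refl)

  countN-zero : ∀ n {f : ℕ → ℕ} → (∀ i → i < n → f i ≡ 0) → countN n f ≡ 0
  countN-zero zero    p = refl
  countN-zero (suc n) p = cong₂ _+_ (countN-zero n (λ i i<n → p i (ℕ.m<n⇒m<1+n i<n))) (p n ℕ.≤-refl)

  countN-+ : ∀ n (f g : ℕ → ℕ) → countN n (λ i → f i + g i) ≡ countN n f + countN n g
  countN-+ zero    f g = refl
  countN-+ (suc n) f g = trans (cong (_+ (f n + g n)) (countN-+ n f g)) (interchange (countN n f) (countN n g) (f n) (g n))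

  countN-*ˡ : ∀ n k (f : ℕ → ℕ) → countN n (λ i → k * f i) ≡ k * countN n f
  countN-*ˡ zero    k f = sym (ℕ.*-zeroʳ k)
  countN-*ˡ (suc n) k f = trans (cong (_+ k * f n) (countN-*ˡ n k f)) (sym (ℕ.*-distribˡ-+ k (countN n f) (f n)))

  countN-sucˡ : ∀ n (f : ℕ → ℕ) → countN (suc n) f ≡ f 0 + countN n (λ i → f (suc i))
  countN-sucˡ zero    f = sym (ℕ.+-identityʳ (f 0))
  countN-sucˡ (suc n) f = trans (cong (_+ f (suc n)) (countN-sucˡ n f)) (ℕ.+-assoc (f 0) _ _)

  countN-split : ∀ m n (f : ℕ → ℕ) → countN (m + n) f ≡ countN m f + countN n (λ i → f (m + i))
  countN-split zero    n f = refl
  countN-split (suc m) n f = begin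
    countN (suc (m + n)) f                                   ≡⟨ countN-sucˡ (m + n) f ⟩
    f 0 + countN (m + n) (λ i → f (suc i))                   ≡⟨ cong (f 0 +_) (countN-split m n (λ i → f (suc i))) ⟩
    f 0 + (countN m (λ i → f (suc i)) + _)                   ≡⟨ ℕ.+-assoc (f 0) _ _ ⟨
    f 0 + countN m (λ i → f (suc i)) + _                     ≡⟨ cong (_+ countN n (λ i → f (suc m + i))) (countN-sucˡ m f) ⟨
    countN (suc m) f + countN n (λ i → f (suc m + i))        ∎
    where open ≡-Reasoning

  -- Induction on n adds the row i = n of the triangle j ≤ i < n, which lengthens each column j < n
  -- by one entry and opens the column j = n.
  countN-triangle : ∀ n (g : ℕ → ℕ → ℕ) →
    countN n (λ i → countN (suc i) (λ j → g i j)) ≡ countN n (λ j → countN (n ∸ j) (λ k → g (j + k) j))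
  countN-triangle zero    g = refl
  countN-triangle (suc n) g = begin
    countN n (λ i → countN (suc i) (g i)) + countN (suc n) (g n)
      ≡⟨ cong (_+ countN (suc n) (g n)) (countN-triangle n g) ⟩
    countN n (λ j → countN (n ∸ j) (λ k → g (j + k) j)) + (countN n (g n) + g n n)
      ≡⟨ ℕ.+-assoc (countN n (λ j → countN (n ∸ j) (λ k → g (j + k) j))) _ _ ⟨
    countN n (λ j → countN (n ∸ j) (λ k → g (j + k) j)) + countN n (g n) + g n n
      ≡⟨ cong₂ _+_ (countN-+ n (λ j → countN (n ∸ j) (λ k → g (j + k) j)) (g n)) (last n) ⟨
    countN n (λ j → countN (n ∸ j) (λ k → g (j + k) j) + g n j) + countN (suc n ∸ n) (λ k → g (n + k) n)
      ≡⟨ cong (_+ countN (suc n ∸ n) (λ k → g (n + k) n)) (countN-cong n (λ j j<n → sym (inner j (ℕ.<⇒≤ j<n)))) ⟩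
    countN (suc n) (λ j → countN (suc n ∸ j) (λ k → g (j + k) j)) ∎
    where
    open ≡-Reasoning
    inner : ∀ j → j ≤ n → countN (suc n ∸ j) (λ k → g (j + k) j) ≡ countN (n ∸ j) (λ k → g (j + k) j) + g n j
    inner j j≤n rewrite ℕ.+-∸-assoc 1 j≤n | ℕ.m+[n∸m]≡n j≤n = refl
    last : ∀ n → countN (suc n ∸ n) (λ k → g (n + k) n) ≡ g n n
    last n rewrite ℕ.m+n∸n≡m 1 n | ℕ.+-identityʳ n = refl

  -- Think of v as the place where a letter is inserted and of the second argument of h as the size
  -- of the first block afterwards. Either the letter lands beyond that block, or the block contains
  -- it and had size l before. Both sums are then arranged by the size l before the insertion.
  countN-splitSquare : ∀ n (h : ℕ → ℕ → ℕ) →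
    countN (suc n) (λ v → countN (suc (suc n)) (h v))
    ≡ countN (suc n) (λ l → countN (suc n ∸ l) (λ v → h (l + v) l)) + countN (suc n) (λ l → countN (suc l) (λ v → h v (suc l)))
  countN-splitSquare n h = begin
    countN (suc n) (λ v → countN (suc (suc n)) (h v))
      ≡⟨ countN-cong (suc n) (λ v v≤n → split v (ℕ.<⇒≤ v≤n)) ⟩
    countN (suc n) (λ v → countN (suc v) (h v) + countN (suc n ∸ v) (λ k → h v (suc (v + k))))
      ≡⟨ countN-+ (suc n) _ _ ⟩
    countN (suc n) (λ v → countN (suc v) (h v)) + countN (suc n) (λ v → countN (suc n ∸ v) (λ k → h v (suc (v + k))))
      ≡⟨ cong₂ _+_ (countN-triangle (suc n) h) (sym (countN-triangle (suc n) (λ i j → h j (suc i)))) ⟩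
    countN (suc n) (λ l → countN (suc n ∸ l) (λ v → h (l + v) l)) + countN (suc n) (λ l → countN (suc l) (λ v → h v (suc l))) ∎
    where
    open ≡-Reasoning
    split : ∀ v → v ≤ suc n → countN (suc (suc n)) (h v) ≡ countN (suc v) (h v) + countN (suc n ∸ v) (λ k → h v (suc (v + k)))
    split v v≤n = trans (cong (λ N → countN (suc N) (h v)) (sym (ℕ.m+[n∸m]≡n v≤n))) (countN-split (suc v) (suc n ∸ v) (h v))

  ΣFin : ∀ m → (Fin m → ℕ) → ℕ
  ΣFin zero    f = 0
  ΣFin (suc m) f = f zero + ΣFin m (λ b → f (suc b))

  ΣFin-cong : ∀ m {f g : Fin m → ℕ} → (∀ b → f b ≡ g b) → ΣFin m f ≡ ΣFin m g
  ΣFin-cong zero    p = refl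
  ΣFin-cong (suc m) p = cong₂ _+_ (p zero) (ΣFin-cong m (λ b → p (suc b)))

  ΣFin-+ : ∀ m (f g : Fin m → ℕ) → ΣFin m (λ b → f b + g b) ≡ ΣFin m f + ΣFin m g
  ΣFin-+ zero    f g = refl
  ΣFin-+ (suc m) f g = trans (cong (f zero + g zero +_) (ΣFin-+ m _ _)) (interchange (f zero) (g zero) _ _)

  ΣFin-*ˡ : ∀ m k (f : Fin m → ℕ) → ΣFin m (λ b → k * f b) ≡ k * ΣFin m f
  ΣFin-*ˡ zero    k f = sym (ℕ.*-zeroʳ k)
  ΣFin-*ˡ (suc m) k f = trans (cong (k * f zero +_) (ΣFin-*ˡ m k _)) (sym (ℕ.*-distribˡ-+ k (f zero) _))

  ΣFin-zero : ∀ m {f : Fin m → ℕ} → (∀ b → f b ≡ 0) → ΣFin m f ≡ 0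
  ΣFin-zero zero    p = refl
  ΣFin-zero (suc m) p = cong₂ _+_ (p zero) (ΣFin-zero m (λ b → p (suc b)))

  countN-ΣFin : ∀ n m (f : ℕ → Fin m → ℕ) → countN n (λ i → ΣFin m (f i)) ≡ ΣFin m (λ b → countN n (λ i → f i b))
  countN-ΣFin zero    m f = sym (ΣFin-zero m (λ _ → refl))
  countN-ΣFin (suc n) m f = trans (cong (_+ ΣFin m (f n)) (countN-ΣFin n m f)) (sym (ΣFin-+ m _ _))

  -- Cuts of a word and insertion of a minimum

  infix 5 _≟ᵇ_
  _≟ᵇ_ : Bool → Bool → Bool
  true  ≟ᵇ b = b
  false ≟ᵇ b = not b

  insertAt : {A : Set} → ℕ → A → List A → List A
  insertAt zero    z σ       = z ∷ σ
  insertAt (suc v) z []      = z ∷ []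
  insertAt (suc v) z (x ∷ σ) = x ∷ insertAt v z σ

  length-insertAt : ∀ {A : Set} v (z : A) σ → length (insertAt v z σ) ≡ suc (length σ)
  length-insertAt zero    z σ       = refl
  length-insertAt (suc v) z []      = refl
  length-insertAt (suc v) z (x ∷ σ) = cong suc (length-insertAt v z σ)

  take-insertAt-≤ : ∀ {A : Set} l v (z : A) σ → l ≤ length σ → take l (insertAt (l + v) z σ) ≡ take l σ
  take-insertAt-≤ zero    v z σ       _       = refl
  take-insertAt-≤ (suc l) v z (x ∷ σ) (s≤s p) = cong (x ∷_) (take-insertAt-≤ l v z σ p)

  drop-insertAt-≤ : ∀ {A : Set} l v (z : A) σ → l ≤ length σ → drop l (insertAt (l + v) z σ) ≡ insertAt v z (drop l σ)
  drop-insertAt-≤ zero    v z σ       _       = refl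
  drop-insertAt-≤ (suc l) v z (x ∷ σ) (s≤s p) = drop-insertAt-≤ l v z σ p

  take-insertAt-> : ∀ {A : Set} l v (z : A) σ → v ≤ l → l ≤ length σ → take (suc l) (insertAt v z σ) ≡ insertAt v z (take l σ)
  take-insertAt-> l       zero    z σ       _       _       = refl
  take-insertAt-> (suc l) (suc v) z (x ∷ σ) (s≤s p) (s≤s q) = cong (x ∷_) (take-insertAt-> l v z σ p q)

  drop-insertAt-> : ∀ {A : Set} l v (z : A) σ → v ≤ l → l ≤ length σ → drop (suc l) (insertAt v z σ) ≡ drop l σ
  drop-insertAt-> l       zero    z σ       _       _       = refl
  drop-insertAt-> (suc l) (suc v) z (x ∷ σ) (s≤s p) (s≤s q) = drop-insertAt-> l v z σ p q

  -- Where a new minimum of label b goes, given the sizes μ of the blocks.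
  slot : ∀ {m} → Vec Bool m → Fin m → Vec ℕ m → ℕ
  slot (d ∷ ds) zero    (l ∷ μ) = if d then 0 else l
  slot (d ∷ ds) (suc b) (l ∷ μ) = l + slot ds b μ

  -- Generic in the ascent relation, since cuts are taken of words of numbers and of words of
  -- letters; on letters `asc` need not be irreflexive.
  module Cuts {A : Set} (asc : A → A → Bool) where

    mono : Bool → List A → Bool
    mono d (x ∷ y ∷ r) = (asc x y ≟ᵇ d) ∧ mono d (y ∷ r)
    mono d _           = true

    -- Sum of f μ over all ways μ of cutting the word into consecutive, possibly
    -- empty, blocks that are monotone of the prescribed directions.
    cutSum : ∀ {m} → Vec Bool m → List A → (Vec ℕ m → ℕ) → ℕ
    cutSum []       []      f = f []
    cutSum []       (_ ∷ _) f = 0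
    cutSum (d ∷ ds) σ       f =
      countN (suc (length σ)) λ l → b2n (mono d (take l σ)) * cutSum ds (drop l σ) (λ μ → f (l ∷ μ))

    cutSum-cong : ∀ {m} (δ : Vec Bool m) σ {f g} → (∀ μ → f μ ≡ g μ) → cutSum δ σ f ≡ cutSum δ σ g
    cutSum-cong []       []      p = p []
    cutSum-cong []       (_ ∷ _) p = refl
    cutSum-cong (d ∷ ds) σ       p =
      countN-cong (suc (length σ)) λ l _ → cong (b2n (mono d (take l σ)) *_) (cutSum-cong ds (drop l σ) (λ μ → p (l ∷ μ)))

    cutSum-*ˡ : ∀ {m} (δ : Vec Bool m) σ k f → cutSum δ σ (λ μ → k * f μ) ≡ k * cutSum δ σ f
    cutSum-*ˡ []       []      k f = refl
    cutSum-*ˡ []       (_ ∷ _) k f = sym (ℕ.*-zeroʳ k)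
    cutSum-*ˡ (d ∷ ds) σ       k f = trans
      (countN-cong (suc (length σ)) λ l _ →
        trans (cong (b2n (mono d (take l σ)) *_) (cutSum-*ˡ ds (drop l σ) k _)) (swap (b2n (mono d (take l σ))) k _))
      (countN-*ˡ (suc (length σ)) k _)
      where
      swap : ∀ x y z → x * (y * z) ≡ y * (x * z)
      swap x y z = trans (sym (ℕ.*-assoc x y z)) (trans (cong (_* z) (ℕ.*-comm x y)) (ℕ.*-assoc y x z))

    -- Both comparisons are recorded, as `asc` is an arbitrary Boolean relation and neither
    -- determines the other.
    IsMin : A → List A → Set
    IsMin z = All (λ y → asc z y ≡ true × asc y z ≡ false)

    mono-∷-false : ∀ d x w → mono d w ≡ false → mono d (x ∷ w) ≡ false
    mono-∷-false d x (y ∷ w) p = trans (cong (_ ∧_) p) (Bool.∧-zeroʳ _)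

    mono-true-insertAt : ∀ v x z ρ → asc x z ≡ false → IsMin z ρ → mono true (x ∷ insertAt v z ρ) ≡ false
    mono-true-insertAt zero    x z ρ       x>z _       rewrite x>z = refl
    mono-true-insertAt (suc v) x z []      x>z _       rewrite x>z = refl
    mono-true-insertAt (suc v) x z (y ∷ ρ) x>z (m ∷ ms) = mono-∷-false true x (y ∷ insertAt v z ρ) (mono-true-insertAt v y z ρ (proj₂ m) ms)

    mono-false-insertAt : ∀ v z ρ → v < length ρ → IsMin z ρ → mono false (insertAt v z ρ) ≡ false
    mono-false-insertAt zero    z (y ∷ ρ) _       (m ∷ _)  rewrite proj₁ m = refl
    mono-false-insertAt (suc v) z (y ∷ ρ) (s≤s p) (_ ∷ ms) = mono-∷-false false y (insertAt v z ρ) (mono-false-insertAt v z ρ p ms)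

    mono-true-min : ∀ z ρ → IsMin z ρ → mono true (z ∷ ρ) ≡ mono true ρ
    mono-true-min z []      _       = refl
    mono-true-min z (y ∷ ρ) (m ∷ _) rewrite proj₁ m = refl

    mono-false-min : ∀ z ρ → IsMin z ρ → mono false (insertAt (length ρ) z ρ) ≡ mono false ρ
    mono-false-min z []          _              = refl
    mono-false-min z (y ∷ [])    (m ∷ [])       rewrite proj₂ m = refl
    mono-false-min z (x ∷ y ∷ ρ) (_ ∷ ms)       = cong ((asc x y ≟ᵇ false) ∧_) (mono-false-min z (y ∷ ρ) ms)

    -- In an ascending block a letter before the minimum would make a descent, in a descending block
    -- a letter after it an ascent. Only the front, respectively the end, survives.
    block-insert : ∀ d z ρ (C : ℕ → ℕ) → IsMin z ρ →
      countN (suc (length ρ)) (λ v → b2n (mono d (insertAt v z ρ)) * C v) ≡ b2n (mono d ρ) * C (if d then 0 else length ρ)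
    block-insert true z ρ C m = trans (countN-sucˡ (length ρ) _)
      (trans (cong₂ _+_ (cong (λ t → b2n t * C 0) (mono-true-min z ρ m))
                        (countN-zero (length ρ) (λ v v< → cong (λ t → b2n t * C (suc v)) (rest ρ v v< m))))
      (ℕ.+-identityʳ _))
      where
      rest : ∀ ρ v → v < length ρ → IsMin z ρ → mono true (insertAt (suc v) z ρ) ≡ false
      rest (y ∷ ρ) v _ (m ∷ ms) = mono-true-insertAt v y z ρ (proj₂ m) ms
    block-insert false z ρ C m =
      cong₂ _+_ (countN-zero (length ρ) (λ v v< → cong (λ t → b2n t * C v) (mono-false-insertAt v z ρ v< m)))
                (cong (λ t → b2n t * C (length ρ)) (mono-false-min z ρ m))

    -- A cut of the longer word is determined by the block b that receives z and the cut left after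
    -- removing z. The weight f depends on the place as well as on the sizes, because
    -- standardization has to remember both.
    cutSum-insert : ∀ {m} (δ : Vec Bool m) z σ (f : ℕ → Vec ℕ m → ℕ) → IsMin z σ →
      countN (suc (length σ)) (λ v → cutSum δ (insertAt v z σ) (f v))
      ≡ ΣFin m (λ b → cutSum δ σ (λ μ → f (slot δ b μ) (updateAt μ b suc)))
    cutSum-insert [] z σ f m = countN-zero (suc (length σ)) (λ v _ → nonempty v σ)
      where
      nonempty : ∀ v σ → cutSum [] (insertAt v z σ) (f v) ≡ 0
      nonempty zero    σ       = refl
      nonempty (suc v) []      = refl
      nonempty (suc v) (x ∷ σ) = refl
    cutSum-insert {suc m} (d ∷ ds) z σ f min = begin
      countN (suc n) (λ v → countN (suc (length (insertAt v z σ))) (h v))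
        ≡⟨ countN-cong (suc n) (λ v _ → cong (λ N → countN (suc N) (h v)) (length-insertAt v z σ)) ⟩
      countN (suc n) (λ v → countN (suc (suc n)) (h v))
        ≡⟨ countN-splitSquare n h ⟩
      countN (suc n) (λ l → countN (suc n ∸ l) (λ v → h (l + v) l)) + countN (suc n) (λ l → countN (suc l) (λ v → h v (suc l)))
        ≡⟨ cong₂ _+_ (trans (countN-cong (suc n) after) later) (countN-cong (suc n) inside) ⟩
      ΣFin m (λ b → cutSum (d ∷ ds) σ (λ μ → f (slot (d ∷ ds) (suc b) μ) (updateAt μ (suc b) suc)))
      + cutSum (d ∷ ds) σ (λ μ → f (slot (d ∷ ds) zero μ) (updateAt μ zero suc))
        ≡⟨ ℕ.+-comm (ΣFin m (λ b → cutSum (d ∷ ds) σ (λ μ → f (slot (d ∷ ds) (suc b) μ) (updateAt μ (suc b) suc)))) _ ⟩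
      ΣFin (suc m) (λ b → cutSum (d ∷ ds) σ (λ μ → f (slot (d ∷ ds) b μ) (updateAt μ b suc))) ∎
      where
      open ≡-Reasoning
      n = length σ
      h : ℕ → ℕ → ℕ
      h v l = b2n (mono d (take l (insertAt v z σ))) * cutSum ds (drop l (insertAt v z σ)) (λ μ → f v (l ∷ μ))
      M : ℕ → ℕ
      M l = b2n (mono d (take l σ))
      -- The minimum lies beyond the first block, which stays intact; induction applies to the
      -- remaining word.
      after : ∀ l → l < suc n → countN (suc n ∸ l) (λ v → h (l + v) l)
        ≡ M l * ΣFin m (λ b → cutSum ds (drop l σ) (λ μ → f (l + slot ds b μ) (l ∷ updateAt μ b suc)))
      after l (s≤s l≤n) = begin
        countN (suc n ∸ l) (λ v → h (l + v) l)
          ≡⟨ cong (λ N → countN N (λ v → h (l + v) l)) (trans (ℕ.+-∸-assoc 1 l≤n) (cong suc (sym (List.length-drop l σ)))) ⟩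
        countN (suc (length (drop l σ))) (λ v → h (l + v) l)
          ≡⟨ countN-cong (suc (length (drop l σ))) (λ v _ → cong₂ (λ p q → b2n (mono d p) * cutSum ds q (λ μ → f (l + v) (l ∷ μ)))
               (take-insertAt-≤ l v z σ l≤n) (drop-insertAt-≤ l v z σ l≤n)) ⟩
        countN (suc (length (drop l σ))) (λ v → M l * cutSum ds (insertAt v z (drop l σ)) (λ μ → f (l + v) (l ∷ μ)))
          ≡⟨ countN-*ˡ (suc (length (drop l σ))) (M l) _ ⟩
        M l * countN (suc (length (drop l σ))) (λ v → cutSum ds (insertAt v z (drop l σ)) (λ μ → f (l + v) (l ∷ μ)))
          ≡⟨ cong (M l *_) (cutSum-insert ds z (drop l σ) (λ v μ → f (l + v) (l ∷ μ)) (All.drop⁺ l min)) ⟩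
        M l * ΣFin m (λ b → cutSum ds (drop l σ) (λ μ → f (l + slot ds b μ) (l ∷ updateAt μ b suc))) ∎
      later : countN (suc n) (λ l → M l * ΣFin m (λ b → cutSum ds (drop l σ) (λ μ → f (l + slot ds b μ) (l ∷ updateAt μ b suc))))
        ≡ ΣFin m (λ b → cutSum (d ∷ ds) σ (λ μ → f (slot (d ∷ ds) (suc b) μ) (updateAt μ (suc b) suc)))
      later = trans (countN-cong (suc n) (λ l _ → sym (ΣFin-*ˡ m (M l) _))) (countN-ΣFin (suc n) m _)
      -- The first block receives the minimum and grows from l to l + 1, while the rest of the word
      -- stays intact.
      inside : ∀ l → l < suc n → countN (suc l) (λ v → h v (suc l))
        ≡ M l * cutSum ds (drop l σ) (λ μ → f (if d then 0 else l) (suc l ∷ μ))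
      inside l (s≤s l≤n) = begin
        countN (suc l) (λ v → h v (suc l))
          ≡⟨ countN-cong (suc l) (λ { v (s≤s v≤l) → cong₂ (λ p q → b2n (mono d p) * cutSum ds q (λ μ → f v (suc l ∷ μ)))
               (take-insertAt-> l v z σ v≤l l≤n) (drop-insertAt-> l v z σ v≤l l≤n) }) ⟩
        countN (suc l) (λ v → b2n (mono d (insertAt v z (take l σ))) * C v)
          ≡⟨ cong (λ N → countN (suc N) (λ v → b2n (mono d (insertAt v z (take l σ))) * C v)) (sym len) ⟩
        countN (suc (length (take l σ))) (λ v → b2n (mono d (insertAt v z (take l σ))) * C v)
          ≡⟨ block-insert d z (take l σ) C (All.take⁺ l min) ⟩
        M l * C (if d then 0 else length (take l σ))
          ≡⟨ cong (λ N → M l * C (if d then 0 else N)) len ⟩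
        M l * C (if d then 0 else l) ∎
        where
        C : ℕ → ℕ
        C v = cutSum ds (drop l σ) (λ μ → f v (suc l ∷ μ))
        len : length (take l σ) ≡ l
        len = trans (List.length-take l σ) (ℕ.m≤n⇒m⊓n≡m l≤n)

  -- The order-preserving injection ℕ → ℕ whose image omits v.
  shift : ℕ → ℕ → ℕ
  shift zero    y       = suc y
  shift (suc v) zero    = zero
  shift (suc v) (suc y) = suc (shift v y)

  shift-<ᵇ : ∀ v x y → (shift v x <ᵇ shift v y) ≡ (x <ᵇ y)
  shift-<ᵇ zero    x       y       = refl
  shift-<ᵇ (suc v) zero    zero    = refl
  shift-<ᵇ (suc v) zero    (suc y) = refl
  shift-<ᵇ (suc v) (suc x) zero    = refl
  shift-<ᵇ (suc v) (suc x) (suc y) = shift-<ᵇ v x y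

  shift-≡ᵇ : ∀ v x y → (shift v x ≡ᵇ shift v y) ≡ (x ≡ᵇ y)
  shift-≡ᵇ zero    x       y       = refl
  shift-≡ᵇ (suc v) zero    zero    = refl
  shift-≡ᵇ (suc v) zero    (suc y) = refl
  shift-≡ᵇ (suc v) (suc x) zero    = refl
  shift-≡ᵇ (suc v) (suc x) (suc y) = shift-≡ᵇ v x y

  shift-omits : ∀ v y → (shift v y ≡ᵇ v) ≡ false
  shift-omits zero    y       = refl
  shift-omits (suc v) zero    = refl
  shift-omits (suc v) (suc y) = shift-omits v y

  shift-≥ : ∀ {v y} → v ≤ y → shift v y ≡ suc y
  shift-≥ z≤n     = refl
  shift-≥ (s≤s p) = cong suc (shift-≥ p)

  shift-< : ∀ {v y} → y < v → shift v y ≡ y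
  shift-< {suc v} {zero}  _       = refl
  shift-< {suc v} {suc y} (s≤s p) = cong suc (shift-< p)

  <ᵇ-shift-≤ : ∀ {v y} → v ≤ y → (v <ᵇ shift v y) ≡ true
  <ᵇ-shift-≤ z≤n     = refl
  <ᵇ-shift-≤ (s≤s p) = <ᵇ-shift-≤ p

  <ᵇ-shift-> : ∀ {v y} → y < v → (v <ᵇ shift v y) ≡ false
  <ᵇ-shift-> {suc v} {zero}  _       = refl
  <ᵇ-shift-> {suc v} {suc y} (s≤s p) = <ᵇ-shift-> p

  <ᵇ-shift-+ : ∀ k v y → (k + v <ᵇ shift (k + v) (k + y)) ≡ (v <ᵇ shift v y)
  <ᵇ-shift-+ zero    v y = refl
  <ᵇ-shift-+ (suc k) v y = <ᵇ-shift-+ k v y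

  shift-comparable : ∀ v y → (shift v y <ᵇ v) ≡ not (v <ᵇ shift v y)
  shift-comparable zero    y       = refl
  shift-comparable (suc v) zero    = refl
  shift-comparable (suc v) (suc y) = shift-comparable v y

  -- Enumeration of permutations by their first letter

  range : ℕ → ℕ → List ℕ
  range a zero    = []
  range a (suc n) = a ∷ range (suc a) n

  applyUpTo≡range : ∀ a n {f : ℕ → ℕ} → (∀ i → f i ≡ a + i) → applyUpTo f n ≡ range a n
  applyUpTo≡range a zero    p = refl
  applyUpTo≡range a (suc n) p =
    cong₂ _∷_ (trans (p 0) (ℕ.+-identityʳ a)) (applyUpTo≡range (suc a) n (λ i → trans (p (suc i)) (ℕ.+-suc a i)))

  [1‥]≡range : ∀ n → [1‥ n ] ≡ range 1 n
  [1‥]≡range n = trans (List.map-upTo suc n) (applyUpTo≡range 1 n (λ _ → refl))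

  map-shift-range : ∀ v a n → v ≤ a → map (shift v) (range a n) ≡ range (suc a) n
  map-shift-range v a zero    p = refl
  map-shift-range v a (suc n) p = cong₂ _∷_ (shift-≥ p) (map-shift-range v (suc a) n (ℕ.m≤n⇒m≤1+n p))

  All-range : ∀ {P : ℕ → Set} a n → (∀ i → i < n → P (a + i)) → All P (range a n)
  All-range     a zero    p = []
  All-range {P} a (suc n) p =
    subst P (ℕ.+-identityʳ a) (p 0 (s≤s z≤n)) ∷ All-range (suc a) n (λ i i<n → subst P (ℕ.+-suc a i) (p (suc i) (s≤s i<n)))

  ≡ᵇ-refl : ∀ a → (a ≡ᵇ a) ≡ true
  ≡ᵇ-refl zero    = refl
  ≡ᵇ-refl (suc a) = ≡ᵇ-refl a

  <⇒≢ᵇ : ∀ {a b} → a < b → (a ≡ᵇ b) ≡ false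
  <⇒≢ᵇ {zero}  (s≤s _) = refl
  <⇒≢ᵇ {suc a} (s≤s p) = <⇒≢ᵇ p

  >⇒≢ᵇ : ∀ {a b} → b < a → (a ≡ᵇ b) ≡ false
  >⇒≢ᵇ {suc a} {zero}  _       = refl
  >⇒≢ᵇ {suc a} {suc b} (s≤s p) = >⇒≢ᵇ p

  -- Entries below the deleted value are fixed by the shift, the others are moved by one across the
  -- gap.
  filter-shift-range : ∀ a i n → i ≤ n →
    filterᵇ (λ u → not (a + i ≡ᵇ u)) (range a (suc n)) ≡ map (shift (a + i)) (range a n)
  filter-shift-range a zero n _ rewrite ℕ.+-identityʳ a | ≡ᵇ-refl a =
    trans (keep n ℕ.≤-refl) (sym (map-shift-range a a n ℕ.≤-refl))
    where
    keep : ∀ {b} n → suc a ≤ b → filterᵇ (λ u → not (a ≡ᵇ u)) (range b n) ≡ range b n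
    keep     zero    _ = refl
    keep {b} (suc n) p rewrite <⇒≢ᵇ p = cong (b ∷_) (keep n (ℕ.m≤n⇒m≤1+n p))
  filter-shift-range a (suc i) (suc n) (s≤s i≤n) rewrite ℕ.+-suc a i | >⇒≢ᵇ (s≤s (ℕ.m≤m+n a i)) | shift-< {suc (a + i)} (s≤s (ℕ.m≤m+n a i)) =
    cong (a ∷_) (filter-shift-range (suc a) i n i≤n)

  filterᵇ-cong : ∀ {A : Set} {p q : A → Bool} → (∀ x → p x ≡ q x) → ∀ xs → filterᵇ p xs ≡ filterᵇ q xs
  filterᵇ-cong             eq []       = refl
  filterᵇ-cong {p = p} {q} eq (x ∷ xs) with p x | q x | eq x
  ... | true  | .true  | refl = cong (x ∷_) (filterᵇ-cong eq xs)
  ... | false | .false | refl = filterᵇ-cong eq xs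

  filter≡filterᵇ : ∀ {A : Set} {P : A → Set} (P? : Decidable P) {q : A → Bool} → (∀ x → does (P? x) ≡ q x) →
    ∀ xs → filter P? xs ≡ filterᵇ q xs
  filter≡filterᵇ P?     eq []       = refl
  filter≡filterᵇ P? {q} eq (x ∷ xs) with does (P? x) | q x | eq x
  ... | true  | .true  | refl = cong (x ∷_) (filter≡filterᵇ P? eq xs)
  ... | false | .false | refl = filter≡filterᵇ P? eq xs

  filterᵇ-map : ∀ {A B : Set} (p : B → Bool) (f : A → B) xs → filterᵇ p (map f xs) ≡ map f (filterᵇ (p ∘ f) xs)
  filterᵇ-map p f []       = refl
  filterᵇ-map p f (x ∷ xs) with p (f x)
  ... | true  = cong (f x ∷_) (filterᵇ-map p f xs)
  ... | false = filterᵇ-map p f xs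

  filterᵇ-∧ : ∀ {A : Set} (p q : A → Bool) xs → filterᵇ (λ x → p x ∧ q x) xs ≡ filterᵇ q (filterᵇ p xs)
  filterᵇ-∧ p q []       = refl
  filterᵇ-∧ p q (x ∷ xs) with p x
  ... | false = filterᵇ-∧ p q xs
  ... | true with q x
  ...   | true  = cong (x ∷_) (filterᵇ-∧ p q xs)
  ...   | false = filterᵇ-∧ p q xs

  filterᵇ-++ : ∀ {A : Set} (p : A → Bool) xs ys → filterᵇ p (xs ++ ys) ≡ filterᵇ p xs ++ filterᵇ p ys
  filterᵇ-++ p []       ys = refl
  filterᵇ-++ p (x ∷ xs) ys with p x
  ... | true  = cong (x ∷_) (filterᵇ-++ p xs ys)
  ... | false = filterᵇ-++ p xs ys

  filterᵇ-concatMap : ∀ {A B : Set} (p : B → Bool) (f : A → List B) xs →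
    filterᵇ p (concatMap f xs) ≡ concatMap (λ x → filterᵇ p (f x)) xs
  filterᵇ-concatMap p f []       = refl
  filterᵇ-concatMap p f (x ∷ xs) = trans (filterᵇ-++ p (f x) _) (cong (filterᵇ p (f x) ++_) (filterᵇ-concatMap p f xs))

  concatMap-filterᵇ : ∀ {A B : Set} (p : A → Bool) (g : A → List B) xs →
    concatMap g (filterᵇ p xs) ≡ concatMap (λ x → if p x then g x else []) xs
  concatMap-filterᵇ p g []       = refl
  concatMap-filterᵇ p g (x ∷ xs) with p x
  ... | true  = cong (g x ++_) (concatMap-filterᵇ p g xs)
  ... | false = concatMap-filterᵇ p g xs

  concatMap-congᴬ : ∀ {A B : Set} {f g : A → List B} {xs} → All (λ x → f x ≡ g x) xs → concatMap f xs ≡ concatMap g xs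
  concatMap-congᴬ []       = refl
  concatMap-congᴬ (p ∷ ps) = cong₂ _++_ p (concatMap-congᴬ ps)

  avoids : ℕ → List ℕ → Bool
  avoids v []      = true
  avoids v (u ∷ r) = not (v ≡ᵇ u) ∧ avoids v r

  unique : List ℕ → Bool
  unique []      = true
  unique (v ∷ r) = avoids v r ∧ unique r

  avoids-shift : ∀ v x r → avoids (shift v x) (map (shift v) r) ≡ avoids x r
  avoids-shift v x []      = refl
  avoids-shift v x (u ∷ r) = cong₂ _∧_ (cong not (shift-≡ᵇ v x u)) (avoids-shift v x r)

  unique-shift : ∀ v r → unique (map (shift v) r) ≡ unique r
  unique-shift v []      = refl
  unique-shift v (x ∷ r) = cong₂ _∧_ (avoids-shift v x r) (unique-shift v r)

  does-unique? : ∀ r → does (UniqueDec.unique? ℕ._≟_ r) ≡ unique r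
  does-unique? []      = refl
  does-unique? (v ∷ r) = cong₂ _∧_ (go r) (does-unique? r)
    where
    open import Relation.Nullary.Decidable using (¬?)
    go : ∀ r → does (All.all? (λ y → ¬? (v ℕ.≟ y)) r) ≡ avoids v r
    go []      = refl
    go (u ∷ r) = cong (not (v ≡ᵇ u) ∧_) (go r)

  -- Since `shift` preserves the order, it also matches the lexicographic enumerations, and an
  -- equality of lists results where a bijection might be expected.
  filter-avoids-words : ∀ k n i → i ≤ n →
    filterᵇ (avoids (suc i)) (words k (suc n)) ≡ map (map (shift (suc i))) (words k n)
  filter-avoids-words zero    n i i≤n = refl
  filter-avoids-words (suc k) n i i≤n = begin
    filterᵇ (avoids v) (concatMap (λ u → map (u ∷_) (words k (suc n))) [1‥ suc n ])
      ≡⟨ filterᵇ-concatMap (avoids v) (λ u → map (u ∷_) (words k (suc n))) [1‥ suc n ] ⟩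
    concatMap (λ u → filterᵇ (avoids v) (map (u ∷_) (words k (suc n)))) [1‥ suc n ]
      ≡⟨ List.concatMap-cong step [1‥ suc n ] ⟩
    concatMap (λ u → if not (v ≡ᵇ u) then g u else []) [1‥ suc n ]
      ≡⟨ concatMap-filterᵇ (λ u → not (v ≡ᵇ u)) g [1‥ suc n ] ⟨
    concatMap g (filterᵇ (λ u → not (v ≡ᵇ u)) [1‥ suc n ])
      ≡⟨ cong (λ xs → concatMap g (filterᵇ (λ u → not (v ≡ᵇ u)) xs)) ([1‥]≡range (suc n)) ⟩
    concatMap g (filterᵇ (λ u → not (v ≡ᵇ u)) (range 1 (suc n)))
      ≡⟨ cong (concatMap g) (filter-shift-range 1 i n i≤n) ⟩
    concatMap g (map (shift v) (range 1 n))
      ≡⟨ List.concatMap-map g (shift v) (range 1 n) ⟩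
    concatMap (λ u → g (shift v u)) (range 1 n)
      ≡⟨ List.concatMap-cong (λ u → swap u (words k n)) (range 1 n) ⟩
    concatMap (λ u → map (map (shift v)) (map (u ∷_) (words k n))) (range 1 n)
      ≡⟨ List.map-concatMap (map (shift v)) (λ u → map (u ∷_) (words k n)) (range 1 n) ⟨
    map (map (shift v)) (concatMap (λ u → map (u ∷_) (words k n)) (range 1 n))
      ≡⟨ cong (λ xs → map (map (shift v)) (concatMap (λ u → map (u ∷_) (words k n)) xs)) ([1‥]≡range n) ⟨
    map (map (shift v)) (words (suc k) n) ∎
    where
    open ≡-Reasoning
    v = suc i
    g : ℕ → List (List ℕ)
    g u = map (u ∷_) (map (map (shift v)) (words k n))
    step : ∀ u → filterᵇ (avoids v) (map (u ∷_) (words k (suc n))) ≡ (if not (v ≡ᵇ u) then g u else [])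
    step u = trans (filterᵇ-map (avoids v) (u ∷_) (words k (suc n))) (go (not (v ≡ᵇ u)))
      where
      none : ∀ {A : Set} (xs : List A) → filterᵇ (λ _ → false) xs ≡ []
      none []       = refl
      none (x ∷ xs) = none xs
      go : ∀ t → map (u ∷_) (filterᵇ (λ r → t ∧ avoids v r) (words k (suc n))) ≡ (if t then g u else [])
      go true  = cong (map (u ∷_)) (filter-avoids-words k n i i≤n)
      go false = cong (map (u ∷_)) (none (words k (suc n)))
    swap : ∀ u ws → map (shift v u ∷_) (map (map (shift v)) ws) ≡ map (map (shift v)) (map (u ∷_) ws)
    swap u []       = refl
    swap u (w ∷ ws) = cong ((shift v u ∷ map (shift v) w) ∷_) (swap u ws)

  prepend : ℕ → List ℕ → List ℕ
  prepend v π = v ∷ map (shift v) π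

  perms : ℕ → List (List ℕ)
  perms zero    = [] ∷ []
  perms (suc n) = concatMap (λ v → map (prepend v) (perms n)) (range 1 (suc n))

  -- After a first letter v, distinctness means avoiding v and being distinct. Relabelling by
  -- `shift v` turns the words that avoid v into words over n letters and does not affect
  -- distinctness.
  𝔖≡perms : ∀ n → 𝔖 n ≡ perms n
  𝔖≡perms n = trans (filter≡filterᵇ (UniqueDec.unique? ℕ._≟_) does-unique? (words n n)) (go n)
    where
    open ≡-Reasoning
    go : ∀ n → filterᵇ unique (words n n) ≡ perms n
    go zero    = refl
    go (suc n) = begin
      filterᵇ unique (concatMap (λ u → map (u ∷_) (words n (suc n))) [1‥ suc n ])
        ≡⟨ filterᵇ-concatMap unique (λ u → map (u ∷_) (words n (suc n))) [1‥ suc n ] ⟩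
      concatMap (λ v → filterᵇ unique (map (v ∷_) (words n (suc n)))) [1‥ suc n ]
        ≡⟨ cong (concatMap (λ v → filterᵇ unique (map (v ∷_) (words n (suc n))))) ([1‥]≡range (suc n)) ⟩
      concatMap (λ v → filterᵇ unique (map (v ∷_) (words n (suc n)))) (range 1 (suc n))
        ≡⟨ concatMap-congᴬ (All-range 1 (suc n) (λ i i≤n → step i (ℕ.≤-pred i≤n))) ⟩
      perms (suc n) ∎
      where
      step : ∀ i → i ≤ n → filterᵇ unique (map (suc i ∷_) (words n (suc n))) ≡ map (prepend (suc i)) (perms n)
      step i i≤n = begin
        filterᵇ unique (map (suc i ∷_) (words n (suc n)))
          ≡⟨ filterᵇ-map unique (suc i ∷_) (words n (suc n)) ⟩
        map (suc i ∷_) (filterᵇ (λ r → avoids (suc i) r ∧ unique r) (words n (suc n)))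
          ≡⟨ cong (map (suc i ∷_)) (filterᵇ-∧ (avoids (suc i)) unique (words n (suc n))) ⟩
        map (suc i ∷_) (filterᵇ unique (filterᵇ (avoids (suc i)) (words n (suc n))))
          ≡⟨ cong (λ ws → map (suc i ∷_) (filterᵇ unique ws)) (filter-avoids-words n n i i≤n) ⟩
        map (suc i ∷_) (filterᵇ unique (map (map (shift (suc i))) (words n n)))
          ≡⟨ cong (map (suc i ∷_)) (filterᵇ-map unique (map (shift (suc i))) (words n n)) ⟩
        map (suc i ∷_) (map (map (shift (suc i))) (filterᵇ (λ r → unique (map (shift (suc i)) r)) (words n n)))
          ≡⟨ cong (λ ws → map (suc i ∷_) (map (map (shift (suc i))) ws)) (trans (filterᵇ-cong (unique-shift (suc i)) (words n n)) (go n)) ⟩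
        map (suc i ∷_) (map (map (shift (suc i))) (perms n))
          ≡⟨ List.map-∘ (perms n) ⟨
        map (prepend (suc i)) (perms n) ∎

  -- Inverses of permutations

  pos-shift : ∀ v u π → pos (shift v u) (map (shift v) π) ≡ pos u π
  pos-shift v u []      = refl
  pos-shift v u (y ∷ π) rewrite shift-≡ᵇ v u y | pos-shift v u π = refl

  pos-prepend : ∀ v u π → pos (shift v u) (prepend v π) ≡ suc (pos u π)
  pos-prepend v u π rewrite shift-omits v u = cong suc (pos-shift v u π)

  pos-head : ∀ v r → pos v (v ∷ r) ≡ 1
  pos-head v r rewrite ≡ᵇ-refl v = refl

  map-pos-prepend : ∀ π a i n → i ≤ n →
    map (λ u → pos u (prepend (a + i) π)) (range a (suc n)) ≡ insertAt i 1 (map (λ u → suc (pos u π)) (range a n))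
  map-pos-prepend π a zero n _ rewrite ℕ.+-identityʳ a =
    cong₂ _∷_ (pos-head a (map (shift a) π)) (trans (cong (map (λ u → pos u (prepend a π))) (sym (map-shift-range a a n ℕ.≤-refl)))
      (trans (sym (List.map-∘ (range a n))) (List.map-cong (λ u → pos-prepend a u π) (range a n))))
  map-pos-prepend π a (suc i) (suc n) (s≤s i≤n) rewrite ℕ.+-suc a i =
    cong₂ _∷_ (trans (cong (λ u → pos u (prepend (suc (a + i)) π)) (sym (shift-< {suc (a + i)} (s≤s (ℕ.m≤m+n a i)))))
                     (pos-prepend (suc (a + i)) a π))
              (map-pos-prepend π (suc a) i n i≤n)

  -- The value i + 1 now has position 1 and every other value is found one position later; read in
  -- the order of values, the shift opens a gap exactly at index i.
  inverse-prepend : ∀ π i → i ≤ length π → inverse (prepend (suc i) π) ≡ insertAt i 1 (map suc (inverse π))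
  inverse-prepend π i i≤n = begin
    map (λ u → pos u (prepend (suc i) π)) [1‥ suc (length (map (shift (suc i)) π)) ]
      ≡⟨ cong (map (λ u → pos u (prepend (suc i) π))) ([1‥]≡range _) ⟩
    map (λ u → pos u (prepend (suc i) π)) (range 1 (suc (length (map (shift (suc i)) π))))
      ≡⟨ cong (λ k → map (λ u → pos u (prepend (suc i) π)) (range 1 (suc k))) (List.length-map (shift (suc i)) π) ⟩
    map (λ u → pos u (prepend (suc i) π)) (range 1 (suc (length π)))
      ≡⟨ map-pos-prepend π 1 i (length π) i≤n ⟩
    insertAt i 1 (map (λ u → suc (pos u π)) (range 1 (length π)))
      ≡⟨ cong (insertAt i 1) (List.map-∘ (range 1 (length π))) ⟩
    insertAt i 1 (map suc (map (λ u → pos u π) (range 1 (length π))))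
      ≡⟨ cong (λ us → insertAt i 1 (map suc (map (λ u → pos u π) us))) ([1‥]≡range (length π)) ⟨
    insertAt i 1 (map suc (inverse π)) ∎
    where open ≡-Reasoning

  open Cuts _<ᵇ_ using (IsMin)

  -- Positions in a nonempty word are at least 1: `pos` takes the value 0 only on the empty word,
  -- whose inverse has no entries.
  inverse-min : ∀ π → IsMin 1 (map suc (inverse π))
  inverse-min []      = []
  inverse-min (y ∷ π) = All.map⁺ (All.map⁺ (All.universal above [1‥ length (y ∷ π) ]))
    where
    above : ∀ u → (0 <ᵇ pos u (y ∷ π)) ≡ true × (pos u (y ∷ π) <ᵇ 0) ≡ false
    above u with u ≡ᵇ y
    ... | true  = refl , refl
    ... | false = refl , refl

  length-inverse : ∀ π → length (inverse π) ≡ length π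
  length-inverse π = trans (List.length-map _ [1‥ length π ]) (trans (List.length-map suc (upTo (length π))) (List.length-upTo (length π)))

  -- Distinctness of neighbours as a Boolean identity: descents are exactly the non-ascents, so that
  -- br, pk and des become functions of the ascent pattern.
  Comparable : ℕ → ℕ → Set
  Comparable x y = (y <ᵇ x) ≡ not (x <ᵇ y)

  Comparable-insertAt : ∀ v z σ → IsMin z σ → Linked Comparable σ → Linked Comparable (insertAt v z σ)
  Comparable-insertAt zero    z []          _                     _        = [-]
  Comparable-insertAt zero    z (y ∷ σ)     ((z<y , y≮z) ∷ _)     ls       = trans y≮z (cong not (sym z<y)) ∷ ls
  Comparable-insertAt (suc v) z []          _                     _        = [-]
  Comparable-insertAt (suc v) z (x ∷ [])    ((z<x , x≮z) ∷ _)     _        = last v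
    where
    last : ∀ v → Linked Comparable (x ∷ insertAt v z [])
    last zero    = trans z<x (cong not (sym x≮z)) ∷ [-]
    last (suc v) = trans z<x (cong not (sym x≮z)) ∷ [-]
  Comparable-insertAt (suc zero) z (x ∷ y ∷ σ) ((z<x , x≮z) ∷ (z<y , y≮z) ∷ _) (_ ∷ ls) =
    trans z<x (cong not (sym x≮z)) ∷ trans y≮z (cong not (sym z<y)) ∷ ls
  Comparable-insertAt (suc (suc v)) z (x ∷ y ∷ σ) (_ ∷ ms) (l ∷ ls) = l ∷ Comparable-insertAt (suc v) z (y ∷ σ) ms ls

  Comparable-suc : ∀ {σ} → Linked Comparable σ → Linked Comparable (map suc σ)
  Comparable-suc []       = []
  Comparable-suc [-]      = [-]
  Comparable-suc (l ∷ ls) = l ∷ Comparable-suc ls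

  Comparable-shift : ∀ v {π} → Linked Comparable π → Linked Comparable (map (shift v) π)
  Comparable-shift v []                         = []
  Comparable-shift v [-]                        = [-]
  Comparable-shift v (_∷_ {x = x} {y} l ls) = trans (shift-<ᵇ v y x) (trans l (cong not (sym (shift-<ᵇ v x y)))) ∷ Comparable-shift v ls

  Comparable-prepend : ∀ v {π} → Linked Comparable π → Linked Comparable (prepend v π)
  Comparable-prepend v {[]}    _  = [-]
  Comparable-prepend v {y ∷ π} ls = shift-comparable v y ∷ Comparable-shift v ls

  record IsPerm (n : ℕ) (π : List ℕ) : Set where
    field
      len        : length π ≡ n
      comparable : Linked Comparable π
      inverse-comparable : Linked Comparable (inverse π)

  perms-IsPerm : ∀ n → All (IsPerm n) (perms n)
  perms-IsPerm zero    = record { len = refl ; comparable = [] ; inverse-comparable = [] } ∷ []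
  perms-IsPerm (suc n) = All.concat⁺ (All.map⁺ (All-range 1 (suc n) λ i i≤n →
    All.map⁺ (All.map (λ {π} p → step i (ℕ.≤-pred i≤n) π p) (perms-IsPerm n))))
    where
    step : ∀ i → i ≤ n → ∀ π → IsPerm n π → IsPerm (suc n) (prepend (suc i) π)
    step i i≤n π p = record
      { len = cong suc (trans (List.length-map _ π) len)
      ; comparable = Comparable-prepend (suc i) comparable
      ; inverse-comparable = subst (Linked Comparable) (sym (inverse-prepend π i (subst (i ≤_) (sym len) i≤n)))
          (Comparable-insertAt i 1 _ (inverse-min π) (Comparable-suc inverse-comparable)) }
      where open IsPerm p

  -- Sums over permutations and over words

  sumL : {A : Set} → List A → (A → ℕ) → ℕ
  sumL []       f = 0
  sumL (x ∷ xs) f = f x + sumL xs f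

  sumL-congᴬ : ∀ {A : Set} {xs : List A} {f g : A → ℕ} → All (λ x → f x ≡ g x) xs → sumL xs f ≡ sumL xs g
  sumL-congᴬ []       = refl
  sumL-congᴬ (p ∷ ps) = cong₂ _+_ p (sumL-congᴬ ps)

  sumL-map : ∀ {A B : Set} (h : A → B) xs (f : B → ℕ) → sumL (map h xs) f ≡ sumL xs (λ x → f (h x))
  sumL-map h []       f = refl
  sumL-map h (x ∷ xs) f = cong (f (h x) +_) (sumL-map h xs f)

  sumL-++ : ∀ {A : Set} (xs ys : List A) f → sumL (xs ++ ys) f ≡ sumL xs f + sumL ys f
  sumL-++ []       ys f = refl
  sumL-++ (x ∷ xs) ys f = trans (cong (f x +_) (sumL-++ xs ys f)) (sym (ℕ.+-assoc (f x) _ _))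

  sumL-concatMap : ∀ {A B : Set} (h : A → List B) xs f → sumL (concatMap h xs) f ≡ sumL xs (λ x → sumL (h x) f)
  sumL-concatMap h []       f = refl
  sumL-concatMap h (x ∷ xs) f = trans (sumL-++ (h x) _ f) (cong (sumL (h x) f +_) (sumL-concatMap h xs f))

  sumL-range : ∀ a n f → sumL (range a n) f ≡ countN n (λ i → f (a + i))
  sumL-range a zero    f = refl
  sumL-range a (suc n) f = trans (cong₂ _+_ (cong f (sym (ℕ.+-identityʳ a)))
      (trans (sumL-range (suc a) n f) (countN-cong n (λ i _ → cong f (sym (ℕ.+-suc a i))))))
    (sym (countN-sucˡ n (λ i → f (a + i))))

  sumL-+ : ∀ {A : Set} (xs : List A) f g → sumL xs (λ x → f x + g x) ≡ sumL xs f + sumL xs g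
  sumL-+ []       f g = refl
  sumL-+ (x ∷ xs) f g = trans (cong (f x + g x +_) (sumL-+ xs f g)) (interchange (f x) (g x) _ _)

  sumL-zero : ∀ {A : Set} (xs : List A) → sumL xs (const 0) ≡ 0
  sumL-zero []       = refl
  sumL-zero (x ∷ xs) = sumL-zero xs

  sumL-countN : ∀ {A : Set} (xs : List A) n (f : A → ℕ → ℕ) →
    countN n (λ i → sumL xs (λ x → f x i)) ≡ sumL xs (λ x → countN n (f x))
  sumL-countN xs zero    f = sym (sumL-zero xs)
  sumL-countN xs (suc n) f = trans (cong (_+ sumL xs (λ x → f x n)) (sumL-countN xs n f)) (sym (sumL-+ xs _ _))

  sumL-ΣFin : ∀ {A : Set} (xs : List A) m (f : A → Fin m → ℕ) →
    sumL xs (λ x → ΣFin m (f x)) ≡ ΣFin m (λ b → sumL xs (λ x → f x b))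
  sumL-ΣFin xs zero    f = sumL-zero xs
  sumL-ΣFin xs (suc m) f = trans (sumL-+ xs (λ x → f x zero) _) (cong (sumL xs (λ x → f x zero) +_) (sumL-ΣFin xs m _))

  -- The sum over first letters is moved inside: for fixed π it runs over all places where 1 can
  -- enter the inverse, the form that `cutSum-insert` evaluates.
  sumL-perms-suc : ∀ n F → sumL (perms (suc n)) F ≡ sumL (perms n) (λ π → countN (suc n) (λ i → F (prepend (suc i) π)))
  sumL-perms-suc n F = begin
    sumL (perms (suc n)) F
      ≡⟨ sumL-concatMap (λ v → map (prepend v) (perms n)) (range 1 (suc n)) F ⟩
    sumL (range 1 (suc n)) (λ v → sumL (map (prepend v) (perms n)) F)
      ≡⟨ sumL-range 1 (suc n) _ ⟩
    countN (suc n) (λ i → sumL (map (prepend (suc i)) (perms n)) F)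
      ≡⟨ countN-cong (suc n) (λ i _ → sumL-map (prepend (suc i)) (perms n) F) ⟩
    countN (suc n) (λ i → sumL (perms n) (λ π → F (prepend (suc i) π)))
      ≡⟨ sumL-countN (perms n) (suc n) _ ⟩
    sumL (perms n) (λ π → countN (suc n) (λ i → F (prepend (suc i) π))) ∎
    where open ≡-Reasoning

  ΣWords : ∀ m (n : ℕ) → (List (Fin m) → ℕ) → ℕ
  ΣWords m zero    F = F []
  ΣWords m (suc n) F = ΣFin m (λ b → ΣWords m n (λ w → F (b ∷ w)))

  ΣWords-cong : ∀ m n {F G : List (Fin m) → ℕ} → (∀ w → length w ≡ n → F w ≡ G w) → ΣWords m n F ≡ ΣWords m n G
  ΣWords-cong m zero    p = p [] refl
  ΣWords-cong m (suc n) p = ΣFin-cong m (λ b → ΣWords-cong m n (λ w l → p (b ∷ w) (cong suc l)))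

  ΣWords-*ˡ : ∀ m n k F → ΣWords m n (λ w → k * F w) ≡ k * ΣWords m n F
  ΣWords-*ˡ m zero    k F = refl
  ΣWords-*ˡ m (suc n) k F = trans (ΣFin-cong m (λ b → ΣWords-*ˡ m n k (λ w → F (b ∷ w)))) (ΣFin-*ˡ m k _)

  ΣWords-zero : ∀ m n → ΣWords m n (λ _ → 0) ≡ 0
  ΣWords-zero m zero    = refl
  ΣWords-zero m (suc n) = ΣFin-zero m (λ _ → ΣWords-zero m n)

  countN-ΣWords : ∀ m n N (f : ℕ → List (Fin m) → ℕ) → ΣWords m n (λ w → countN N (λ l → f l w)) ≡ countN N (λ l → ΣWords m n (f l))
  countN-ΣWords m zero    N f = refl
  countN-ΣWords m (suc n) N f = trans (ΣFin-cong m (λ b → countN-ΣWords m n N (λ l w → f l (b ∷ w)))) (sym (countN-ΣFin N m _))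

  ΣWords-split : ∀ m l n (g h : List (Fin m) → ℕ) →
    ΣWords m (l + n) (λ w → g (take l w) * h (drop l w)) ≡ ΣWords m l g * ΣWords m n h
  ΣWords-split m zero    n g h = ΣWords-*ˡ m n (g []) h
  ΣWords-split m (suc l) n g h = begin
    ΣFin m (λ b → ΣWords m (l + n) (λ w → g (b ∷ take l w) * h (drop l w)))
      ≡⟨ ΣFin-cong m (λ b → ΣWords-split m l n (λ w → g (b ∷ w)) h) ⟩
    ΣFin m (λ b → ΣWords m l (λ w → g (b ∷ w)) * ΣWords m n h)
      ≡⟨ ΣFin-cong m (λ b → ℕ.*-comm _ (ΣWords m n h)) ⟩
    ΣFin m (λ b → ΣWords m n h * ΣWords m l (λ w → g (b ∷ w)))
      ≡⟨ ΣFin-*ˡ m (ΣWords m n h) _ ⟩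
    ΣWords m n h * ΣFin m (λ b → ΣWords m l (λ w → g (b ∷ w)))
      ≡⟨ ℕ.*-comm (ΣWords m n h) _ ⟩
    ΣFin m (λ b → ΣWords m l (λ w → g (b ∷ w))) * ΣWords m n h ∎
    where open ≡-Reasoning

  -- The number of cuts of a nonempty word with the given ascents.  In cutsFrom its
  -- first letter is already placed in a block of direction τ.
  cuts : ∀ {k} → Vec Bool k → List Bool → ℕ
  cutsFrom : ∀ {k} → Bool → Vec Bool k → List Bool → ℕ
  cuts []      p = 0
  cuts (τ ∷ ε) p = cutsFrom τ ε p + cuts ε p
  cutsFrom τ ε []      = 1
  cutsFrom τ ε (x ∷ p) = b2n (x ≟ᵇ τ) * cutsFrom τ ε p + cuts ε p

  -- Cuts in terms of the ascent pattern

  module Patterns {A : Set} (asc : A → A → Bool) where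
    open Cuts asc

    ascents : List A → List Bool
    ascents (x ∷ y ∷ r) = asc x y ∷ ascents (y ∷ r)
    ascents _           = []

    cutCount : ∀ {k} → Vec Bool k → List A → ℕ
    cutCount ε w = cutSum ε w (const 1)

    cutSum-[] : ∀ {k} (ε : Vec Bool k) f → cutSum ε [] f ≡ f (replicate k 0)
    cutSum-[] []      f = refl
    cutSum-[] (τ ∷ ε) f = trans (ℕ.+-identityʳ _) (cutSum-[] ε _)

    -- The first block either is empty or contains x. In the second case the next letter continues
    -- this block, if the step allows it, or opens a later one; hence the mutual recursion.
    cutCount≡cuts : ∀ {k} (ε : Vec Bool k) x σ → cutCount ε (x ∷ σ) ≡ cuts ε (ascents (x ∷ σ))
    cutCount≡cutsFrom : ∀ {k} τ (ε : Vec Bool k) x σ →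
      countN (suc (length σ)) (λ l → b2n (mono τ (x ∷ take l σ)) * cutCount ε (drop l σ)) ≡ cutsFrom τ ε (ascents (x ∷ σ))
    cutCount≡cuts []      x σ = refl
    cutCount≡cuts (τ ∷ ε) x σ = begin
      cutCount (τ ∷ ε) (x ∷ σ)
        ≡⟨ countN-sucˡ (suc (length σ)) _ ⟩
      1 * cutCount ε (x ∷ σ) + countN (suc (length σ)) (λ l → b2n (mono τ (x ∷ take l σ)) * cutCount ε (drop l σ))
        ≡⟨ cong₂ _+_ (trans (ℕ.*-identityˡ _) (cutCount≡cuts ε x σ)) (cutCount≡cutsFrom τ ε x σ) ⟩
      cuts ε (ascents (x ∷ σ)) + cutsFrom τ ε (ascents (x ∷ σ))
        ≡⟨ ℕ.+-comm (cuts ε (ascents (x ∷ σ))) _ ⟩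
      cuts (τ ∷ ε) (ascents (x ∷ σ)) ∎
      where open ≡-Reasoning
    cutCount≡cutsFrom τ ε x []      = trans (ℕ.+-identityʳ _) (cutSum-[] ε (const 1))
    cutCount≡cutsFrom τ ε x (y ∷ σ) = begin
      countN (suc (suc (length σ))) (λ l → b2n (mono τ (x ∷ take l (y ∷ σ))) * cutCount ε (drop l (y ∷ σ)))
        ≡⟨ countN-sucˡ (suc (length σ)) _ ⟩
      1 * cutCount ε (y ∷ σ) + countN (suc (length σ)) (λ l → b2n ((asc x y ≟ᵇ τ) ∧ mono τ (y ∷ take l σ)) * cutCount ε (drop l σ))
        ≡⟨ cong₂ _+_ (trans (ℕ.*-identityˡ _) (cutCount≡cuts ε y σ)) (trans (countN-cong (suc (length σ)) (λ l _ → b2n-∧ (asc x y ≟ᵇ τ) _ _))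
             (trans (countN-*ˡ (suc (length σ)) (b2n (asc x y ≟ᵇ τ)) _) (cong (b2n (asc x y ≟ᵇ τ) *_) (cutCount≡cutsFrom τ ε y σ)))) ⟩
      cuts ε (ascents (y ∷ σ)) + b2n (asc x y ≟ᵇ τ) * cutsFrom τ ε (ascents (y ∷ σ))
        ≡⟨ ℕ.+-comm (cuts ε (ascents (y ∷ σ))) _ ⟩
      cutsFrom τ ε (ascents (x ∷ y ∷ σ)) ∎
      where
      open ≡-Reasoning
      b2n-∧ : ∀ s t k → b2n (s ∧ t) * k ≡ b2n s * (b2n t * k)
      b2n-∧ true  t k = sym (ℕ.*-identityˡ _)
      b2n-∧ false t k = refl

  open Cuts _<ᵇ_ using (cutSum; cutSum-cong; cutSum-*ˡ; cutSum-insert; mono)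
  open Patterns _<ᵇ_ using (cutCount; cutSum-[]; ascents; cutCount≡cuts)

  -- Standardization of words

  cutSum-map-suc : ∀ {m} (δ : Vec Bool m) σ f → cutSum δ (map suc σ) f ≡ cutSum δ σ f
  cutSum-map-suc []       []      f = refl
  cutSum-map-suc []       (_ ∷ _) f = refl
  cutSum-map-suc (d ∷ ds) σ       f = trans
    (countN-cong (suc (length (map suc σ))) (λ l _ → cong₂ _*_
      (cong b2n (trans (cong (mono d) (List.take-map l σ)) (mono-map (take l σ))))
      (trans (cong (λ s → cutSum ds s (λ μ → f (l ∷ μ))) (List.drop-map l σ)) (cutSum-map-suc ds (drop l σ) _))))
    (cong (λ N → countN (suc N) (λ l → b2n (mono d (take l σ)) * cutSum ds (drop l σ) (λ μ → f (l ∷ μ)))) (List.length-map suc σ))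
    where
    mono-map : ∀ σ → mono d (map suc σ) ≡ mono d σ
    mono-map []          = refl
    mono-map (x ∷ [])    = refl
    mono-map (x ∷ y ∷ σ) = cong (((x <ᵇ y) ≟ᵇ d) ∧_) (mono-map (y ∷ σ))

  module Alphabet {m} (δ : Vec Bool m) where
    content : List (Fin m) → Vec ℕ m
    content []      = replicate m 0
    content (b ∷ w) = updateAt (content w) b suc

    -- Built from the right: a letter names the block of the inverse that holds its position, and
    -- `content w` supplies the block sizes already reached, which fix the place of the new minimum.
    standardize : List (Fin m) → List ℕ
    standardize []      = []
    standardize (b ∷ w) = prepend (suc (slot δ b (content w))) (standardize w)

    -- Permutations with a cut of their inverse are in bijection with words: the
    -- label of the first letter of π determines where 1 is inserted in π⁻¹.
    sum-standardize : ∀ n (F : List ℕ → Vec ℕ m → ℕ) →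
      sumL (perms n) (λ π → cutSum δ (inverse π) (F π)) ≡ ΣWords m n (λ w → F (standardize w) (content w))
    sum-standardize zero    F = trans (ℕ.+-identityʳ _) (cutSum-[] δ (F []))
    sum-standardize (suc n) F = begin
      sumL (perms (suc n)) (λ π → cutSum δ (inverse π) (F π))
        ≡⟨ sumL-perms-suc n _ ⟩
      sumL (perms n) (λ π → countN (suc n) (λ i → cutSum δ (inverse (prepend (suc i) π)) (F (prepend (suc i) π))))
        ≡⟨ sumL-congᴬ (All.map (λ {π} p → step π p) (perms-IsPerm n)) ⟩
      sumL (perms n) (λ π → ΣFin m (λ b → cutSum δ (inverse π) (λ μ → F (prepend (suc (slot δ b μ)) π) (updateAt μ b suc))))
        ≡⟨ sumL-ΣFin (perms n) m _ ⟩
      ΣFin m (λ b → sumL (perms n) (λ π → cutSum δ (inverse π) (λ μ → F (prepend (suc (slot δ b μ)) π) (updateAt μ b suc))))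
        ≡⟨ ΣFin-cong m (λ b → sum-standardize n (λ π μ → F (prepend (suc (slot δ b μ)) π) (updateAt μ b suc))) ⟩
      ΣWords m (suc n) (λ w → F (standardize w) (content w)) ∎
      where
      open ≡-Reasoning
      step : ∀ π → IsPerm n π →
        countN (suc n) (λ i → cutSum δ (inverse (prepend (suc i) π)) (F (prepend (suc i) π)))
        ≡ ΣFin m (λ b → cutSum δ (inverse π) (λ μ → F (prepend (suc (slot δ b μ)) π) (updateAt μ b suc)))
      step π p = begin
        countN (suc n) (λ i → cutSum δ (inverse (prepend (suc i) π)) (F (prepend (suc i) π)))
          ≡⟨ countN-cong (suc n) (λ { i (s≤s i≤n) → cong (λ σ → cutSum δ σ (F (prepend (suc i) π)))
               (inverse-prepend π i (subst (i ≤_) (sym len) i≤n)) }) ⟩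
        countN (suc n) (λ i → cutSum δ (insertAt i 1 (map suc (inverse π))) (F (prepend (suc i) π)))
          ≡⟨ cong (λ N → countN (suc N) (λ i → cutSum δ (insertAt i 1 (map suc (inverse π))) (F (prepend (suc i) π))))
               (trans (sym len) (trans (sym (length-inverse π)) (sym (List.length-map suc (inverse π))))) ⟩
        countN (suc (length (map suc (inverse π)))) (λ i → cutSum δ (insertAt i 1 (map suc (inverse π))) (F (prepend (suc i) π)))
          ≡⟨ cutSum-insert δ 1 (map suc (inverse π)) (λ i → F (prepend (suc i) π)) (inverse-min π) ⟩
        ΣFin m (λ b → cutSum δ (map suc (inverse π)) (λ μ → F (prepend (suc (slot δ b μ)) π) (updateAt μ b suc)))
          ≡⟨ ΣFin-cong m (λ b → cutSum-map-suc δ (inverse π) _) ⟩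
        ΣFin m (λ b → cutSum δ (inverse π) (λ μ → F (prepend (suc (slot δ b μ)) π) (updateAt μ b suc))) ∎
        where open IsPerm p

  letterAsc : ∀ {m} → Vec Bool m → Fin m → Fin m → Bool
  letterAsc (d ∷ ds) zero    zero     = d
  letterAsc (d ∷ ds) zero    (suc b′) = true
  letterAsc (d ∷ ds) (suc b) zero     = false
  letterAsc (d ∷ ds) (suc b) (suc b′) = letterAsc ds b b′

  -- Of two minima put into the same block, the newer one precedes the older in an ascending block
  -- and follows it in a descending one; different blocks keep their order. Block b′ has already
  -- received the later letter, hence the updated sizes, and prepending shifts the entry of that
  -- letter.
  slot-asc : ∀ {m} (δ : Vec Bool m) b b′ μ → let v = slot δ b (updateAt μ b′ suc) in
    (v <ᵇ shift v (slot δ b′ μ)) ≡ letterAsc δ b b′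
  slot-asc (true  ∷ ds) zero    zero     (l ∷ μ) = refl
  slot-asc (false ∷ ds) zero    zero     (l ∷ μ) = <ᵇ-shift-> {suc l} ℕ.≤-refl
  slot-asc (true  ∷ ds) zero    (suc b′) (l ∷ μ) = refl
  slot-asc (false ∷ ds) zero    (suc b′) (l ∷ μ) = <ᵇ-shift-≤ (ℕ.m≤m+n l _)
  slot-asc (true  ∷ ds) (suc b) zero     (l ∷ μ) = refl
  slot-asc (false ∷ ds) (suc b) zero     (l ∷ μ) = <ᵇ-shift-> (s≤s (ℕ.m≤m+n l _))
  slot-asc (d     ∷ ds) (suc b) (suc b′) (l ∷ μ) =
    trans (<ᵇ-shift-+ l (slot ds b (updateAt μ b′ suc)) (slot ds b′ μ)) (slot-asc ds b b′ μ)

  pattern-shift : ∀ v π → ascents (map (shift v) π) ≡ ascents π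
  pattern-shift v []          = refl
  pattern-shift v (x ∷ [])    = refl
  pattern-shift v (x ∷ y ∷ π) = cong₂ _∷_ (shift-<ᵇ v x y) (pattern-shift v (y ∷ π))

  module _ {m} (δ : Vec Bool m) where
    open Alphabet δ
    private module W = Patterns (letterAsc δ)

    pattern-standardize : ∀ w → ascents (standardize w) ≡ W.ascents w
    pattern-standardize []           = refl
    pattern-standardize (b ∷ [])     = refl
    pattern-standardize (b ∷ b′ ∷ w) =
      cong₂ _∷_ (slot-asc δ b b′ (content w)) (trans (pattern-shift _ (standardize (b′ ∷ w))) (pattern-standardize (b′ ∷ w)))

    cutCount-standardize : ∀ {k} (ε : Vec Bool k) w → cutCount ε (standardize w) ≡ W.cutCount ε w
    cutCount-standardize ε []      = trans (cutSum-[] ε _) (sym (W.cutSum-[] ε _))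
    cutCount-standardize ε (b ∷ w) =
      trans (cutCount≡cuts ε _ _) (trans (cong (cuts ε) (pattern-standardize (b ∷ w))) (sym (W.cutCount≡cuts ε b w)))

    -- Taking the constant weight `cutCount ε π` on the cuts of π⁻¹ produces the product, so
    -- standardization turns pairs of cuts into single cuts of words.
    sum-cutCounts : ∀ {k} (ε : Vec Bool k) n →
      sumL (perms n) (λ π → cutCount ε π * cutCount δ (inverse π)) ≡ ΣWords m n (W.cutCount ε)
    sum-cutCounts ε n = begin
      sumL (perms n) (λ π → cutCount ε π * cutCount δ (inverse π))
        ≡⟨ sumL-congᴬ (All.universal (λ π → trans (sym (cutSum-*ˡ δ (inverse π) (cutCount ε π) (const 1)))
             (cutSum-cong δ (inverse π) (λ μ → ℕ.*-identityʳ _))) (perms n)) ⟩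
      sumL (perms n) (λ π → cutSum δ (inverse π) (λ _ → cutCount ε π))
        ≡⟨ sum-standardize n (λ π _ → cutCount ε π) ⟩
      ΣWords m n (λ w → cutCount ε (standardize w))
        ≡⟨ ΣWords-cong m n (λ w _ → cutCount-standardize ε w) ⟩
      ΣWords m n (W.cutCount ε) ∎
      where open ≡-Reasoning

  -- Words with a cut, and monotone words

  monoWords : ∀ {m} → Vec Bool m → Bool → ℕ → ℕ
  monoWords {m} δ τ l = ΣWords m l (λ w → b2n (Cuts.mono (letterAsc δ) τ w))

  cutWords : ∀ {m k} → Vec Bool m → Vec Bool k → ℕ → ℕ
  cutWords {m} δ ε n = ΣWords m n (Patterns.cutCount (letterAsc δ) ε)

  -- Nothing is required of the step between two blocks, so the prefix forming the first block and
  -- the remaining suffix vary independently.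
  cutWords-∷ : ∀ {m k} (δ : Vec Bool m) τ (ε : Vec Bool k) n →
    cutWords δ (τ ∷ ε) n ≡ countN (suc n) (λ l → monoWords δ τ l * cutWords δ ε (n ∸ l))
  cutWords-∷ {m} δ τ ε n = begin
    ΣWords m n (λ w → countN (suc (length w)) (λ l → term l w))
      ≡⟨ ΣWords-cong m n (λ w eq → cong (λ N → countN (suc N) (λ l → term l w)) eq) ⟩
    ΣWords m n (λ w → countN (suc n) (λ l → term l w))
      ≡⟨ countN-ΣWords m n (suc n) term ⟩
    countN (suc n) (λ l → ΣWords m n (term l))
      ≡⟨ countN-cong (suc n) (λ { l (s≤s l≤n) → trans (cong (λ N → ΣWords m N (term l)) (sym (ℕ.m+[n∸m]≡n l≤n)))
           (ΣWords-split m l (n ∸ l) (λ u → b2n (Cuts.mono (letterAsc δ) τ u)) (Patterns.cutCount (letterAsc δ) ε)) }) ⟩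
    countN (suc n) (λ l → monoWords δ τ l * cutWords δ ε (n ∸ l)) ∎
    where
    open ≡-Reasoning
    term : ℕ → List (Fin m) → ℕ
    term l w = b2n (Cuts.mono (letterAsc δ) τ (take l w)) * Patterns.cutCount (letterAsc δ) ε (drop l w)

  cutWords-[]-suc : ∀ {m} (δ : Vec Bool m) n → cutWords δ [] (suc n) ≡ 0
  cutWords-[]-suc {m} δ n = ΣFin-zero m (λ b → ΣWords-zero m n)

  monoFrom : ∀ {m} → Vec Bool m → Bool → Fin m → ℕ → ℕ
  monoFrom {m} δ τ b l = ΣWords m l (λ w → b2n (Cuts.mono (letterAsc δ) τ (b ∷ w)))

  monoFrom-suc : ∀ {m} (δ : Vec Bool m) τ b l →
    monoFrom δ τ b (suc l) ≡ ΣFin m (λ b′ → b2n (letterAsc δ b b′ ≟ᵇ τ) * monoFrom δ τ b′ l)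
  monoFrom-suc {m} δ τ b l = ΣFin-cong m λ b′ →
    trans (ΣWords-cong m l (λ w _ → b2n-∧ (letterAsc δ b b′ ≟ᵇ τ) _)) (ΣWords-*ˡ m l (b2n (letterAsc δ b b′ ≟ᵇ τ)) _)
    where
    b2n-∧ : ∀ s t → b2n (s ∧ t) ≡ b2n s * b2n t
    b2n-∧ true  t = sym (ℕ.+-identityʳ _)
    b2n-∧ false t = refl

  module _ {m} (d : Bool) (δ : Vec Bool m) where

    asc-suc : ∀ b l → monoFrom (d ∷ δ) true (suc b) l ≡ monoFrom δ true b l
    asc-suc b zero    = refl
    asc-suc b (suc l) = trans (monoFrom-suc (d ∷ δ) true (suc b) l)
      (trans (ΣFin-cong m (λ b′ → cong (b2n (letterAsc δ b b′ ≟ᵇ true) *_) (asc-suc b′ l))) (sym (monoFrom-suc δ true b l)))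

    asc-words : ∀ l → monoWords (d ∷ δ) true (suc l) ≡ monoFrom (d ∷ δ) true zero l + monoWords δ true (suc l)
    asc-words l = cong (monoFrom (d ∷ δ) true zero l +_) (ΣFin-cong m (λ b → asc-suc b l))

    asc-zero : ∀ l → monoFrom (d ∷ δ) true zero (suc l) ≡ b2n (d ≟ᵇ true) * monoFrom (d ∷ δ) true zero l + monoWords δ true (suc l)
    asc-zero l = trans (monoFrom-suc (d ∷ δ) true zero l)
      (cong (b2n (d ≟ᵇ true) * monoFrom (d ∷ δ) true zero l +_)
        (ΣFin-cong m (λ b → trans (ℕ.*-identityˡ _) (asc-suc b l))))

    desc-suc : ∀ b l → monoFrom (d ∷ δ) false (suc b) (suc l)
      ≡ monoFrom (d ∷ δ) false zero l + ΣFin m (λ b′ → b2n (letterAsc δ b b′ ≟ᵇ false) * monoFrom (d ∷ δ) false (suc b′) l)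
    desc-suc b l = trans (monoFrom-suc (d ∷ δ) false (suc b) l) (cong (_+ ΣFin m (λ b′ → b2n (letterAsc δ b b′ ≟ᵇ false) * monoFrom (d ∷ δ) false (suc b′) l)) (ℕ.*-identityˡ _))

    desc-zero : ∀ l → monoFrom (d ∷ δ) false zero (suc l) ≡ b2n (d ≟ᵇ false) * monoFrom (d ∷ δ) false zero l
    desc-zero l = trans (monoFrom-suc (d ∷ δ) false zero l)
      (trans (cong (b2n (d ≟ᵇ false) * monoFrom (d ∷ δ) false zero l +_) (ΣFin-zero m (λ _ → refl))) (ℕ.+-identityʳ _))

  ΣFin-*-distrib : ∀ m (k f g : Fin m → ℕ) → ΣFin m (λ b → k b * (f b + g b)) ≡ ΣFin m (λ b → k b * f b) + ΣFin m (λ b → k b * g b)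
  ΣFin-*-distrib m k f g = trans (ΣFin-cong m (λ b → ℕ.*-distribˡ-+ (k b) (f b) (g b))) (ΣFin-+ m _ _)

  -- Repeating an ascending letter is an ascent. In a descending word the new smallest letter
  -- therefore occurs at most once, at the end.
  desc-suc-asc : ∀ {m} (δ : Vec Bool m) b l →
    monoFrom (true ∷ δ) false (suc b) (suc l) ≡ monoFrom δ false b (suc l) + monoFrom δ false b l
  desc-suc-asc {m} δ b zero = trans (desc-suc true δ b 0) (trans (ℕ.+-comm 1 _) (cong (_+ 1) (sym (monoFrom-suc δ false b 0))))
  desc-suc-asc {m} δ b (suc l) = begin
    monoFrom (true ∷ δ) false (suc b) (suc (suc l))
      ≡⟨ desc-suc true δ b (suc l) ⟩
    monoFrom (true ∷ δ) false zero (suc l) + ΣFin m (λ b′ → N b′ * monoFrom (true ∷ δ) false (suc b′) (suc l))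
      ≡⟨ cong₂ _+_ (desc-zero true δ l) (ΣFin-cong m (λ b′ → cong (N b′ *_) (desc-suc-asc δ b′ l))) ⟩
    ΣFin m (λ b′ → N b′ * (monoFrom δ false b′ (suc l) + monoFrom δ false b′ l))
      ≡⟨ ΣFin-*-distrib m N _ _ ⟩
    ΣFin m (λ b′ → N b′ * monoFrom δ false b′ (suc l)) + ΣFin m (λ b′ → N b′ * monoFrom δ false b′ l)
      ≡⟨ cong₂ _+_ (monoFrom-suc δ false b (suc l)) (monoFrom-suc δ false b l) ⟨
    monoFrom δ false b (suc (suc l)) + monoFrom δ false b (suc l) ∎
    where
    open ≡-Reasoning
    N : Fin m → ℕ
    N b′ = b2n (letterAsc δ b b′ ≟ᵇ false)

  desc-zero-desc : ∀ {m} (δ : Vec Bool m) l → monoFrom (false ∷ δ) false zero l ≡ 1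
  desc-zero-desc δ zero    = refl
  desc-zero-desc δ (suc l) = trans (desc-zero false δ l) (trans (ℕ.*-identityˡ _) (desc-zero-desc δ l))

  -- Repeating a descending letter is a descent. A descending word either lacks the new smallest
  -- letter or ends in it, and then one copy can be removed.
  desc-suc-desc : ∀ {m} (δ : Vec Bool m) b l →
    monoFrom (false ∷ δ) false (suc b) (suc l) ≡ monoFrom δ false b (suc l) + monoFrom (false ∷ δ) false (suc b) l
  desc-suc-desc {m} δ b zero = trans (desc-suc false δ b 0) (trans (ℕ.+-comm 1 _) (cong (_+ 1) (sym (monoFrom-suc δ false b 0))))
  desc-suc-desc {m} δ b (suc l) = begin
    monoFrom (false ∷ δ) false (suc b) (suc (suc l))
      ≡⟨ desc-suc false δ b (suc l) ⟩
    monoFrom (false ∷ δ) false zero (suc l) + ΣFin m (λ b′ → N b′ * monoFrom (false ∷ δ) false (suc b′) (suc l))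
      ≡⟨ cong₂ _+_ (trans (desc-zero-desc δ (suc l)) (sym (desc-zero-desc δ l))) (ΣFin-cong m (λ b′ → cong (N b′ *_) (desc-suc-desc δ b′ l))) ⟩
    z + ΣFin m (λ b′ → N b′ * (monoFrom δ false b′ (suc l) + monoFrom (false ∷ δ) false (suc b′) l))
      ≡⟨ cong (z +_) (ΣFin-*-distrib m N _ _) ⟩
    z + (ΣFin m (λ b′ → N b′ * monoFrom δ false b′ (suc l)) + r)
      ≡⟨ x+[y+z] z _ r ⟩
    ΣFin m (λ b′ → N b′ * monoFrom δ false b′ (suc l)) + (z + r)
      ≡⟨ cong₂ _+_ (monoFrom-suc δ false b (suc l)) (desc-suc false δ b l) ⟨
    monoFrom δ false b (suc (suc l)) + monoFrom (false ∷ δ) false (suc b) (suc l) ∎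
    where
    open ≡-Reasoning
    N : Fin m → ℕ
    N b′ = b2n (letterAsc δ b b′ ≟ᵇ false)
    z = monoFrom (false ∷ δ) false zero l
    r = ΣFin m (λ b′ → N b′ * monoFrom (false ∷ δ) false (suc b′) l)

  -- Letters equal to the new one may repeat in a monotone word exactly when d = τ.
  monoWords-∷ : ∀ {m} d (δ : Vec Bool m) τ l →
    monoWords (d ∷ δ) τ (suc l) ≡ monoWords δ τ (suc l) + (if d ≟ᵇ τ then monoWords (d ∷ δ) τ l else monoWords δ τ l)
  monoWords-∷ true δ true l = trans (asc-words true δ l) (trans (ℕ.+-comm _ (monoWords δ true (suc l))) (cong (monoWords δ true (suc l) +_) (go l)))
    where
    go : ∀ l → monoFrom (true ∷ δ) true zero l ≡ monoWords (true ∷ δ) true l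
    go zero    = refl
    go (suc l) = trans (asc-zero true δ l) (trans (cong (_+ monoWords δ true (suc l)) (ℕ.*-identityˡ _)) (sym (asc-words true δ l)))
  monoWords-∷ false δ true l = trans (asc-words false δ l) (trans (ℕ.+-comm _ (monoWords δ true (suc l))) (cong (monoWords δ true (suc l) +_) (go l)))
    where
    go : ∀ l → monoFrom (false ∷ δ) true zero l ≡ monoWords δ true l
    go zero    = refl
    go (suc l) = asc-zero false δ l
  monoWords-∷ {m} true δ false zero    = ℕ.+-comm 1 (monoWords δ false 1)
  monoWords-∷ {m} true δ false (suc l) = trans (cong (_+ ΣFin m (λ b → monoFrom (true ∷ δ) false (suc b) (suc l))) (desc-zero true δ l))
    (trans (ΣFin-cong m (λ b → desc-suc-asc δ b l)) (ΣFin-+ m _ _))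
  monoWords-∷ {m} false δ false zero    = ℕ.+-comm 1 (monoWords δ false 1)
  monoWords-∷ {m} false δ false (suc l) = begin
    monoFrom (false ∷ δ) false zero (suc l) + ΣFin m (λ b → monoFrom (false ∷ δ) false (suc b) (suc l))
      ≡⟨ cong₂ _+_ (trans (desc-zero-desc δ (suc l)) (sym (desc-zero-desc δ l))) (trans (ΣFin-cong m (λ b → desc-suc-desc δ b l)) (ΣFin-+ m _ _)) ⟩
    monoFrom (false ∷ δ) false zero l + (monoWords δ false (suc (suc l)) + ΣFin m (λ b → monoFrom (false ∷ δ) false (suc b) l))
      ≡⟨ x+[y+z] (monoFrom (false ∷ δ) false zero l) (monoWords δ false (suc (suc l))) _ ⟩
    monoWords δ false (suc (suc l)) + monoWords (false ∷ δ) false (suc l) ∎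
    where
    open ≡-Reasoning

  -- Direction sequences; descents and peaks of a pattern

  alternating : Bool → (r : ℕ) → Vec Bool r
  alternating τ zero    = []
  alternating τ (suc r) = τ ∷ alternating (not τ) r

  descAsc : (r : ℕ) → Vec Bool (r ℕ.* 2)
  descAsc zero    = []
  descAsc (suc r) = false ∷ true ∷ descAsc r

  -- The argument z is the step before the pattern; carrying it along gives a recursion by one step,
  -- as the transfer computations require.
  changesFrom : Bool → List Bool → ℕ
  changesFrom z []      = 0
  changesFrom z (y ∷ p) = b2n (not (z ≟ᵇ y)) ℕ.+ changesFrom y p

  peaksFrom : Bool → List Bool → ℕ
  peaksFrom z []      = 0
  peaksFrom z (y ∷ p) = b2n (z ∧ not y) ℕ.+ peaksFrom y p

  descents : List Bool → ℕ
  descents []      = 0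
  descents (y ∷ p) = b2n (not y) ℕ.+ descents p

  des≡descents : ∀ {w} → Linked Comparable w → des w ≡ descents (ascents w)
  des≡descents []       = refl
  des≡descents [-]      = refl
  des≡descents (l ∷ ls) = cong₂ _+_ (cong b2n l) (des≡descents ls)

  -- The initial state is `false`: the first step is not preceded by an ascent, so it cannot
  -- complete a peak.
  pk≡peaks : ∀ {x w} → Linked Comparable (x ∷ w) → pk (x ∷ w) ≡ peaksFrom false (ascents (x ∷ w))
  pk≡peaks [-]      = refl
  pk≡peaks (_ ∷ ls) = go ls
    where
    go : ∀ {x y r} → Linked Comparable (y ∷ r) → pk (x ∷ y ∷ r) ≡ peaksFrom (x <ᵇ y) (ascents (y ∷ r))
    go         [-]      = refl
    go {x} {y} (l ∷ ls) = cong₂ _+_ (cong (λ t → b2n ((x <ᵇ y) ∧ t)) l) (go ls)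

  -- Biruns as changes of direction

  constantPrefix : Bool → List Bool → ℕ → Bool
  constantPrefix t p       zero    = true
  constantPrefix t []      (suc j) = true
  constantPrefix t (s ∷ p) (suc j) = (t ≟ᵇ s) ∧ constantPrefix t p j

  increasing-take : ∀ y r j → increasing (take (suc j) (y ∷ r)) ≡ constantPrefix true (ascents (y ∷ r)) j
  increasing-take y r       zero    = refl
  increasing-take y []      (suc j) = refl
  increasing-take y (z ∷ r) (suc j) = cong ((y <ᵇ z) ∧_) (increasing-take z r j)

  decreasing-take : ∀ {y r} → Linked Comparable (y ∷ r) → ∀ j →
    decreasing (take (suc j) (y ∷ r)) ≡ constantPrefix false (ascents (y ∷ r)) j
  decreasing-take l        zero    = refl
  decreasing-take [-]      (suc j) = refl
  decreasing-take (l ∷ ls) (suc j) = cong₂ _∧_ l (decreasing-take ls j)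

  monotone-take : ∀ {x y r} → Linked Comparable (x ∷ y ∷ r) → ∀ j →
    monotone (take (suc (suc j)) (x ∷ y ∷ r)) ≡ constantPrefix (x <ᵇ y) (ascents (y ∷ r)) j
  monotone-take {x} {y} {r} (l ∷ ls) j rewrite l | increasing-take y r j | decreasing-take ls j with x <ᵇ y
  ... | true  = Bool.∨-identityʳ _
  ... | false = refl

  constantPrefix-antitone : ∀ t p j → constantPrefix t p (suc j) ≡ true → constantPrefix t p j ≡ true
  constantPrefix-antitone t p       zero    _ = refl
  constantPrefix-antitone t []      (suc j) _ = refl
  constantPrefix-antitone t (s ∷ p) (suc j) h with t ≟ᵇ s
  ... | true = constantPrefix-antitone t p j h

  <⇒<ᵇ-true : ∀ {i n} → i < n → (i <ᵇ n) ≡ true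
  <⇒<ᵇ-true (s≤s z≤n)       = refl
  <⇒<ᵇ-true (s≤s (s≤s i≤n)) = <⇒<ᵇ-true (s≤s i≤n)

  0≤ᵇ : ∀ j → ((0 <ᵇ j) ∨ (0 ≡ᵇ j)) ≡ true
  0≤ᵇ zero    = refl
  0≤ᵇ (suc j) = refl

  longestPrefix : (ℕ → Bool) → ℕ → ℕ → ℕ
  longestPrefix m N j = b2n (m j ∧ not ((suc j <ᵇ N) ∧ m (suc j)))

  -- For a downward closed m each summand is the difference of m at j and at j + 1, so the sum
  -- telescopes to the value at 0. At j = n the test against the length replaces the missing next
  -- value.
  count-longestPrefix : ∀ m → m 0 ≡ true → (∀ j → m (suc j) ≡ true → m j ≡ true) → ∀ n →
    countN (suc n) (longestPrefix m (suc n)) ≡ 1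
  count-longestPrefix m m₀ anti n = begin
    countN n (longestPrefix m (suc n)) + longestPrefix m (suc n) n
      ≡⟨ cong₂ _+_ (countN-cong n (λ j j<n → cong (λ t → b2n (m j ∧ not (t ∧ m (suc j)))) (<⇒<ᵇ-true j<n)))
                   (cong (λ t → b2n (m n ∧ not (t ∧ m (suc n)))) (<ᵇ-irrefl n)) ⟩
    countN n (λ j → b2n (m j ∧ not (m (suc j)))) + b2n (m n ∧ true)
      ≡⟨ cong (λ t → countN n (λ j → b2n (m j ∧ not (m (suc j)))) + b2n t) (Bool.∧-identityʳ (m n)) ⟩
    countN n (λ j → b2n (m j ∧ not (m (suc j)))) + b2n (m n)
      ≡⟨ telescope n ⟩
    b2n (m 0)
      ≡⟨ cong b2n m₀ ⟩
    1 ∎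
    where
    open ≡-Reasoning
    <ᵇ-irrefl : ∀ n → (n <ᵇ n) ≡ false
    <ᵇ-irrefl zero    = refl
    <ᵇ-irrefl (suc n) = <ᵇ-irrefl n
    step : ∀ s t → (t ≡ true → s ≡ true) → b2n (s ∧ not t) + b2n t ≡ b2n s
    step true  true  _ = refl
    step true  false _ = refl
    step false true  h with () ← h refl
    step false false _ = refl
    telescope : ∀ n → countN n (λ j → b2n (m j ∧ not (m (suc j)))) + b2n (m n) ≡ b2n (m 0)
    telescope zero    = refl
    telescope (suc n) = trans (ℕ.+-assoc (countN n (λ j → b2n (m j ∧ not (m (suc j))))) _ _)
      (trans (cong (countN n (λ j → b2n (m j ∧ not (m (suc j)))) +_) (step (m n) (m (suc n)) (anti n))) (telescope n))

  -- A row collects the biruns with a given start. Start 0 is kept apart, since there is no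
  -- extension to the left to be excluded.
  firstRow : List ℕ → ℕ
  firstRow w = countN (length w) (λ j → b2n (isBirun w 0 j))

  laterRows : List ℕ → ℕ
  laterRows w = countN (length w ∸ 1) (λ i → countN (length w) (λ j → b2n (isBirun w (suc i) j)))

  br-firstRow : ∀ x w → br (x ∷ w) ≡ firstRow (x ∷ w) + laterRows (x ∷ w)
  br-firstRow x w = countN-sucˡ (length w) _

  -- A segment that starts at index 2 or later, even after extension to the left, does not see x and
  -- is tested as a segment of the tail. Only the row of start 1 involves x; its entry for end 0
  -- vanishes.
  laterRows-∷ : ∀ x y w → laterRows (x ∷ y ∷ w)
    ≡ countN (length (y ∷ w)) (λ j → b2n (isBirun (x ∷ y ∷ w) 1 (suc j))) + laterRows (y ∷ w)
  laterRows-∷ x y w = trans (countN-cong (suc (length w)) (λ i _ → countN-sucˡ (suc (length w)) _)) (countN-sucˡ (length w) _)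

  prefixMono : List ℕ → ℕ → Bool
  prefixMono w j = monotone (take (suc j) w)

  isBirun-0 : ∀ w j → j < length w → b2n (isBirun w 0 j) ≡ longestPrefix (prefixMono w) (length w) j
  isBirun-0 w j j<n rewrite <⇒<ᵇ-true j<n | 0≤ᵇ j = refl

  isBirun-1 : ∀ x w j → j < length w → isBirun (x ∷ w) 1 (suc j)
    ≡ prefixMono w j ∧ not (prefixMono (x ∷ w) (suc j)) ∧ not ((suc j <ᵇ length w) ∧ prefixMono w (suc j))
  isBirun-1 x w j j<n rewrite <⇒<ᵇ-true j<n | 0≤ᵇ j = refl

  firstRow≡1 : ∀ {x y r} → Linked Comparable (x ∷ y ∷ r) → firstRow (x ∷ y ∷ r) ≡ 1
  firstRow≡1 {x} {y} {r} ls = trans (countN-cong (length w) (isBirun-0 w)) (count-longestPrefix (prefixMono w) refl anti (suc (length r)))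
    where
    w : List ℕ
    w = x ∷ y ∷ r
    anti : ∀ j → prefixMono w (suc j) ≡ true → prefixMono w j ≡ true
    anti zero    _ = refl
    anti (suc j) h = trans (monotone-take ls j)
      (constantPrefix-antitone (x <ᵇ y) (ascents (y ∷ r)) j (trans (sym (monotone-take ls (suc j))) h))

  -- A birun starting at the second letter is one of the tail not extended by x.
  secondRow : ∀ {x y z r} → Linked Comparable (x ∷ y ∷ z ∷ r) → let w = y ∷ z ∷ r in
    countN (length w) (λ j → b2n (isBirun (x ∷ w) 1 (suc j))) ≡ b2n (not ((x <ᵇ y) ≟ᵇ (y <ᵇ z)))
  secondRow {x} {y} {z} {r} ls@(_ ∷ ls′) = trans (countN-cong N (λ j j<N → cong b2n (isBirun-1 x w j j<N))) (go ((x <ᵇ y) ≟ᵇ (y <ᵇ z)) refl)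
    where
    w : List ℕ
    w = y ∷ z ∷ r
    N : ℕ
    N = length w
    m M : ℕ → Bool
    m j = prefixMono w j
    M j = prefixMono (x ∷ w) (suc j)
    M-suc : ∀ j → M (suc j) ≡ ((x <ᵇ y) ≟ᵇ (y <ᵇ z)) ∧ constantPrefix (x <ᵇ y) (ascents (z ∷ r)) j
    M-suc j = monotone-take ls (suc j)
    ≟ᵇ⇒≡ : ∀ s t → (s ≟ᵇ t) ≡ true → s ≡ t
    ≟ᵇ⇒≡ true  true  _ = refl
    ≟ᵇ⇒≡ false false _ = refl
    go : ∀ t → ((x <ᵇ y) ≟ᵇ (y <ᵇ z)) ≡ t → countN N (λ j → b2n (m j ∧ not (M j) ∧ not ((suc j <ᵇ N) ∧ m (suc j)))) ≡ b2n (not t)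
    go true  eq = countN-zero N (λ j _ → trans (cong (λ t → b2n (m j ∧ not t ∧ not ((suc j <ᵇ N) ∧ m (suc j)))) (M≡m j)) (contra (m j) _))
      where
      M≡m : ∀ j → M j ≡ m j
      M≡m zero    = monotone-take ls 0
      M≡m (suc j) = trans (M-suc j) (trans (cong (_∧ constantPrefix (x <ᵇ y) (ascents (z ∷ r)) j) eq)
        (trans (cong (λ t → constantPrefix t (ascents (z ∷ r)) j) (≟ᵇ⇒≡ _ _ eq)) (sym (monotone-take ls′ j))))
      contra : ∀ s t → b2n (s ∧ not s ∧ t) ≡ 0
      contra true  t = refl
      contra false t = refl
    go false eq = trans (countN-cong N (λ j _ → same j)) (trans (sym (countN-cong N (isBirun-0 w))) (firstRow≡1 ls′))
      where
      same : ∀ j → b2n (m j ∧ not (M j) ∧ not ((suc j <ᵇ N) ∧ m (suc j))) ≡ longestPrefix m N j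
      same zero rewrite monotone-take ls 0 | monotone-take ls′ 0 = refl
      same (suc j) = cong (λ t → b2n (m (suc j) ∧ not t ∧ not ((suc (suc j) <ᵇ N) ∧ m (suc (suc j)))))
        (trans (M-suc j) (cong (_∧ constantPrefix (x <ᵇ y) (ascents (z ∷ r)) j) eq))

  -- Consecutive biruns share one letter, the turning point, so every change of direction starts a
  -- new birun in addition to the first.
  br≡changes : ∀ {x y r} → Linked Comparable (x ∷ y ∷ r) → br (x ∷ y ∷ r) ≡ suc (changesFrom (x <ᵇ y) (ascents (y ∷ r)))
  br≡changes {x} {y} {[]} ls = begin
    br (x ∷ y ∷ [])
      ≡⟨ br-firstRow x (y ∷ []) ⟩
    firstRow (x ∷ y ∷ []) + laterRows (x ∷ y ∷ [])
      ≡⟨ cong₂ _+_ (firstRow≡1 ls) (trans (laterRows-∷ x y []) (cong (λ t → b2n t + 0)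
           (trans (isBirun-1 x (y ∷ []) 0 (s≤s z≤n)) (cong (λ t → not t ∧ true) (monotone-take ls 0))))) ⟩
    1 ∎
    where open ≡-Reasoning
  br≡changes {x} {y} {z ∷ r} ls@(_ ∷ ls′) = begin
    br (x ∷ y ∷ z ∷ r)
      ≡⟨ br-firstRow x (y ∷ z ∷ r) ⟩
    firstRow (x ∷ y ∷ z ∷ r) + laterRows (x ∷ y ∷ z ∷ r)
      ≡⟨ cong₂ _+_ (firstRow≡1 ls) (trans (laterRows-∷ x y (z ∷ r)) (cong (_+ laterRows (y ∷ z ∷ r)) (secondRow ls))) ⟩
    suc (c + laterRows (y ∷ z ∷ r))
      ≡⟨ ℕ.+-suc c _ ⟨
    c + suc (laterRows (y ∷ z ∷ r))
      -- The 1 of the whole word's first birun is reused as the first row of the tail, which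
      -- restores `br` of the tail.
      ≡⟨ cong (λ k → c + (k + laterRows (y ∷ z ∷ r))) (sym (firstRow≡1 ls′)) ⟩
    c + (firstRow (y ∷ z ∷ r) + laterRows (y ∷ z ∷ r))
      ≡⟨ cong (c +_) (trans (sym (br-firstRow y (z ∷ r))) (br≡changes ls′)) ⟩
    c + suc (changesFrom (y <ᵇ z) (ascents (z ∷ r)))
      ≡⟨ ℕ.+-suc c _ ⟩
    suc (changesFrom (x <ᵇ y) (ascents (y ∷ z ∷ r))) ∎
    where
    open ≡-Reasoning
    c : ℕ
    c = b2n (not ((x <ᵇ y) ≟ᵇ (y <ᵇ z)))

open Counting
open Patterns _<ᵇ_ using (cutCount; cutSum-[]; ascents; cutCount≡cuts)

-- Generating functions of cuts over an arbitrary commutative ring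

module GeneratingFunctions (R : CommutativeRing 0ℓ 0ℓ) where
  open CommutativeRing R hiding (zero) renaming (refl to ≈-refl; sym to ≈-sym; trans to ≈-trans)
  open import Algebra.Properties.Group +-group using () renaming (∙-cancelʳ to +-cancelʳ)
  open import Algebra.Properties.Semiring.Exp semiring public using (_^_; ^-homo-*; ^-congˡ; ^-assocʳ)
  open import Algebra.Properties.CommutativeSemiring.Exp commutativeSemiring using (^-distrib-*)
  open import Relation.Binary.Reasoning.Setoid setoid
  open import Algebra.Solver.Ring.NaturalCoefficients.Default commutativeSemiring using (solve; _:=_; _:+_; _:*_; con)

  -- Here e plays 1/(1 - y). Multiplying the equation for k by e and expanding e k by the equation
  -- for e leaves y e k on both sides; it cancels, so no division is made.
  solve-fixpoint : ∀ {y e k c} → e ≈ 1# + y * e → k ≈ c + y * k → k ≈ e * c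
  solve-fixpoint {y} {e} {k} {c} pe pk = +-cancelʳ (y * e * k) k (e * c) (begin
    k + y * e * k        ≈⟨ solve 3 (λ k y e → k :+ y :* e :* k := (con 1 :+ y :* e) :* k) ≈-refl k y e ⟩
    (1# + y * e) * k     ≈⟨ *-cong (≈-sym pe) pk ⟩
    e * (c + y * k)      ≈⟨ solve 4 (λ e c y k → e :* (c :+ y :* k) := e :* c :+ y :* e :* k) ≈-refl e c y k ⟩
    e * c + y * e * k    ∎)

  -- Connects `_^^_` with the power for which the exponent laws are available. The equation k ≡ l
  -- lets the exponent be rewritten in the same step.
  ^-unique : (_^′_ : Carrier → ℕ → Carrier) → (∀ z → (z ^′ 0) ≈ 1#) → (∀ z k → (z ^′ suc k) ≈ z * (z ^′ k)) →
    ∀ z k l → k ≡ l → (z ^′ k) ≈ z ^ l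
  ^-unique _^′_ p₀ pₛ z zero    _        refl = p₀ z
  ^-unique _^′_ p₀ pₛ z (suc k) _        refl = ≈-trans (pₛ z k) (*-congˡ (^-unique _^′_ p₀ pₛ z k k refl))

  -- Generating functions in a variable x, known only through their recursion.
  record IsOGF (x : Carrier) (gf : (ℕ → ℕ) → Carrier) : Set where
    field
      gf-cong : ∀ {f g} → (∀ n → f n ≡ g n) → gf f ≈ gf g
      gf-+    : ∀ f g → gf (λ n → f n ℕ.+ g n) ≈ gf f + gf g
      gf-0    : ∀ f → f 0 ≡ 0 → gf f ≈ x * gf (λ n → f (suc n))
      gf-1    : ∀ f → f 0 ≡ 1 → gf f ≈ 1# + x * gf (λ n → f (suc n))

    module _ {i} (geo : i ≈ 1# + x * i) where
      gf-const-1 : gf (λ _ → 1) ≈ i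
      gf-const-1 = ≈-trans (solve-fixpoint geo (gf-1 _ refl)) (*-identityʳ i)

      gf-const-0 : gf (λ _ → 0) ≈ 0#
      gf-const-0 = ≈-trans (solve-fixpoint geo (≈-trans (gf-0 _ refl) (≈-sym (+-identityˡ _)))) (zeroʳ i)

    gf-b2n : ∀ t f g → gf (λ n → b2n t ℕ.* f n ℕ.+ g n) ≈ (if t then gf f + gf g else gf g)
    gf-b2n true  f g = ≈-trans (gf-cong (λ n → cong (ℕ._+ g n) (ℕ.*-identityˡ (f n)))) (gf-+ f g)
    gf-b2n false f g = ≈-refl

  -- The elements i, e and u play 1/(1 - x), 1/(1 - x²) and 2x/(1 + x²), each through the equation
  -- that characterises it.
  module Biruns {x gf} (isOGF : IsOGF x gf) {i e u}
    (geo : i ≈ 1# + x * i) (geo² : e ≈ 1# + x * x * e) (hu : (1# + x * x) * u ≈ x + x) where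

    open IsOGF isOGF

    -- In `G` the first letter is already placed. Eliminating the other direction from the two
    -- recursions for `K` leaves the combination `L`, and a step at the front of the pattern acts on
    -- `L` as a scalar; this turns the transfer computation into a product.
    G K L : Bool → List Bool → Carrier
    G τ p = gf (λ r → cutsFrom τ (alternating (not τ) r) p)
    K τ p = gf (λ r → cuts (alternating τ r) p)
    L z p = G z p + x * G (not z) p

    K-rec : ∀ τ p → K τ p ≈ x * (G τ p + K (not τ) p)
    K-rec τ p = ≈-trans (gf-0 _ refl) (*-congˡ (gf-+ _ _))

    K-not-not : ∀ τ p → K (not (not τ)) p ≈ K τ p
    K-not-not τ p = reflexive (cong (λ t → K t p) (Bool.not-involutive τ))

    K≈ : ∀ τ p → K τ p ≈ e * (x * L τ p)
    K≈ τ p = solve-fixpoint geo² (begin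
      K τ p                                               ≈⟨ K-rec τ p ⟩
      x * (G τ p + K (not τ) p)                           ≈⟨ *-congˡ (+-congˡ (K-rec (not τ) p)) ⟩
      x * (G τ p + x * (G (not τ) p + K (not (not τ)) p)) ≈⟨ *-congˡ (+-congˡ (*-congˡ (+-congˡ (K-not-not τ p)))) ⟩
      x * (G τ p + x * (G (not τ) p + K τ p))
        ≈⟨ solve 4 (λ x g g′ k → x :* (g :+ x :* (g′ :+ k)) := x :* (g :+ x :* g′) :+ x :* x :* k) ≈-refl x (G τ p) (G (not τ) p) (K τ p) ⟩
      x * L τ p + x * x * K τ p ∎)

    G-same : ∀ y p → G y (y ∷ p) ≈ e * L y p
    G-same y p = begin
      G y (y ∷ p)
        ≈⟨ gf-b2n (y ≟ᵇ y) _ _ ⟩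
      (if y ≟ᵇ y then G y p + K (not y) p else K (not y) p)
        ≡⟨ cong (if_then G y p + K (not y) p else K (not y) p) (same y) ⟩
      G y p + K (not y) p
        ≈⟨ +-congˡ (≈-trans (K-rec (not y) p) (*-congˡ (+-congˡ (≈-trans (K-not-not y p) (K≈ y p))))) ⟩
      G y p + x * (G (not y) p + e * (x * L y p))
        ≈⟨ solve 4 (λ x e g g′ → g :+ x :* (g′ :+ e :* (x :* (g :+ x :* g′))) := (con 1 :+ x :* x :* e) :* (g :+ x :* g′))
             ≈-refl x e (G y p) (G (not y) p) ⟩
      (1# + x * x * e) * L y p
        ≈⟨ *-congʳ geo² ⟨
      e * L y p ∎
      where
      same : ∀ y → (y ≟ᵇ y) ≡ true
      same true  = refl
      same false = refl

    G-change : ∀ y p → G (not y) (y ∷ p) ≈ e * (x * L y p)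
    G-change y p = begin
      G (not y) (y ∷ p)
        ≈⟨ gf-b2n (y ≟ᵇ not y) _ _ ⟩
      (if y ≟ᵇ not y then G (not y) p + K (not (not y)) p else K (not (not y)) p)
        ≡⟨ cong (if_then G (not y) p + K (not (not y)) p else K (not (not y)) p) (different y) ⟩
      K (not (not y)) p
        ≈⟨ ≈-trans (K-not-not y p) (K≈ y p) ⟩
      e * (x * L y p) ∎
      where
      different : ∀ y → (y ≟ᵇ not y) ≡ false
      different true  = refl
      different false = refl

    L-same : ∀ y p → L y (y ∷ p) ≈ e * (1# + x * x) * L y p
    L-same y p = ≈-trans (+-cong (G-same y p) (*-congˡ (G-change y p)))
      (solve 3 (λ x e l → e :* l :+ x :* (e :* (x :* l)) := e :* (con 1 :+ x :* x) :* l) ≈-refl x e (L y p))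

    L-change : ∀ y p → L (not y) (y ∷ p) ≈ e * (1# + x * x) * (u * L y p)
    L-change y p = begin
      G (not y) (y ∷ p) + x * G (not (not y)) (y ∷ p)
        ≈⟨ +-cong (G-change y p) (*-congˡ (≈-trans (reflexive (cong (λ t → G t (y ∷ p)) (Bool.not-involutive y))) (G-same y p))) ⟩
      e * (x * L y p) + x * (e * L y p)
        ≈⟨ solve 3 (λ x e l → e :* (x :* l) :+ x :* (e :* l) := e :* (x :+ x) :* l) ≈-refl x e (L y p) ⟩
      e * (x + x) * L y p
        ≈⟨ *-congʳ (*-congˡ hu) ⟨
      e * ((1# + x * x) * u) * L y p
        ≈⟨ solve 4 (λ e s u l → e :* (s :* u) :* l := e :* s :* (u :* l)) ≈-refl e (1# + x * x) u (L y p) ⟩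
      e * (1# + x * x) * (u * L y p) ∎

    L-step : ∀ z y p → L z (y ∷ p) ≈ e * (1# + x * x) * (u ^ b2n (not (z ≟ᵇ y)) * L y p)
    L-step true  true  p = ≈-trans (L-same true p) (*-congˡ (≈-sym (*-identityˡ _)))
    L-step true  false p = ≈-trans (L-change false p) (*-congˡ (*-congʳ (≈-sym (*-identityʳ u))))
    L-step false true  p = ≈-trans (L-change true p) (*-congˡ (*-congʳ (≈-sym (*-identityʳ u))))
    L-step false false p = ≈-trans (L-same false p) (*-congˡ (≈-sym (*-identityˡ _)))

    L≈ : ∀ z p → L z p ≈ (1# + x) * i * ((e * (1# + x * x)) ^ length p * u ^ changesFrom z p)
    L≈ z [] = ≈-trans (+-cong (gf-const-1 geo) (*-congˡ (gf-const-1 geo)))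
      (solve 2 (λ x i → i :+ x :* i := (con 1 :+ x) :* i :* (con 1 :* con 1)) ≈-refl x i)
    L≈ z (y ∷ p) = begin
      L z (y ∷ p)
        ≈⟨ L-step z y p ⟩
      E * (ub * L y p)
        ≈⟨ *-congˡ (*-congˡ (L≈ y p)) ⟩
      E * (ub * ((1# + x) * i * (E ^ length p * u ^ changesFrom y p)))
        ≈⟨ solve 5 (λ E ub k El uc → E :* (ub :* (k :* (El :* uc))) := k :* (E :* El :* (ub :* uc)))
             ≈-refl E ub ((1# + x) * i) (E ^ length p) (u ^ changesFrom y p) ⟩
      (1# + x) * i * (E * E ^ length p * (ub * u ^ changesFrom y p))
        ≈⟨ *-congˡ (*-congˡ (^-homo-* u (b2n (not (z ≟ᵇ y))) (changesFrom y p))) ⟨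
      (1# + x) * i * (E ^ length (y ∷ p) * u ^ changesFrom z (y ∷ p)) ∎
      where
      E ub : Carrier
      E = e * (1# + x * x)
      ub = u ^ b2n (not (z ≟ᵇ y))

    bothCuts : List Bool → Carrier
    bothCuts p = gf (λ r → cuts (alternating true r) p ℕ.+ cuts (alternating false r) p)

    -- The recursions for the two directions exchange them, so the sum of the two satisfies one
    -- first-order equation.
    bothCuts-G : ∀ p → bothCuts p ≈ i * (x * (G true p + G false p))
    bothCuts-G p = ≈-trans (gf-+ _ _) (solve-fixpoint geo (begin
      K true p + K false p
        ≈⟨ +-cong (K-rec true p) (K-rec false p) ⟩
      x * (G true p + K false p) + x * (G false p + K true p)
        ≈⟨ solve 5 (λ x a b c d → x :* (a :+ d) :+ x :* (b :+ c) := x :* (a :+ b) :+ x :* (c :+ d))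
             ≈-refl x (G true p) (G false p) (K true p) (K false p) ⟩
      x * (G true p + G false p) + x * (K true p + K false p) ∎))

    bothCuts-[] : bothCuts [] ≈ i * (x * (i + i))
    bothCuts-[] = ≈-trans (bothCuts-G []) (*-congˡ (*-congˡ (+-cong (gf-const-1 geo) (gf-const-1 geo))))

    [1+x]e≈i : (1# + x) * e ≈ i
    [1+x]e≈i = ≈-trans (solve-fixpoint geo (begin
      (1# + x) * e             ≈⟨ solve 2 (λ x e → (con 1 :+ x) :* e := e :+ x :* e) ≈-refl x e ⟩
      e + x * e                ≈⟨ +-congʳ geo² ⟩
      1# + x * x * e + x * e   ≈⟨ solve 2 (λ x e → con 1 :+ x :* x :* e :+ x :* e := con 1 :+ x :* ((con 1 :+ x) :* e)) ≈-refl x e ⟩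
      1# + x * ((1# + x) * e)  ∎)) (*-identityʳ i)

    -- Origin of the cube: one factor 1 + x from the initial value of `L`, one from adding the two
    -- directions, one from 1/(1 - x) = (1 + x)/(1 - x²). The surplus (1 + x²) u equals x + x,
    -- whence the double on the right.
    bothCuts≈ : ∀ y p → let m = length p in
      (1# + x) ^ 3 * i * ((1# + x * x) ^ suc m * e ^ suc (suc m) * u ^ suc (changesFrom y p))
      ≈ bothCuts (y ∷ p) + bothCuts (y ∷ p)
    bothCuts≈ y p = begin
      (1# + x) ^ 3 * i * (s * s ^ m * (e * (e * e ^ m)) * (u * uc))
        ≈⟨ solve 7 (λ x i s sm e em v →
             (con 1 :+ x) :* ((con 1 :+ x) :* ((con 1 :+ x) :* con 1)) :* i :* (s :* sm :* (e :* (e :* em)) :* v)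
             := i :* e :* (con 1 :+ x) :* (con 1 :+ x) :* (((con 1 :+ x) :* e) :* (s :* v :* (em :* sm))))
             ≈-refl x i s (s ^ m) e (e ^ m) (u * uc) ⟩
      i * e * (1# + x) * (1# + x) * (((1# + x) * e) * (s * (u * uc) * (e ^ m * s ^ m)))
        ≈⟨ *-congˡ (*-cong [1+x]e≈i (*-cong (≈-trans (≈-sym (*-assoc s u uc)) (*-congʳ hu)) (≈-sym (^-distrib-* e s m)))) ⟩
      i * e * (1# + x) * (1# + x) * (i * ((x + x) * uc * (e * s) ^ m))
        ≈⟨ solve 5 (λ x i e uc Em → i :* e :* (con 1 :+ x) :* (con 1 :+ x) :* (i :* ((x :+ x) :* uc :* Em))
             := i :* (x :* (e :* (con 1 :+ x) :* ((con 1 :+ x) :* i :* (Em :* uc))))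
                :+ i :* (x :* (e :* (con 1 :+ x) :* ((con 1 :+ x) :* i :* (Em :* uc)))))
             ≈-refl x i e uc ((e * s) ^ m) ⟩
      k + k
        ≈⟨ +-cong k≈ k≈ ⟩
      bothCuts (y ∷ p) + bothCuts (y ∷ p) ∎
      where
      m : ℕ
      m = length p
      s uc k : Carrier
      s = 1# + x * x
      uc = u ^ changesFrom y p
      k = i * (x * (e * (1# + x) * ((1# + x) * i * ((e * s) ^ m * uc))))
      both : ∀ y → G true (y ∷ p) + G false (y ∷ p) ≈ e * (1# + x) * L y p
      both true  = ≈-trans (+-cong (G-same true p) (G-change true p))
        (solve 3 (λ x e l → e :* l :+ e :* (x :* l) := e :* (con 1 :+ x) :* l) ≈-refl x e (L true p))
      both false = ≈-trans (+-cong (G-change false p) (G-same false p))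
        (solve 3 (λ x e l → e :* (x :* l) :+ e :* l := e :* (con 1 :+ x) :* l) ≈-refl x e (L false p))
      k≈ : k ≈ bothCuts (y ∷ p)
      k≈ = ≈-sym (≈-trans (bothCuts-G (y ∷ p)) (*-congˡ (*-congˡ (≈-trans (both y) (*-congˡ (L≈ y p))))))

    bothCuts-series : ∀ a c d v k y p → let m = length p in
      a ≈ (1# + x) ^ 3 → c ≈ (1# + x * x) ^ suc m → d ≈ e ^ suc (suc m) → v ≈ u ^ suc (changesFrom y p) → k ≈ bothCuts (y ∷ p) →
      a * i * (c * d * v) ≈ k + k
    bothCuts-series a c d v k y p pa pc pd pv pk =
      ≈-trans (*-cong (*-congʳ pa) (*-cong (*-cong pc pd) pv)) (≈-trans (bothCuts≈ y p) (≈-sym (+-cong pk pk)))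

  module Peaks {x gf} (isOGF : IsOGF x gf) {i ρ}
    (geo : i ≈ 1# + x * i) (hρ : (1# + x) * (1# + x) * ρ ≈ (x + x) + (x + x)) where

    open IsOGF isOGF

    -- Here x marks a pair (descending, ascending), and the first letter lies in the descending
    -- block of a pair for `Gd`, in the ascending one for `Gi`. An ascent in front reduces both to
    -- `Li`, a descent both to `Ld`, so these two are the states of the transfer.
    Gd Gi K Li Ld : List Bool → Carrier
    Gd p = gf (λ r → cutsFrom false (true ∷ descAsc r) p)
    Gi p = gf (λ r → cutsFrom true (descAsc r) p)
    K p  = gf (λ r → cuts (descAsc r) p)
    Li p = Gi p + x * Gd p
    Ld p = Gd p + Gi p

    E : Carrier
    E = (1# + x) * i

    K≈ : ∀ p → K p ≈ i * (x * Ld p)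
    K≈ p = solve-fixpoint geo (begin
      K p                         ≈⟨ gf-0 _ refl ⟩
      x * gf (λ r → cutsFrom false (true ∷ descAsc r) p ℕ.+ (cutsFrom true (descAsc r) p ℕ.+ cuts (descAsc r) p))
                                  ≈⟨ *-congˡ (≈-trans (gf-+ _ _) (+-congˡ (gf-+ _ _))) ⟩
      x * (Gd p + (Gi p + K p))   ≈⟨ solve 4 (λ x a b k → x :* (a :+ (b :+ k)) := x :* (a :+ b) :+ x :* k) ≈-refl x (Gd p) (Gi p) (K p) ⟩
      x * Ld p + x * K p          ∎)

    Gi+K≈ : ∀ p → Gi p + K p ≈ i * Li p
    Gi+K≈ p = begin
      Gi p + K p                           ≈⟨ +-congˡ (K≈ p) ⟩
      Gi p + i * (x * (Gd p + Gi p))       ≈⟨ solve 4 (λ x i a b → b :+ i :* (x :* (a :+ b)) := (con 1 :+ x :* i) :* b :+ i :* (x :* a)) ≈-refl x i (Gd p) (Gi p) ⟩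
      (1# + x * i) * Gi p + i * (x * Gd p) ≈⟨ +-congʳ (*-congʳ geo) ⟨
      i * Gi p + i * (x * Gd p)            ≈⟨ distribˡ i _ _ ⟨
      i * Li p                             ∎

    Gd-asc : ∀ p → Gd (true ∷ p) ≈ i * Li p
    Gd-asc p = ≈-trans (gf-+ _ _) (Gi+K≈ p)

    Gi-asc : ∀ p → Gi (true ∷ p) ≈ i * Li p
    Gi-asc p = ≈-trans (gf-b2n true _ _) (Gi+K≈ p)

    Gd-desc : ∀ p → Gd (false ∷ p) ≈ i * Ld p
    Gd-desc p = begin
      Gd (false ∷ p)                 ≈⟨ ≈-trans (gf-b2n true _ _) (+-congˡ (gf-+ _ _)) ⟩
      Gd p + (Gi p + K p)            ≈⟨ +-congˡ (Gi+K≈ p) ⟩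
      Gd p + i * (Gi p + x * Gd p)   ≈⟨ solve 4 (λ x i a b → a :+ i :* (b :+ x :* a) := (con 1 :+ x :* i) :* a :+ i :* b) ≈-refl x i (Gd p) (Gi p) ⟩
      (1# + x * i) * Gd p + i * Gi p ≈⟨ +-congʳ (*-congʳ geo) ⟨
      i * Gd p + i * Gi p            ≈⟨ distribˡ i _ _ ⟨
      i * Ld p                       ∎

    Gi-desc : ∀ p → Gi (false ∷ p) ≈ i * (x * Ld p)
    Gi-desc p = ≈-trans (gf-b2n false (λ r → cutsFrom true (descAsc r) p) _) (K≈ p)

    -- Passing from `Li` to `Ld` happens exactly at an ascent followed by a descent. It yields the
    -- factor 4 x i², which is E² ρ: the weight ρ of a peak and two powers of E, one of them
    -- replacing the constant of `Ld`.
    Li≈ : ∀ p → Li p ≈ E * (E ^ length p * ρ ^ peaksFrom true p)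
    Ld≈ : ∀ p → Ld p ≈ (1# + 1#) * i * (E ^ length p * ρ ^ peaksFrom false p)
    Li≈ [] = ≈-trans (+-cong (gf-const-1 geo) (*-congˡ (gf-const-1 geo)))
      (solve 2 (λ x i → i :+ x :* i := (con 1 :+ x) :* i :* (con 1 :* con 1)) ≈-refl x i)
    Li≈ (true ∷ p) = begin
      Li (true ∷ p)                                   ≈⟨ +-cong (Gi-asc p) (*-congˡ (Gd-asc p)) ⟩
      i * Li p + x * (i * Li p)                       ≈⟨ solve 3 (λ x i l → i :* l :+ x :* (i :* l) := (con 1 :+ x) :* i :* l) ≈-refl x i (Li p) ⟩
      E * Li p                                        ≈⟨ *-congˡ (Li≈ p) ⟩
      E * (E * (E ^ length p * ρ ^ peaksFrom true p)) ≈⟨ *-congˡ (≈-sym (*-assoc _ _ _)) ⟩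
      E * (E * E ^ length p * ρ ^ peaksFrom true p)   ∎
    Li≈ (false ∷ p) = begin
      Li (false ∷ p)
        ≈⟨ +-cong (Gi-desc p) (*-congˡ (Gd-desc p)) ⟩
      i * (x * Ld p) + x * (i * Ld p)
        ≈⟨ +-cong (*-congˡ (*-congˡ (Ld≈ p))) (*-congˡ (*-congˡ (Ld≈ p))) ⟩
      i * (x * ((1# + 1#) * i * (El * ρp))) + x * (i * ((1# + 1#) * i * (El * ρp)))
        ≈⟨ solve 3 (λ x i q → i :* (x :* (con 2 :* i :* q)) :+ x :* (i :* (con 2 :* i :* q)) := ((x :+ x) :+ (x :+ x)) :* (i :* i :* q))
             ≈-refl x i (El * ρp) ⟩
      ((x + x) + (x + x)) * (i * i * (El * ρp))
        ≈⟨ *-congʳ hρ ⟨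
      (1# + x) * (1# + x) * ρ * (i * i * (El * ρp))
        ≈⟨ solve 5 (λ x i ρ El ρp → (con 1 :+ x) :* (con 1 :+ x) :* ρ :* (i :* i :* (El :* ρp))
             := (con 1 :+ x) :* i :* ((con 1 :+ x) :* i :* El :* (ρ :* ρp))) ≈-refl x i ρ El ρp ⟩
      E * (E * El * (ρ * ρp)) ∎
      where
      El ρp : Carrier
      El = E ^ length p
      ρp = ρ ^ peaksFrom false p
    Ld≈ [] = ≈-trans (+-cong (gf-const-1 geo) (gf-const-1 geo)) (solve 1 (λ i → i :+ i := con 2 :* i :* (con 1 :* con 1)) ≈-refl i)
    Ld≈ (true ∷ p) = begin
      Ld (true ∷ p)
        ≈⟨ +-cong (Gd-asc p) (Gi-asc p) ⟩
      i * Li p + i * Li p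
        ≈⟨ +-cong (*-congˡ (Li≈ p)) (*-congˡ (Li≈ p)) ⟩
      i * (E * (El * ρp)) + i * (E * (El * ρp))
        ≈⟨ solve 4 (λ i E El ρp → i :* (E :* (El :* ρp)) :+ i :* (E :* (El :* ρp)) := con 2 :* i :* (E :* El :* ρp)) ≈-refl i E El ρp ⟩
      (1# + 1#) * i * (E * El * ρp) ∎
      where
      El ρp : Carrier
      El = E ^ length p
      ρp = ρ ^ peaksFrom true p
    Ld≈ (false ∷ p) = begin
      Ld (false ∷ p)
        ≈⟨ +-cong (Gd-desc p) (Gi-desc p) ⟩
      i * Ld p + i * (x * Ld p)
        ≈⟨ solve 3 (λ x i l → i :* l :+ i :* (x :* l) := (con 1 :+ x) :* i :* l) ≈-refl x i (Ld p) ⟩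
      E * Ld p
        ≈⟨ *-congˡ (Ld≈ p) ⟩
      E * ((1# + 1#) * i * (El * ρp))
        ≈⟨ solve 4 (λ i E El ρp → E :* (con 2 :* i :* (El :* ρp)) := con 2 :* i :* (E :* El :* ρp)) ≈-refl i E El ρp ⟩
      (1# + 1#) * i * (E * El * ρp) ∎
      where
      El ρp : Carrier
      El = E ^ length p
      ρp = ρ ^ peaksFrom false p

    -- Entering the first pair gives i x, and `Ld` brings the constant 2 i; doubled, this is again 4
    -- x i² = E² ρ. Hence the exponent pk + 1 and the two extra powers of E.
    peakCuts≈ : ∀ p → let n = suc (length p) in
      (1# + x) ^ suc n * i ^ suc n * ρ ^ suc (peaksFrom false p) ≈ K p + K p
    peakCuts≈ p = begin
      (1# + x) ^ suc n * i ^ suc n * (ρ * ρp)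
        ≈⟨ *-congʳ (^-distrib-* (1# + x) i (suc n)) ⟨
      E * (E * El) * (ρ * ρp)
        ≈⟨ solve 5 (λ x i ρ El ρp → (con 1 :+ x) :* i :* ((con 1 :+ x) :* i :* El) :* (ρ :* ρp)
             := (con 1 :+ x) :* (con 1 :+ x) :* ρ :* (i :* i :* (El :* ρp))) ≈-refl x i ρ El ρp ⟩
      (1# + x) * (1# + x) * ρ * (i * i * (El * ρp))
        ≈⟨ *-congʳ hρ ⟩
      ((x + x) + (x + x)) * (i * i * (El * ρp))
        ≈⟨ solve 3 (λ x i q → ((x :+ x) :+ (x :+ x)) :* (i :* i :* q) := i :* (x :* (con 2 :* i :* q)) :+ i :* (x :* (con 2 :* i :* q)))
             ≈-refl x i (El * ρp) ⟩
      k + k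
        ≈⟨ +-cong k≈ k≈ ⟩
      K p + K p ∎
      where
      n : ℕ
      n = suc (length p)
      El ρp k : Carrier
      El = E ^ length p
      ρp = ρ ^ peaksFrom false p
      k = i * (x * ((1# + 1#) * i * (El * ρp)))
      k≈ : k ≈ K p
      k≈ = ≈-sym (≈-trans (K≈ p) (*-congˡ (*-congˡ (Ld≈ p))))

    peakCuts-series : ∀ c d v k p → let n = suc (length p) in
      c ≈ (1# + x) ^ suc n → d ≈ i ^ suc n → v ≈ ρ ^ suc (peaksFrom false p) → k ≈ K p → c * d * v ≈ k + k
    peakCuts-series c d v k p pc pd pv pk =
      ≈-trans (*-cong (*-cong pc pd) pv) (≈-trans (peakCuts≈ p) (≈-sym (+-cong pk pk)))

    peakCuts-[] : K [] ≈ i * (x * (i + i))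
    peakCuts-[] = ≈-trans (K≈ []) (*-congˡ (*-congˡ (+-cong (gf-const-1 geo) (gf-const-1 geo))))

  module Descents {x gf} (isOGF : IsOGF x gf) {i} (geo : i ≈ 1# + x * i) where

    open IsOGF isOGF

    G K : List Bool → Carrier
    G p = gf (λ r → cutsFrom true (replicate r true) p)
    K p = gf (λ r → cuts (replicate r true) p)

    K≈ : ∀ p → K p ≈ i * (x * G p)
    K≈ p = solve-fixpoint geo (≈-trans (gf-0 _ refl) (≈-trans (*-congˡ (gf-+ _ _)) (distribˡ _ _ _)))

    -- On an ascent the next letter moves on by any number of blocks, which gives i; on a descent by
    -- at least one block, which gives x i.
    G≈ : ∀ p → G p ≈ i ^ suc (length p) * x ^ descents p
    G≈ [] = ≈-trans (gf-const-1 geo) (solve 1 (λ i → i := i :* con 1 :* con 1) ≈-refl i)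
    G≈ (true ∷ p) = begin
      G (true ∷ p)                              ≈⟨ gf-b2n true _ _ ⟩
      G p + K p                                 ≈⟨ +-congˡ (K≈ p) ⟩
      G p + i * (x * G p)                       ≈⟨ solve 3 (λ x i g → g :+ i :* (x :* g) := (con 1 :+ x :* i) :* g) ≈-refl x i (G p) ⟩
      (1# + x * i) * G p                        ≈⟨ *-cong (≈-sym geo) (G≈ p) ⟩
      i * (i ^ suc (length p) * x ^ descents p) ≈⟨ *-assoc _ _ _ ⟨
      i * i ^ suc (length p) * x ^ descents p   ∎
    G≈ (false ∷ p) = begin
      G (false ∷ p)
        ≈⟨ gf-b2n false (λ r → cutsFrom true (replicate r true) p) _ ⟩
      K p
        ≈⟨ K≈ p ⟩
      i * (x * G p)
        ≈⟨ *-congˡ (*-congˡ (G≈ p)) ⟩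
      i * (x * (i ^ suc (length p) * x ^ descents p))
        ≈⟨ solve 4 (λ i x a b → i :* (x :* (a :* b)) := i :* a :* (x :* b)) ≈-refl i x (i ^ suc (length p)) (x ^ descents p) ⟩
      i * i ^ suc (length p) * (x * x ^ descents p) ∎

    descentCuts≈ : ∀ p → i ^ suc (suc (length p)) * x ^ suc (descents p) ≈ K p
    descentCuts≈ p = begin
      i * i ^ suc (length p) * (x * x ^ descents p)
        ≈⟨ solve 4 (λ i x a b → i :* a :* (x :* b) := i :* (x :* (a :* b))) ≈-refl i x (i ^ suc (length p)) (x ^ descents p) ⟩
      i * (x * (i ^ suc (length p) * x ^ descents p))
        ≈⟨ *-congˡ (*-congˡ (G≈ p)) ⟨
      i * (x * G p)
        ≈⟨ K≈ p ⟨
      K p ∎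

    descentCuts-series : ∀ c v k p → c ≈ i ^ suc (suc (length p)) → v ≈ x ^ suc (descents p) → k ≈ K p → c * v ≈ k
    descentCuts-series c v k p pc pv pk = ≈-trans (*-cong pc pv) (≈-trans (descentCuts≈ p) (≈-sym pk))

    descentCuts-[] : K [] ≈ i * (x * i)
    descentCuts-[] = ≈-trans (K≈ []) (*-congˡ (*-congˡ (gf-const-1 geo)))

  module Words {x gf} (isOGF : IsOGF x gf) {i} (geo : i ≈ 1# + x * i)
    (gf-conv : ∀ f g → gf (λ n → countN (suc n) (λ l → f l ℕ.* g (n ∸ l))) ≈ gf f * gf g) where

    open IsOGF isOGF

    factor : Bool → Bool → Carrier
    factor d τ = if d ≟ᵇ τ then i else 1# + x

    -- For d = τ the recursion of `monoWords-∷` refers back to the longer alphabet and is solved as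
    -- a fixpoint; for d different from τ it is explicit.
    mono≈ : ∀ {m} d (δ : Vec Bool m) τ → gf (monoWords (d ∷ δ) τ) ≈ factor d τ * gf (monoWords δ τ)
    mono≈ d δ τ = go (d ≟ᵇ τ) (monoWords-∷ d δ τ)
      where
      M M′ : ℕ → ℕ
      M = monoWords (d ∷ δ) τ
      M′ = monoWords δ τ
      unfold : ∀ {f} → (∀ l → M (suc l) ≡ M′ (suc l) ℕ.+ f l) → gf M ≈ gf M′ + x * gf f
      unfold {f} rec = begin
        gf M                                       ≈⟨ gf-1 M refl ⟩
        1# + x * gf (λ l → M (suc l))              ≈⟨ +-congˡ (*-congˡ (≈-trans (gf-cong rec) (gf-+ _ _))) ⟩
        1# + x * (gf (λ l → M′ (suc l)) + gf f)    ≈⟨ solve 3 (λ x a b → con 1 :+ x :* (a :+ b) := (con 1 :+ x :* a) :+ x :* b) ≈-refl x _ _ ⟩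
        1# + x * gf (λ l → M′ (suc l)) + x * gf f  ≈⟨ +-congʳ (gf-1 M′ refl) ⟨
        gf M′ + x * gf f                           ∎
      go : ∀ t → (∀ l → M (suc l) ≡ M′ (suc l) ℕ.+ (if t then M l else M′ l)) → gf M ≈ (if t then i else 1# + x) * gf M′
      go true  rec = solve-fixpoint geo (unfold rec)
      go false rec = ≈-trans (unfold rec) (solve 2 (λ x g → g :+ x :* g := (con 1 :+ x) :* g) ≈-refl x (gf M′))

    gf-one : ∀ f → f 0 ≡ 1 → (∀ n → f (suc n) ≡ 0) → gf f ≈ 1#
    gf-one f f₀ fₛ = begin
      gf f                           ≈⟨ gf-1 f f₀ ⟩
      1# + x * gf (λ n → f (suc n))  ≈⟨ +-congˡ (*-congˡ (≈-trans (gf-cong fₛ) (gf-const-0 geo))) ⟩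
      1# + x * 0#                    ≈⟨ ≈-trans (+-congˡ (zeroʳ x)) (+-identityʳ 1#) ⟩
      1#                             ∎

    -- Each pair of letters has one of either direction, hence one factor of each kind whatever τ
    -- is.
    mono-descAsc : ∀ j τ → gf (monoWords (descAsc j) τ) ≈ ((1# + x) * i) ^ j
    mono-descAsc zero    τ = gf-one _ refl (λ _ → refl)
    mono-descAsc (suc j) τ = begin
      gf (monoWords (descAsc (suc j)) τ)                              ≈⟨ mono≈ false (true ∷ descAsc j) τ ⟩
      factor false τ * gf (monoWords (true ∷ descAsc j) τ)            ≈⟨ *-congˡ (mono≈ true (descAsc j) τ) ⟩
      factor false τ * (factor true τ * gf (monoWords (descAsc j) τ)) ≈⟨ *-assoc _ _ _ ⟨
      factor false τ * factor true τ * gf (monoWords (descAsc j) τ)   ≈⟨ *-cong (both τ) (mono-descAsc j τ) ⟩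
      (1# + x) * i * ((1# + x) * i) ^ j                               ∎
      where
      both : ∀ τ → factor false τ * factor true τ ≈ (1# + x) * i
      both true  = ≈-refl
      both false = *-comm _ _

    mono-replicate : ∀ j τ → gf (monoWords (replicate j true) τ) ≈ factor true τ ^ j
    mono-replicate zero    τ = gf-one _ refl (λ _ → refl)
    mono-replicate (suc j) τ = ≈-trans (mono≈ true (replicate j true) τ) (*-congˡ (mono-replicate j τ))

    cutWords≈ : ∀ {m k} (δ : Vec Bool m) τ (ε : Vec Bool k) → gf (cutWords δ (τ ∷ ε)) ≈ gf (monoWords δ τ) * gf (cutWords δ ε)
    cutWords≈ δ τ ε = ≈-trans (gf-cong (cutWords-∷ δ τ ε)) (gf-conv _ _)

    cutWords-[]≈ : ∀ {m} (δ : Vec Bool m) → gf (cutWords δ []) ≈ 1#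
    cutWords-[]≈ δ = gf-one _ refl (cutWords-[]-suc δ)

    cutWords-descAsc : ∀ j {k} (ε : Vec Bool k) → gf (cutWords (descAsc j) ε) ≈ (((1# + x) * i) ^ j) ^ k
    cutWords-descAsc j []      = cutWords-[]≈ (descAsc j)
    cutWords-descAsc j (τ ∷ ε) = ≈-trans (cutWords≈ (descAsc j) τ ε) (*-cong (mono-descAsc j τ) (cutWords-descAsc j ε))

    -- With ascending letters only, the kind of factor is decided by the block; two consecutive
    -- blocks of opposite direction supply one of each.
    cutWords-pair : ∀ j τ r → let δ = replicate j true in
      gf (cutWords δ (alternating τ (suc (suc r)))) ≈ ((1# + x) * i) ^ j * gf (cutWords δ (alternating τ r))
    cutWords-pair j τ r = begin
      gf (cutWords δ (alternating τ (suc (suc r))))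
        ≈⟨ ≈-trans (cutWords≈ δ τ (alternating (not τ) (suc r))) (*-congˡ (cutWords≈ δ (not τ) (alternating (not (not τ)) r))) ⟩
      gf (monoWords δ τ) * (gf (monoWords δ (not τ)) * gf (cutWords δ (alternating (not (not τ)) r)))
        ≈⟨ *-cong (mono-replicate j τ) (*-cong (mono-replicate j (not τ))
             (reflexive (cong (λ t → gf (cutWords δ (alternating t r))) (Bool.not-involutive τ)))) ⟩
      factor true τ ^ j * (factor true (not τ) ^ j * gf (cutWords δ (alternating τ r)))
        ≈⟨ *-assoc _ _ _ ⟨
      factor true τ ^ j * factor true (not τ) ^ j * gf (cutWords δ (alternating τ r))
        ≈⟨ *-congʳ (≈-trans (≈-sym (^-distrib-* (factor true τ) (factor true (not τ)) j)) (^-congˡ j (both τ))) ⟩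
      ((1# + x) * i) ^ j * gf (cutWords δ (alternating τ r)) ∎
      where
      δ = replicate j true
      both : ∀ τ → factor true τ * factor true (not τ) ≈ (1# + x) * i
      both true  = *-comm _ _
      both false = ≈-refl

    cutWords-even : ∀ j τ r → gf (cutWords (replicate j true) (alternating τ (2 ℕ.* r))) ≈ (((1# + x) * i) ^ j) ^ r
    cutWords-even j τ zero    = cutWords-[]≈ (replicate j true)
    cutWords-even j τ (suc r) = begin
      gf (cutWords (replicate j true) (alternating τ (2 ℕ.* suc r)))
        ≡⟨ cong (λ k → gf (cutWords (replicate j true) (alternating τ k))) (ℕ.*-suc 2 r) ⟩
      gf (cutWords (replicate j true) (alternating τ (suc (suc (2 ℕ.* r)))))
        ≈⟨ ≈-trans (cutWords-pair j τ (2 ℕ.* r)) (*-congˡ (cutWords-even j τ r)) ⟩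
      ((1# + x) * i) ^ j * (((1# + x) * i) ^ j) ^ r ∎

  -- Single terms of both sides, over an arbitrary ring containing 1/2

  module Assembly (h : Carrier) (h+h≈1 : h + h ≈ 1#) where

    halve : ∀ z → h * (z + z) ≈ z
    halve z = ≈-trans (solve 2 (λ h z → h :* (z :+ z) := (h :+ h) :* z) ≈-refl h z) (≈-trans (*-congʳ h+h≈1) (*-identityˡ z))

    -- The geometric series of -y is the form in which 1/(1 + y) occurs in `sArg` and `tArg`.
    [1+y]j≈1 : ∀ {y j} → j ≈ 1# + (- y) * j → (1# + y) * j ≈ 1#
    [1+y]j≈1 {y} {j} p = begin
      (1# + y) * j               ≈⟨ distribʳ j 1# y ⟩
      1# * j + y * j             ≈⟨ +-congʳ (≈-trans (*-identityˡ j) p) ⟩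
      1# + (- y) * j + y * j     ≈⟨ +-assoc _ _ _ ⟩
      1# + ((- y) * j + y * j)   ≈⟨ +-congˡ (distribʳ j (- y) y) ⟨
      1# + (- y + y) * j         ≈⟨ +-congˡ (≈-trans (*-congʳ (-‿inverseˡ y)) (zeroˡ j)) ⟩
      1# + 0#                    ≈⟨ +-identityʳ 1# ⟩
      1#                         ∎

    -- The `0#` and `1#` on the right are what the sum over the one empty permutation and the zeroth
    -- power of x leave behind.
    term-zero : ∀ {i j c d} → c ≈ i + i → d ≈ j → i * j ≈ (h * (c * d) + 0#) * 1#
    term-zero {i} {j} {c} {d} pc pd = ≈-sym (begin
      (h * (c * d) + 0#) * 1#      ≈⟨ ≈-trans (*-identityʳ _) (+-identityʳ _) ⟩
      h * (c * d)                  ≈⟨ *-congˡ (*-cong pc pd) ⟩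
      h * ((i + i) * j)            ≈⟨ *-congˡ (distribʳ j i i) ⟩
      h * (i * j + i * j)          ≈⟨ halve (i * j) ⟩
      i * j                        ∎)

    -- A single letter has as many cuts as there are blocks. The half cancels the choice of
    -- alternating sequence; the remaining 2 comes from the 2b blocks of (descending, ascending)ᵇ.
    term-one-ipk : ∀ {s s₂ t x i j c d} → s₂ ≈ s + s → c ≈ i * (s * (i + i)) → d ≈ j * (t * (j + j)) →
      s₂ * t * x * (i * (i * 1#)) * (j * (j * 1#)) ≈ (h * (c * d) + 0#) * (x * 1#)
    term-one-ipk {s} {s₂} {t} {x} {i} {j} {c} {d} ps pc pd = ≈-sym (begin
      (h * (c * d) + 0#) * (x * 1#)
        ≈⟨ *-cong (≈-trans (+-identityʳ _) (*-congˡ (*-cong pc pd))) (*-identityʳ x) ⟩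
      h * (i * (s * (i + i)) * (j * (t * (j + j)))) * x
        ≈⟨ solve 6 (λ h s t x i j → h :* (i :* (s :* (i :+ i)) :* (j :* (t :* (j :+ j)))) :* x
             := h :* ((s :+ s) :* t :* x :* (i :* (i :* con 1)) :* (j :* (j :* con 1)) :+ (s :+ s) :* t :* x :* (i :* (i :* con 1)) :* (j :* (j :* con 1))))
             ≈-refl h s t x i j ⟩
      h * ((s + s) * t * x * (i * (i * 1#)) * (j * (j * 1#)) + (s + s) * t * x * (i * (i * 1#)) * (j * (j * 1#)))
        ≈⟨ halve _ ⟩
      (s + s) * t * x * (i * (i * 1#)) * (j * (j * 1#))
        ≈⟨ *-congʳ (*-congʳ (*-congʳ (*-congʳ ps))) ⟨
      s₂ * t * x * (i * (i * 1#)) * (j * (j * 1#)) ∎)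

    term-one-ides : ∀ {s t x i j c d} → c ≈ i * (s * (i + i)) → d ≈ j * (t * j) →
      s * t * x * (i * (i * 1#)) * (j * (j * 1#)) ≈ (h * (c * d) + 0#) * (x * 1#)
    term-one-ides {s} {t} {x} {i} {j} {c} {d} pc pd = ≈-sym (begin
      (h * (c * d) + 0#) * (x * 1#)
        ≈⟨ *-cong (≈-trans (+-identityʳ _) (*-congˡ (*-cong pc pd))) (*-identityʳ x) ⟩
      h * (i * (s * (i + i)) * (j * (t * j))) * x
        ≈⟨ solve 6 (λ h s t x i j → h :* (i :* (s :* (i :+ i)) :* (j :* (t :* j))) :* x
             := h :* (s :* t :* x :* (i :* (i :* con 1)) :* (j :* (j :* con 1)) :+ s :* t :* x :* (i :* (i :* con 1)) :* (j :* (j :* con 1))))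
             ≈-refl h s t x i j ⟩
      h * (s * t * x * (i * (i * 1#)) * (j * (j * 1#)) + s * t * x * (i * (i * 1#)) * (j * (j * 1#)))
        ≈⟨ halve _ ⟩
      s * t * x * (i * (i * 1#)) * (j * (j * 1#)) ∎)

    collect-ipk : ∀ f sm tm P en jn Xn → f * (sm * tm * P * en * jn * Xn) ≈ f * (sm * tm * en * jn) * P * Xn
    collect-ipk = solve 7 (λ f sm tm P en jn Xn → f :* (sm :* tm :* P :* en :* jn :* Xn) := f :* (sm :* tm :* en :* jn) :* P :* Xn) ≈-refl

    collect-ides : ∀ f sm P en jn Xn → f * (sm * P * en * jn * Xn) ≈ f * (sm * en * jn) * P * Xn
    collect-ides = solve 6 (λ f sm P en jn Xn → f :* (sm :* P :* en :* jn :* Xn) := f :* (sm :* en :* jn) :* P :* Xn) ≈-refl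

    -- The three halves of 1/8: one undoes the doubling in the count of cuts of π, one the doubling
    -- for π⁻¹, and the last averages the two alternating sequences. For descents nothing is
    -- doubled, which leaves 1/4.
    term-ipk : ∀ {f c₃ i sm tm en jn ub ρp k v} → f ≈ h * h * h * c₃ →
      c₃ * i * (sm * en * ub) ≈ k + k → tm * jn * ρp ≈ v + v → f * i * (sm * tm * en * jn) * (ub * ρp) ≈ h * (k * v)
    term-ipk {f} {c₃} {i} {sm} {tm} {en} {jn} {ub} {ρp} {k} {v} pf pk pv = begin
      f * i * (sm * tm * en * jn) * (ub * ρp)
        ≈⟨ *-congʳ (*-congʳ (*-congʳ pf)) ⟩
      h * h * h * c₃ * i * (sm * tm * en * jn) * (ub * ρp)
        ≈⟨ solve 9 (λ h c₃ i sm tm en jn ub ρp → h :* h :* h :* c₃ :* i :* (sm :* tm :* en :* jn) :* (ub :* ρp)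
             := h :* ((h :* (c₃ :* i :* (sm :* en :* ub))) :* (h :* (tm :* jn :* ρp)))) ≈-refl h c₃ i sm tm en jn ub ρp ⟩
      h * ((h * (c₃ * i * (sm * en * ub))) * (h * (tm * jn * ρp)))
        ≈⟨ *-congˡ (*-cong (≈-trans (*-congˡ pk) (halve k)) (≈-trans (*-congˡ pv) (halve v))) ⟩
      h * (k * v) ∎

    term-ides : ∀ {f c₃ i sm en jn ub td k v} → f ≈ h * h * c₃ →
      c₃ * i * (sm * en * ub) ≈ k + k → jn * td ≈ v → f * i * (sm * en * jn) * (ub * td) ≈ h * (k * v)
    term-ides {f} {c₃} {i} {sm} {en} {jn} {ub} {td} {k} {v} pf pk pv = begin
      f * i * (sm * en * jn) * (ub * td)
        ≈⟨ *-congʳ (*-congʳ (*-congʳ pf)) ⟩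
      h * h * c₃ * i * (sm * en * jn) * (ub * td)
        ≈⟨ solve 8 (λ h c₃ i sm en jn ub td → h :* h :* c₃ :* i :* (sm :* en :* jn) :* (ub :* td)
             := h :* ((h :* (c₃ :* i :* (sm :* en :* ub))) :* (jn :* td))) ≈-refl h c₃ i sm en jn ub td ⟩
      h * ((h * (c₃ * i * (sm * en * ub))) * (jn * td))
        ≈⟨ *-congˡ (*-cong (≈-trans (*-congˡ pk) (halve k)) pv) ⟩
      h * (k * v) ∎

    -- Here w₀ and w₁ stand for both alternating sequences together, of lengths 2i and 2i + 1. A
    -- summand of the right side thus carries one even and one odd power of s.
    rhs-term-ipk : ∀ {y yj s S² tj w₀ w₁} → h * w₀ ≈ y → h * w₁ ≈ yj * y →
      y * (1# + s * yj) * S² * tj ≈ h * w₀ * S² * tj + h * w₁ * (s * S²) * tj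
    rhs-term-ipk {y} {yj} {s} {S²} {tj} {w₀} {w₁} p₀ p₁ = begin
      y * (1# + s * yj) * S² * tj
        ≈⟨ solve 5 (λ y yj s S² tj → y :* (con 1 :+ s :* yj) :* S² :* tj := y :* S² :* tj :+ yj :* y :* (s :* S²) :* tj) ≈-refl y yj s S² tj ⟩
      y * S² * tj + yj * y * (s * S²) * tj
        ≈⟨ +-cong (*-congʳ (*-congʳ p₀)) (*-congʳ (*-congʳ p₁)) ⟨
      h * w₀ * S² * tj + h * w₁ * (s * S²) * tj ∎

    rhs-term-ides : ∀ {y t a b s S² tj w₀ w₁} → t ≈ 1# + 1# → w₀ ≈ y + y → w₁ ≈ a * y + b * y →
      h * (y * (t + s * a + s * b) * S² * tj) ≈ h * w₀ * S² * tj + h * w₁ * (s * S²) * tj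
    rhs-term-ides {y} {t} {a} {b} {s} {S²} {tj} {w₀} {w₁} pt p₀ p₁ = begin
      h * (y * (t + s * a + s * b) * S² * tj)
        ≈⟨ *-congˡ (*-congʳ (*-congʳ (*-congˡ (+-congʳ (+-congʳ pt))))) ⟩
      h * (y * ((1# + 1#) + s * a + s * b) * S² * tj)
        ≈⟨ solve 7 (λ h y a b s S² tj → h :* (y :* (con 2 :+ s :* a :+ s :* b) :* S² :* tj)
             := h :* (y :+ y) :* S² :* tj :+ h :* (a :* y :+ b :* y) :* (s :* S²) :* tj) ≈-refl h y a b s S² tj ⟩
      h * (y + y) * S² * tj + h * (a * y + b * y) * (s * S²) * tj
        ≈⟨ +-cong (*-congʳ (*-congʳ (*-congˡ p₀))) (*-congʳ (*-congʳ (*-congˡ p₁))) ⟨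
      h * w₀ * S² * tj + h * w₁ * (s * S²) * tj ∎

    birunArg : ∀ {s s₂ j} → s₂ ≈ s + s → (1# + s * s) * j ≈ 1# → (1# + s * s) * (s₂ * j) ≈ s + s
    birunArg {s} {s₂} {j} p₂ pj = begin
      (1# + s * s) * (s₂ * j)   ≈⟨ solve 3 (λ w s₂ j → w :* (s₂ :* j) := s₂ :* (w :* j)) ≈-refl (1# + s * s) s₂ j ⟩
      s₂ * ((1# + s * s) * j)   ≈⟨ *-cong p₂ pj ⟩
      (s + s) * 1#              ≈⟨ *-identityʳ _ ⟩
      s + s                     ∎

    peakArg : ∀ {t t₄ j} → t₄ ≈ (t + t) + (t + t) → (1# + t) * j ≈ 1# →
      (1# + t) * (1# + t) * (t₄ * (j * (j * 1#))) ≈ (t + t) + (t + t)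
    peakArg {t} {t₄} {j} p₄ pj = begin
      (1# + t) * (1# + t) * (t₄ * (j * (j * 1#)))
        ≈⟨ solve 3 (λ w t₄ j → w :* w :* (t₄ :* (j :* (j :* con 1))) := t₄ :* ((w :* j) :* (w :* j))) ≈-refl (1# + t) t₄ j ⟩
      t₄ * (((1# + t) * j) * ((1# + t) * j))
        ≈⟨ *-cong p₄ (≈-trans (*-cong pj pj) (*-identityʳ 1#)) ⟩
      ((t + t) + (t + t)) * 1#
        ≈⟨ *-identityʳ _ ⟩
      (t + t) + (t + t) ∎

-- Applied to a constructor, and not to a named ring, so that the projections
-- reduce at once and the statements of GF mention _⊛_ itself.
module GF = GeneratingFunctions (CommutativeRing.constructor FPS _≃_ _⊕_ _⊛_ ((-ℚ 1ℚ) ·_) 𝟘 𝟙 FPS-isCommutativeRing)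
open GF using (IsOGF; module IsOGF; module Biruns; module Peaks; module Descents; module Words; module Assembly)

-- The generating functions in s, t and x as power series

ι : ℕ → ℚ
ι zero    = 0ℚ
ι (suc n) = 1ℚ +ℚ ι n

ι-+ : ∀ m n → ι (m ℕ.+ n) ≡ ι m +ℚ ι n
ι-+ zero    n = sym (ℚ.+-identityˡ (ι n))
ι-+ (suc m) n = trans (cong (1ℚ +ℚ_) (ι-+ m n)) (sym (ℚ.+-assoc 1ℚ (ι m) (ι n)))

ι-* : ∀ m n → ι (m ℕ.* n) ≡ ι m *ℚ ι n
ι-* zero    n = sym (ℚ.*-zeroˡ (ι n))
ι-* (suc m) n = trans (ι-+ n (m ℕ.* n)) (trans (cong₂ _+ℚ_ (sym (ℚ.*-identityˡ (ι n))) (ι-* m n)) (sym (ℚ.*-distribʳ-+ (ι n) 1ℚ (ι m))))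

ι-countN : ∀ n f → ι (countN n f) ≡ Σ< n (λ i → ι (f i))
ι-countN zero    f = refl
ι-countN (suc n) f = trans (ι-+ (countN n f) (f n)) (cong (_+ℚ ι (f n)) (ι-countN n f))

𝕊 𝕋 𝕏 : (ℕ → ℕ) → FPS
𝕊 f a zero    zero    = ι (f a)
𝕊 f a zero    (suc c) = 0ℚ
𝕊 f a (suc b) c       = 0ℚ
𝕋 f zero    b zero    = ι (f b)
𝕋 f zero    b (suc c) = 0ℚ
𝕋 f (suc a) b c       = 0ℚ
𝕏 f zero    zero    c = ι (f c)
𝕏 f zero    (suc b) c = 0ℚ
𝕏 f (suc a) b       c = 0ℚ

ogf-S : IsOGF S 𝕊
ogf-S = record { gf-cong = cong′ ; gf-+ = plus ; gf-0 = unfold₀ ; gf-1 = unfold₁ }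
  where
  cong′ : ∀ {f g} → (∀ n → f n ≡ g n) → 𝕊 f ≃ 𝕊 g
  cong′ p .coeff a zero    zero    = cong ι (p a)
  cong′ p .coeff a zero    (suc c) = refl
  cong′ p .coeff a (suc b) c       = refl
  plus : ∀ f g → 𝕊 (λ n → f n ℕ.+ g n) ≃ 𝕊 f ⊕ 𝕊 g
  plus f g .coeff a zero    zero    = ι-+ (f a) (g a)
  plus f g .coeff a zero    (suc c) = refl
  plus f g .coeff a (suc b) c       = refl
  tail : ∀ f a b c → 𝕊 f (suc a) b c ≡ 𝕊 (λ n → f (suc n)) a b c
  tail f a zero    zero    = refl
  tail f a zero    (suc c) = refl
  tail f a (suc b) c       = refl
  unfold₀ : ∀ f → f 0 ≡ 0 → 𝕊 f ≃ S ⊛ 𝕊 (λ n → f (suc n))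
  unfold₀ f f₀ .coeff zero    b c = trans (head b c) (sym (S⊛-zero (𝕊 (λ n → f (suc n))) b c))
    where
    head : ∀ b c → 𝕊 f 0 b c ≡ 0ℚ
    head zero    zero    = cong ι f₀
    head zero    (suc c) = refl
    head (suc b) c       = refl
  unfold₀ f f₀ .coeff (suc a) b c = trans (tail f a b c) (sym (S⊛-suc (𝕊 (λ n → f (suc n))) a b c))
  unfold₁ : ∀ f → f 0 ≡ 1 → 𝕊 f ≃ 𝟙 ⊕ S ⊛ 𝕊 (λ n → f (suc n))
  unfold₁ f f₀ .coeff zero    b c =
    trans (head b c) (trans (sym (ℚ.+-identityʳ (𝟙 0 b c))) (cong (𝟙 0 b c +ℚ_) (sym (S⊛-zero (𝕊 (λ n → f (suc n))) b c))))
    where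
    head : ∀ b c → 𝕊 f 0 b c ≡ 𝟙 0 b c
    head zero    zero    = cong ι f₀
    head zero    (suc c) = refl
    head (suc b) c       = refl
  unfold₁ f f₀ .coeff (suc a) b c = trans (tail f a b c) (trans (sym (ℚ.+-identityˡ (𝕊 (λ n → f (suc n)) a b c)))
    (cong (0ℚ +ℚ_) (sym (S⊛-suc (𝕊 (λ n → f (suc n))) a b c))))

ogf-T : IsOGF T 𝕋
ogf-T = record { gf-cong = cong′ ; gf-+ = plus ; gf-0 = unfold₀ ; gf-1 = unfold₁ }
  where
  cong′ : ∀ {f g} → (∀ n → f n ≡ g n) → 𝕋 f ≃ 𝕋 g
  cong′ p .coeff zero    b zero    = cong ι (p b)
  cong′ p .coeff zero    b (suc c) = refl
  cong′ p .coeff (suc a) b c       = refl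
  plus : ∀ f g → 𝕋 (λ n → f n ℕ.+ g n) ≃ 𝕋 f ⊕ 𝕋 g
  plus f g .coeff zero    b zero    = ι-+ (f b) (g b)
  plus f g .coeff zero    b (suc c) = refl
  plus f g .coeff (suc a) b c       = refl
  tail : ∀ f a b c → 𝕋 f a (suc b) c ≡ 𝕋 (λ n → f (suc n)) a b c
  tail f zero    b zero    = refl
  tail f zero    b (suc c) = refl
  tail f (suc a) b c       = refl
  unfold₀ : ∀ f → f 0 ≡ 0 → 𝕋 f ≃ T ⊛ 𝕋 (λ n → f (suc n))
  unfold₀ f f₀ .coeff a zero    c = trans (head a c) (sym (T⊛-zero (𝕋 (λ n → f (suc n))) a c))
    where
    head : ∀ a c → 𝕋 f a 0 c ≡ 0ℚ
    head zero    zero    = cong ι f₀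
    head zero    (suc c) = refl
    head (suc a) c       = refl
  unfold₀ f f₀ .coeff a (suc b) c = trans (tail f a b c) (sym (T⊛-suc (𝕋 (λ n → f (suc n))) a b c))
  unfold₁ : ∀ f → f 0 ≡ 1 → 𝕋 f ≃ 𝟙 ⊕ T ⊛ 𝕋 (λ n → f (suc n))
  unfold₁ f f₀ .coeff a zero    c =
    trans (head a c) (trans (sym (ℚ.+-identityʳ (𝟙 a 0 c))) (cong (𝟙 a 0 c +ℚ_) (sym (T⊛-zero (𝕋 (λ n → f (suc n))) a c))))
    where
    head : ∀ a c → 𝕋 f a 0 c ≡ 𝟙 a 0 c
    head zero    zero    = cong ι f₀
    head zero    (suc c) = refl
    head (suc a) c       = refl
  unfold₁ f f₀ .coeff a (suc b) c = trans (tail f a b c) (trans (sym (ℚ.+-identityˡ (𝕋 (λ n → f (suc n)) a b c)))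
    (cong₂ _+ℚ_ (one a) (sym (T⊛-suc (𝕋 (λ n → f (suc n))) a b c))))
    where
    one : ∀ a → 0ℚ ≡ 𝟙 a (suc b) c
    one zero    = refl
    one (suc a) = refl

ogf-X : IsOGF X 𝕏
ogf-X = record { gf-cong = cong′ ; gf-+ = plus ; gf-0 = unfold₀ ; gf-1 = unfold₁ }
  where
  cong′ : ∀ {f g} → (∀ n → f n ≡ g n) → 𝕏 f ≃ 𝕏 g
  cong′ p .coeff zero    zero    c = cong ι (p c)
  cong′ p .coeff zero    (suc b) c = refl
  cong′ p .coeff (suc a) b       c = refl
  plus : ∀ f g → 𝕏 (λ n → f n ℕ.+ g n) ≃ 𝕏 f ⊕ 𝕏 g
  plus f g .coeff zero    zero    c = ι-+ (f c) (g c)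
  plus f g .coeff zero    (suc b) c = refl
  plus f g .coeff (suc a) b       c = refl
  tail : ∀ f a b c → 𝕏 f a b (suc c) ≡ 𝕏 (λ n → f (suc n)) a b c
  tail f zero    zero    c = refl
  tail f zero    (suc b) c = refl
  tail f (suc a) b       c = refl
  unfold₀ : ∀ f → f 0 ≡ 0 → 𝕏 f ≃ X ⊛ 𝕏 (λ n → f (suc n))
  unfold₀ f f₀ .coeff a b zero    = trans (head a b) (sym (X⊛-zero (𝕏 (λ n → f (suc n))) a b))
    where
    head : ∀ a b → 𝕏 f a b 0 ≡ 0ℚ
    head zero    zero    = cong ι f₀
    head zero    (suc b) = refl
    head (suc a) b       = refl
  unfold₀ f f₀ .coeff a b (suc c) = trans (tail f a b c) (sym (X⊛-suc (𝕏 (λ n → f (suc n))) a b c))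
  unfold₁ : ∀ f → f 0 ≡ 1 → 𝕏 f ≃ 𝟙 ⊕ X ⊛ 𝕏 (λ n → f (suc n))
  unfold₁ f f₀ .coeff a b zero =
    trans (head a b) (trans (sym (ℚ.+-identityʳ (𝟙 a b 0))) (cong (𝟙 a b 0 +ℚ_) (sym (X⊛-zero (𝕏 (λ n → f (suc n))) a b))))
    where
    head : ∀ a b → 𝕏 f a b 0 ≡ 𝟙 a b 0
    head zero    zero    = cong ι f₀
    head zero    (suc b) = refl
    head (suc a) b       = refl
  unfold₁ f f₀ .coeff a b (suc c) = trans (tail f a b c) (trans (sym (ℚ.+-identityˡ (𝕏 (λ n → f (suc n)) a b c)))
    (cong₂ _+ℚ_ (one a b) (sym (X⊛-suc (𝕏 (λ n → f (suc n))) a b c))))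
    where
    one : ∀ a b → 0ℚ ≡ 𝟙 a b (suc c)
    one zero    zero    = refl
    one zero    (suc b) = refl
    one (suc a) b       = refl

𝕏-conv : ∀ f g → 𝕏 (λ n → countN (suc n) (λ l → f l ℕ.* g (n ∸ l))) ≃ 𝕏 f ⊛ 𝕏 g
𝕏-conv f g .coeff a b c = sym (begin
  (𝕏 f ⊛ 𝕏 g) a b c                                       ≡⟨ coeff (⊛-cong {g = 𝕏 g} 𝕏≃const ≃-refl) a b c ⟩
  (PS₃.constant (PS₂.constant (λ n → ι (f n))) ⊛ 𝕏 g) a b c      ≡⟨ coeff (⊛≃⋆ (PS₃.constant (PS₂.constant (λ n → ι (f n)))) (𝕏 g)) a b c ⟩
  (PS₃.constant (PS₂.constant (λ n → ι (f n))) PS₃.⋆ 𝕏 g) a b c  ≡⟨ V₃.const-⋆ (PS₂.constant (λ n → ι (f n))) (𝕏 g) a b c ⟩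
  (PS₂.constant (λ n → ι (f n)) PS₂.⋆ 𝕏 g a) b c              ≡⟨ V₂.const-⋆ (λ n → ι (f n)) (𝕏 g a) b c ⟩
  ((λ n → ι (f n)) PS₁.⋆ 𝕏 g a b) c                        ≡⟨ ⋆₁-Σ< (λ n → ι (f n)) (𝕏 g a b) c ⟩
  Σ< (suc c) (λ l → ι (f l) *ℚ 𝕏 g a b (c ∸ l))            ≡⟨ last a b ⟩
  𝕏 (λ n → countN (suc n) (λ l → f l ℕ.* g (n ∸ l))) a b c ∎)
  where
  open ≡-Reasoning
  𝕏≃const : 𝕏 f ≃ PS₃.constant (PS₂.constant (λ n → ι (f n)))
  𝕏≃const .coeff zero    zero    c = refl
  𝕏≃const .coeff zero    (suc b) c = refl
  𝕏≃const .coeff (suc a) b       c = refl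
  last : ∀ a b → Σ< (suc c) (λ l → ι (f l) *ℚ 𝕏 g a b (c ∸ l)) ≡ 𝕏 (λ n → countN (suc n) (λ l → f l ℕ.* g (n ∸ l))) a b c
  last zero    zero    = sym (trans (ι-countN (suc c) _) (Σ<-cong (suc c) (λ l _ → ι-* (f l) (g (c ∸ l)))))
  last zero    (suc b) = Σ<-zero (suc c) (λ l _ → ℚ.*-zeroʳ (ι (f l)))
  last (suc a) b       = Σ<-zero (suc c) (λ l _ → ℚ.*-zeroʳ (ι (f l)))

-- The factors involve different variables, so at each level of nesting one of them is a constant,
-- once they are put in the right order.
𝕊⊛𝕋-coeff : ∀ f g a b c → (𝕊 f ⊛ 𝕋 g) a b c ≡ ι (f a) *ℚ 𝕋 g 0 b c
𝕊⊛𝕋-coeff f g a b c = begin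
  (𝕊 f ⊛ 𝕋 g) a b c                          ≡⟨ coeff (⊛-comm (𝕊 f) (𝕋 g)) a b c ⟩
  (𝕋 g ⊛ 𝕊 f) a b c                          ≡⟨ coeff (⊛-cong {g = 𝕊 f} 𝕋≃const ≃-refl) a b c ⟩
  (PS₃.constant (𝕋 g 0) ⊛ 𝕊 f) a b c            ≡⟨ coeff (⊛≃⋆ (PS₃.constant (𝕋 g 0)) (𝕊 f)) a b c ⟩
  (PS₃.constant (𝕋 g 0) PS₃.⋆ 𝕊 f) a b c        ≡⟨ V₃.const-⋆ (𝕋 g 0) (𝕊 f) a b c ⟩
  (𝕋 g 0 PS₂.⋆ 𝕊 f a) b c                    ≡⟨ PS₂.⋆-comm (𝕋 g 0) (𝕊 f a) b c ⟩
  (𝕊 f a PS₂.⋆ 𝕋 g 0) b c                    ≡⟨ PS₂.⋆-cong {𝕊 f a} {PS₂.constant (PS₁.constant (ι (f a)))} {𝕋 g 0} {𝕋 g 0} 𝕊≋const (λ _ _ → refl) b c ⟩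
  (PS₂.constant (PS₁.constant (ι (f a))) PS₂.⋆ 𝕋 g 0) b c ≡⟨ V₂.const-⋆ (PS₁.constant (ι (f a))) (𝕋 g 0) b c ⟩
  (PS₁.constant (ι (f a)) PS₁.⋆ 𝕋 g 0 b) c      ≡⟨ V₁.const-⋆ (ι (f a)) (𝕋 g 0 b) c ⟩
  ι (f a) *ℚ 𝕋 g 0 b c                       ∎
  where
  open ≡-Reasoning
  𝕋≃const : 𝕋 g ≃ PS₃.constant (𝕋 g 0)
  𝕋≃const .coeff zero    b c = refl
  𝕋≃const .coeff (suc a) b c = refl
  𝕊≋const : ∀ b c → 𝕊 f a b c ≡ PS₂.constant (PS₁.constant (ι (f a))) b c
  𝕊≋const zero    zero    = refl
  𝕊≋const zero    (suc c) = refl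
  𝕊≋const (suc b) c       = refl

-- Scalars, and the equations of the arguments substituted for s and t

½ : FPS
½ = q 1 2 · 𝟙

scalar-* : ∀ r s → (r *ℚ s) · 𝟙 ≃ (r · 𝟙) ⊛ (s · 𝟙)
scalar-* r s = ≃-trans (coeffwise λ a b c → ℚ.*-assoc r s (𝟙 a b c)) (·≃⊛ r (s · 𝟙))

½⊕½≃𝟙 : ½ ⊕ ½ ≃ 𝟙
½⊕½≃𝟙 .coeff a b c = trans (sym (ℚ.*-distribʳ-+ (𝟙 a b c) (q 1 2) (q 1 2))) (ℚ.*-identityˡ (𝟙 a b c))

⅛≃½³ : q 1 8 · 𝟙 ≃ ½ ⊛ ½ ⊛ ½
⅛≃½³ = ≃-trans (scalar-* (q 1 4) (q 1 2)) (⊛-cong {g = ½} (scalar-* (q 1 2) (q 1 2)) ≃-refl)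

¼≃½² : q 1 4 · 𝟙 ≃ ½ ⊛ ½
¼≃½² = scalar-* (q 1 2) (q 1 2)

2·≃ : ∀ f → q 2 1 · f ≃ f ⊕ f
2·≃ f .coeff a b c = trans (ℚ.*-distribʳ-+ (f a b c) 1ℚ 1ℚ) (cong₂ _+ℚ_ (ℚ.*-identityˡ (f a b c)) (ℚ.*-identityˡ (f a b c)))

4·≃ : ∀ f → q 4 1 · f ≃ (f ⊕ f) ⊕ (f ⊕ f)
4·≃ f .coeff a b c = trans (ℚ.*-distribʳ-+ (f a b c) (q 2 1) (q 2 1)) (cong₂ _+ℚ_ (coeff (2·≃ f) a b c) (coeff (2·≃ f) a b c))

open Assembly ½ ½⊕½≃𝟙

geo-s : inv1-s ≃ 𝟙 ⊕ S ⊛ inv1-s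
geo-s = inv1-‿unfold S Order-S

geo-t : inv1-t ≃ 𝟙 ⊕ T ⊛ inv1-t
geo-t = inv1-‿unfold T Order-T

geo-x : inv1-x ≃ 𝟙 ⊕ X ⊛ inv1-x
geo-x = inv1-‿unfold X Order-X

geo-s² : inv1-s² ≃ 𝟙 ⊕ S ⊛ S ⊛ inv1-s²
geo-s² = inv1-‿unfold (S ⊛ S) Order-S²

sArg-eq : (𝟙 ⊕ S ⊛ S) ⊛ sArg ≃ S ⊕ S
sArg-eq = birunArg {S} {q 2 1 · S} {inv1- ((-ℚ 1ℚ) · (S ⊛ S))} (2·≃ S)
  ([1+y]j≈1 {S ⊛ S} {inv1- ((-ℚ 1ℚ) · (S ⊛ S))} (inv1-‿unfold ((-ℚ 1ℚ) · (S ⊛ S)) (Order-· (-ℚ 1ℚ) (S ⊛ S) Order-S²)))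

tArg-eq : (𝟙 ⊕ T) ⊛ (𝟙 ⊕ T) ⊛ tArg ≃ (T ⊕ T) ⊕ (T ⊕ T)
tArg-eq = peakArg {T} {q 4 1 · T} {inv1- ((-ℚ 1ℚ) · T)} (4·≃ T)
  ([1+y]j≈1 {T} {inv1- ((-ℚ 1ℚ) · T)} (inv1-‿unfold ((-ℚ 1ℚ) · T) (Order-· (-ℚ 1ℚ) T Order-T)))

module BirunSeries = Biruns ogf-S {inv1-s} {inv1-s²} {sArg} geo-s geo-s² sArg-eq
module PeakSeries = Peaks ogf-T {inv1-t} {tArg} geo-t tArg-eq
module DescentSeries = Descents ogf-T {inv1-t} geo-t
module WordSeries = Words ogf-X {inv1-x} geo-x 𝕏-conv

-- Extracting a coefficient from the infinite sums

≡⇒≃ : ∀ {f g} → f ≡ g → f ≃ g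
≡⇒≃ refl = ≃-refl

-- No signature: comparing another spelling of the inferred type with what the
-- lemmas of GF expect would unfold products of series down to coefficients.
^^≃^ = GF.^-unique _^^_ (λ z → ≃-refl) (λ z k → ≃-refl)

⊛-ΣL : ∀ {A : Set} f (xs : List A) F → f ⊛ ΣL xs F ≃ ΣL xs (λ x → f ⊛ F x)
⊛-ΣL f []       F = R.zeroʳ f
⊛-ΣL f (x ∷ xs) F = ≃-trans (R.distribˡ f (F x) (ΣL xs F)) (⊕-cong (≃-refl {f ⊛ F x}) (⊛-ΣL f xs F))

ΣL-congᴬ : ∀ {A : Set} {xs : List A} {F G : A → FPS} → All (λ x → F x ≃ G x) xs → ΣL xs F ≃ ΣL xs G
ΣL-congᴬ []       = ≃-refl
ΣL-congᴬ (p ∷ ps) = ⊕-cong p (ΣL-congᴬ ps)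

Σ<-*ˡ : ∀ n r f → r *ℚ Σ< n f ≡ Σ< n (λ i → r *ℚ f i)
Σ<-*ˡ zero    r f = ℚ.*-zeroʳ r
Σ<-*ˡ (suc n) r f = trans (ℚ.*-distribˡ-+ r (Σ< n f) (f n)) (cong (_+ℚ r *ℚ f n) (Σ<-*ˡ n r f))

·-Σ∞ : ∀ r F → r · Σ∞ F ≃ Σ∞ (λ k → r · F k)
·-Σ∞ r F .coeff a b c = Σ<-*ˡ (suc (a ℕ.+ b ℕ.+ c)) r (λ k → F k a b c)

⊛X^-coeff : ∀ h n a b c → (∀ k → h a b (suc k) ≡ 0ℚ) → n ≢ c → (h ⊛ (X ^^ n)) a b c ≡ 0ℚ
⊛X^-coeff h n a b c free n≢c = trans (coeff (⊛-comm h (X ^^ n)) a b c) (go (ℕ.≤-<-connex n c))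
  where
  go : n ≤ c ⊎ c < n → ((X ^^ n) ⊛ h) a b c ≡ 0ℚ
  go (inj₂ c<n) = X^-< n h a b c c<n
  go (inj₁ n≤c) with k , refl ← ℕ.m≤n⇒∃[o]m+o≡n n≤c | k
  ... | zero   = contradiction (sym (ℕ.+-identityʳ n)) n≢c
  ... | suc k′ = trans (X^-+ n h a b (suc k′)) (free k′)

⊛X^-diagonal : ∀ h n a b → (h ⊛ (X ^^ n)) a b n ≡ h a b 0
⊛X^-diagonal h n a b = trans (coeff (⊛-comm h (X ^^ n)) a b n)
  (subst (λ c → ((X ^^ n) ⊛ h) a b c ≡ h a b 0) (ℕ.+-identityʳ n) (X^-+ n h a b 0))

-- As no H n contains x, the exponent c of x selects the summand n = c. The first two summands are
-- separate because `from2` omits them.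
collect-X : ∀ (H : ℕ → FPS) → (∀ n a b c → H n a b (suc c) ≡ 0ℚ) → ∀ a b c →
  ((H 0 ⊛ (X ^^ 0)) ⊕ (H 1 ⊛ (X ^^ 1)) ⊕ Σ∞ (from2 λ n → H n ⊛ (X ^^ n))) a b c ≡ H c a b 0
collect-X H free a b c = go c
  where
  off : ∀ n c → n ≢ c → (H n ⊛ (X ^^ n)) a b c ≡ 0ℚ
  off n c = ⊛X^-coeff (H n) n a b c (free n a b)
  rest : ℕ → FPS
  rest = from2 λ n → H n ⊛ (X ^^ n)
  rest-off : ∀ n c → n ≢ c → rest n a b c ≡ 0ℚ
  rest-off zero          c n≢c = refl
  rest-off (suc zero)    c n≢c = refl
  rest-off (suc (suc n)) c n≢c = off (suc (suc n)) c n≢c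
  third : ∀ c → Σ∞ rest a b c ≡ rest c a b c
  third c = Σ<-single (suc (a ℕ.+ b ℕ.+ c)) c (s≤s (ℕ.m≤n+m c (a ℕ.+ b))) (λ n n≢c → rest-off n c n≢c)
  +0 : ∀ x → x +ℚ 0ℚ ≡ x
  +0 = ℚ.+-identityʳ
  0+ : ∀ x → 0ℚ +ℚ x ≡ x
  0+ = ℚ.+-identityˡ
  go : ∀ c → (H 0 ⊛ (X ^^ 0)) a b c +ℚ (H 1 ⊛ (X ^^ 1)) a b c +ℚ Σ∞ rest a b c ≡ H c a b 0
  go zero = trans (cong₂ _+ℚ_ (cong₂ _+ℚ_ (⊛X^-diagonal (H 0) 0 a b) (off 1 0 (λ ()))) (third 0))
    (trans (+0 (H 0 a b 0 +ℚ 0ℚ)) (+0 (H 0 a b 0)))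
  go (suc zero) = trans (cong₂ _+ℚ_ (cong₂ _+ℚ_ (off 0 1 (λ ())) (⊛X^-diagonal (H 1) 1 a b)) (third 1))
    (trans (+0 (0ℚ +ℚ H 1 a b 0)) (0+ (H 1 a b 0)))
  go (suc (suc n)) = trans (cong₂ _+ℚ_ (cong₂ _+ℚ_ (off 0 (suc (suc n)) (λ ())) (off 1 (suc (suc n)) (λ ())))
      (trans (third (suc (suc n))) (⊛X^-diagonal (H (suc (suc n))) (suc (suc n)) a b)))
    (trans (cong (_+ℚ H (suc (suc n)) a b 0) (+0 0ℚ)) (0+ (H (suc (suc n)) a b 0)))

OnlyX : FPS → Set
OnlyX w = (∀ a b c → w (suc a) b c ≡ 0ℚ) × (∀ a b c → w a (suc b) c ≡ 0ℚ)

module _ (w : FPS) (free : OnlyX w) where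
  private
    swap : ∀ u v → w ⊛ (S ^^ u) ⊛ (T ^^ v) ≃ (T ^^ v) ⊛ ((S ^^ u) ⊛ w)
    swap u v = ≃-trans (⊛-comm (w ⊛ (S ^^ u)) (T ^^ v)) (⊛-cong {T ^^ v} ≃-refl (⊛-comm w (S ^^ u)))

  ⊛S^T^-diagonal : ∀ u v c → (w ⊛ (S ^^ u) ⊛ (T ^^ v)) u v c ≡ w 0 0 c
  ⊛S^T^-diagonal u v c = trans (coeff (swap u v) u v c)
    (trans (subst (λ k → ((T ^^ v) ⊛ ((S ^^ u) ⊛ w)) u k c ≡ ((S ^^ u) ⊛ w) u 0 c) (ℕ.+-identityʳ v) (T^-+ v ((S ^^ u) ⊛ w) u 0 c))
    (subst (λ k → ((S ^^ u) ⊛ w) k 0 c ≡ w 0 0 c) (ℕ.+-identityʳ u) (S^-+ u w 0 0 c)))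

  S^⊛-off : ∀ u a b c → u ≢ a → ((S ^^ u) ⊛ w) a b c ≡ 0ℚ
  S^⊛-off u a b c u≢a with ℕ.≤-<-connex u a
  ... | inj₂ a<u = S^-< u w a b c a<u
  ... | inj₁ u≤a with ℕ.m≤n⇒∃[o]m+o≡n u≤a
  ...   | zero  , refl = contradiction (sym (ℕ.+-identityʳ u)) u≢a
  ...   | suc k , refl = trans (S^-+ u w (suc k) b c) (proj₁ free k b c)

  S^⊛-suc : ∀ u a b c → ((S ^^ u) ⊛ w) a (suc b) c ≡ 0ℚ
  S^⊛-suc u a b c with ℕ.≤-<-connex u a
  ... | inj₂ a<u = S^-< u w a (suc b) c a<u
  ... | inj₁ u≤a with ℕ.m≤n⇒∃[o]m+o≡n u≤a
  ...   | k , refl = trans (S^-+ u w k (suc b) c) (proj₂ free k b c)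

  ⊛S^T^-offˢ : ∀ u v a b c → u ≢ a → (w ⊛ (S ^^ u) ⊛ (T ^^ v)) a b c ≡ 0ℚ
  ⊛S^T^-offˢ u v a b c u≢a = trans (coeff (swap u v) a b c) go
    where
    go : ((T ^^ v) ⊛ ((S ^^ u) ⊛ w)) a b c ≡ 0ℚ
    go with ℕ.≤-<-connex v b
    ... | inj₂ b<v = T^-< v ((S ^^ u) ⊛ w) a b c b<v
    ... | inj₁ v≤b with ℕ.m≤n⇒∃[o]m+o≡n v≤b
    ...   | k , refl = trans (T^-+ v ((S ^^ u) ⊛ w) a k c) (S^⊛-off u a k c u≢a)

  ⊛S^T^-offᵗ : ∀ u v a b c → v ≢ b → (w ⊛ (S ^^ u) ⊛ (T ^^ v)) a b c ≡ 0ℚ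
  ⊛S^T^-offᵗ u v a b c v≢b = trans (coeff (swap u v) a b c) go
    where
    go : ((T ^^ v) ⊛ ((S ^^ u) ⊛ w)) a b c ≡ 0ℚ
    go with ℕ.≤-<-connex v b
    ... | inj₂ b<v = T^-< v ((S ^^ u) ⊛ w) a b c b<v
    ... | inj₁ v≤b with ℕ.m≤n⇒∃[o]m+o≡n v≤b
    ...   | zero  , refl = contradiction (sym (ℕ.+-identityʳ v)) v≢b
    ...   | suc k , refl = trans (T^-+ v ((S ^^ u) ⊛ w) a (suc k) c) (S^⊛-suc u a k c)

parity : ∀ a → ∃ λ k → a ≡ 2 ℕ.* k ⊎ a ≡ suc (2 ℕ.* k)
parity zero    = 0 , inj₁ refl
parity (suc a) with parity a
... | k , inj₁ refl = k , inj₂ refl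
... | k , inj₂ refl = suc k , inj₁ (sym (ℕ.*-suc 2 k))

evenOdd : (ℕ → ℕ → FPS) → ℕ → ℕ → FPS
evenOdd W i j = W (2 ℕ.* i) j ⊛ (S ^^ (2 ℕ.* i)) ⊛ (T ^^ j) ⊕ W (suc (2 ℕ.* i)) j ⊛ (S ^^ suc (2 ℕ.* i)) ⊛ (T ^^ j)

-- W k j involves x alone and is multiplied by sᵏ tʲ, so only k = a and j = b survive; the parity of
-- a decides which half of `evenOdd` contains it.
collect-ST : ∀ (W : ℕ → ℕ → FPS) → (∀ k j → OnlyX (W k j)) → ∀ a b c →
  Σ∞ (λ i → Σ∞ (evenOdd W i)) a b c ≡ W a b 0 0 c
collect-ST W free a b c = trans (Σ<-cong N (λ i _ → row i)) (go (parity a))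
  where
  N : ℕ
  N = suc (a ℕ.+ b ℕ.+ c)
  even odd : ℕ → ℕ → ℚ
  even i j = (W (2 ℕ.* i) j ⊛ (S ^^ (2 ℕ.* i)) ⊛ (T ^^ j)) a b c
  odd i j = (W (suc (2 ℕ.* i)) j ⊛ (S ^^ suc (2 ℕ.* i)) ⊛ (T ^^ j)) a b c
  row : ∀ i → Σ< N (λ j → even i j +ℚ odd i j) ≡ even i b +ℚ odd i b
  row i = Σ<-single N b (s≤s (ℕ.≤-trans (ℕ.m≤n+m b a) (ℕ.m≤m+n (a ℕ.+ b) c))) λ j j≢b →
    trans (cong₂ _+ℚ_ (⊛S^T^-offᵗ (W (2 ℕ.* i) j) (free _ j) (2 ℕ.* i) j a b c j≢b)
                      (⊛S^T^-offᵗ (W (suc (2 ℕ.* i)) j) (free _ j) (suc (2 ℕ.* i)) j a b c j≢b)) (ℚ.+-identityˡ 0ℚ)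
  even-off : ∀ i → 2 ℕ.* i ≢ a → even i b ≡ 0ℚ
  even-off i = ⊛S^T^-offˢ (W (2 ℕ.* i) b) (free _ b) (2 ℕ.* i) b a b c
  odd-off : ∀ i → suc (2 ℕ.* i) ≢ a → odd i b ≡ 0ℚ
  odd-off i = ⊛S^T^-offˢ (W (suc (2 ℕ.* i)) b) (free _ b) (suc (2 ℕ.* i)) b a b c
  k<N : ∀ k → 2 ℕ.* k ≤ a → k < N
  k<N k p = s≤s (ℕ.≤-trans (ℕ.m≤m+n k (k ℕ.+ 0)) (ℕ.≤-trans p (ℕ.≤-trans (ℕ.m≤m+n a b) (ℕ.m≤m+n (a ℕ.+ b) c))))
  even≢odd : ∀ i k → suc (2 ℕ.* i) ≢ 2 ℕ.* k
  even≢odd i k eq = ℕ.even≢odd k i (sym eq)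
  double-injective : ∀ i k → 2 ℕ.* i ≡ 2 ℕ.* k → i ≡ k
  double-injective i k = ℕ.*-cancelˡ-≡ i k 2
  go : (∃ λ k → a ≡ 2 ℕ.* k ⊎ a ≡ suc (2 ℕ.* k)) → Σ< N (λ i → even i b +ℚ odd i b) ≡ W a b 0 0 c
  go (k , inj₁ a≡) =
    trans (Σ<-single N k (k<N k (ℕ.≤-reflexive (sym a≡))) λ i i≢k →
      trans (cong₂ _+ℚ_ (even-off i (λ eq → i≢k (double-injective i k (trans eq a≡)))) (odd-off i (λ eq → even≢odd i k (trans eq a≡)))) (ℚ.+-identityˡ 0ℚ))
    (trans (cong (even k b +ℚ_) (odd-off k (λ eq → even≢odd k k (trans eq a≡))))
    (trans (ℚ.+-identityʳ (even k b))
    (subst (λ a′ → (W (2 ℕ.* k) b ⊛ (S ^^ (2 ℕ.* k)) ⊛ (T ^^ b)) a′ b c ≡ W a′ b 0 0 c) (sym a≡)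
      (⊛S^T^-diagonal (W (2 ℕ.* k) b) (free _ b) (2 ℕ.* k) b c))))
  go (k , inj₂ a≡) =
    trans (Σ<-single N k (k<N k (ℕ.≤-trans (ℕ.n≤1+n _) (ℕ.≤-reflexive (sym a≡)))) λ i i≢k →
      trans (cong₂ _+ℚ_ (even-off i (λ eq → even≢odd k i (sym (trans eq a≡)))) (odd-off i (λ eq → i≢k (double-injective i k (ℕ.suc-injective (trans eq a≡)))))) (ℚ.+-identityˡ 0ℚ))
    (trans (cong (_+ℚ odd k b) (even-off k (λ eq → even≢odd k k (sym (trans eq a≡)))))
    (trans (ℚ.+-identityˡ (odd k b))
    (subst (λ a′ → (W (suc (2 ℕ.* k)) b ⊛ (S ^^ suc (2 ℕ.* k)) ⊛ (T ^^ b)) a′ b c ≡ W a′ b 0 0 c) (sym a≡)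
      (⊛S^T^-diagonal (W (suc (2 ℕ.* k)) b) (free _ b) (suc (2 ℕ.* k)) b c))))

-- Comparison of permutations with words

birunCuts : List ℕ → ℕ → ℕ
birunCuts π a = cutCount (alternating true a) π ℕ.+ cutCount (alternating false a) π

-- The two parts of the theorem differ in the sequences δ b, along which the inverse is cut, so the
-- comparison is made once for all of them.
module Comparison {len : ℕ → ℕ} (δ : ∀ b → Vec Bool (len b)) where

  inverseCuts : List ℕ → ℕ → ℕ
  inverseCuts σ b = cutCount (δ b) σ

  permTerm : List ℕ → FPS
  permTerm π = ½ ⊛ (𝕊 (birunCuts π) ⊛ 𝕋 (inverseCuts (inverse π)))

  -- To become the coefficient of xⁿ of the left side, just as `W k j` below becomes that of sᵏ tʲ
  -- of the right side.
  H : ℕ → FPS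
  H n = ΣL (perms n) permTerm

  W : ℕ → ℕ → FPS
  W k j = ½ ⊛ (𝕏 (cutWords (δ j) (alternating true k)) ⊕ 𝕏 (cutWords (δ j) (alternating false k)))

  permTerm-coeff : ∀ π a b c → permTerm π a b c ≡ q 1 2 *ℚ (ι (birunCuts π a) *ℚ 𝕋 (inverseCuts (inverse π)) 0 b c)
  permTerm-coeff π a b c = trans (sym (coeff (·≃⊛ (q 1 2) (𝕊 (birunCuts π) ⊛ 𝕋 (inverseCuts (inverse π)))) a b c))
    (cong (q 1 2 *ℚ_) (𝕊⊛𝕋-coeff (birunCuts π) (inverseCuts (inverse π)) a b c))

  H-coeff : ∀ n a b → H n a b 0 ≡ q 1 2 *ℚ ι (sumL (perms n) (λ π → birunCuts π a ℕ.* inverseCuts (inverse π) b))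
  H-coeff n a b = go (perms n)
    where
    go : ∀ πs → ΣL πs permTerm a b 0 ≡ q 1 2 *ℚ ι (sumL πs (λ π → birunCuts π a ℕ.* inverseCuts (inverse π) b))
    go []       = sym (ℚ.*-zeroʳ (q 1 2))
    go (π ∷ πs) = trans (cong₂ _+ℚ_ (trans (permTerm-coeff π a b 0)
        (cong (q 1 2 *ℚ_) (sym (ι-* (birunCuts π a) (inverseCuts (inverse π) b))))) (go πs))
      (trans (sym (ℚ.*-distribˡ-+ (q 1 2) (ι (birunCuts π a ℕ.* inverseCuts (inverse π) b)) _))
        (cong (q 1 2 *ℚ_) (sym (ι-+ (birunCuts π a ℕ.* inverseCuts (inverse π) b) _))))

  H-free : ∀ n a b c → H n a b (suc c) ≡ 0ℚ
  H-free n a b c = go (perms n)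
    where
    go : ∀ πs → ΣL πs permTerm a b (suc c) ≡ 0ℚ
    go []       = refl
    go (π ∷ πs) = trans (cong₂ _+ℚ_ (trans (permTerm-coeff π a b (suc c))
        (trans (cong (q 1 2 *ℚ_) (ℚ.*-zeroʳ (ι (birunCuts π a)))) (ℚ.*-zeroʳ (q 1 2)))) (go πs)) (ℚ.+-identityˡ 0ℚ)

  W-coeff : ∀ k j a b c → W k j a b c
    ≡ q 1 2 *ℚ (𝕏 (cutWords (δ j) (alternating true k)) a b c +ℚ 𝕏 (cutWords (δ j) (alternating false k)) a b c)
  W-coeff k j a b c = sym (coeff (·≃⊛ (q 1 2) (𝕏 (cutWords (δ j) (alternating true k)) ⊕ 𝕏 (cutWords (δ j) (alternating false k)))) a b c)

  W-free : ∀ k j → OnlyX (W k j)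
  W-free k j = (λ a b c → trans (W-coeff k j (suc a) b c) refl) , (λ a b c → trans (W-coeff k j a (suc b) c) (zeros a b c))
    where
    zeros : ∀ a b c → q 1 2 *ℚ (𝕏 (cutWords (δ j) (alternating true k)) a (suc b) c +ℚ 𝕏 (cutWords (δ j) (alternating false k)) a (suc b) c) ≡ 0ℚ
    zeros zero    b c = refl
    zeros (suc a) b c = refl

  sum-birunCuts : ∀ n a b → sumL (perms n) (λ π → birunCuts π a ℕ.* inverseCuts (inverse π) b)
    ≡ cutWords (δ b) (alternating true a) n ℕ.+ cutWords (δ b) (alternating false a) n
  sum-birunCuts n a b = trans
    (sumL-congᴬ (All.universal (λ π → ℕ.*-distribʳ-+ (inverseCuts (inverse π) b) (cutCount (alternating true a) π) (cutCount (alternating false a) π)) (perms n)))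
    (trans (sumL-+ (perms n) _ _) (cong₂ ℕ._+_ (sum-cutCounts (δ b) (alternating true a) n) (sum-cutCounts (δ b) (alternating false a) n)))

  -- At sᵃ tᵇ xᶜ a single count remains on each side: pairs of cuts over permutations of [c], and
  -- cuts of words of length c over the letters of δ b. `sum-birunCuts` equates them.
  comparison : (H 0 ⊛ (X ^^ 0)) ⊕ (H 1 ⊛ (X ^^ 1)) ⊕ Σ∞ (from2 λ n → H n ⊛ (X ^^ n)) ≃ Σ∞ (λ i → Σ∞ (evenOdd W i))
  comparison .coeff a b c = begin
    ((H 0 ⊛ (X ^^ 0)) ⊕ (H 1 ⊛ (X ^^ 1)) ⊕ Σ∞ (from2 λ n → H n ⊛ (X ^^ n))) a b c
      ≡⟨ collect-X H H-free a b c ⟩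
    H c a b 0
      ≡⟨ H-coeff c a b ⟩
    q 1 2 *ℚ ι (sumL (perms c) (λ π → birunCuts π a ℕ.* inverseCuts (inverse π) b))
      ≡⟨ cong (λ k → q 1 2 *ℚ ι k) (sum-birunCuts c a b) ⟩
    q 1 2 *ℚ ι (cutWords (δ b) (alternating true a) c ℕ.+ cutWords (δ b) (alternating false a) c)
      ≡⟨ cong (q 1 2 *ℚ_) (ι-+ (cutWords (δ b) (alternating true a) c) (cutWords (δ b) (alternating false a) c)) ⟩
    q 1 2 *ℚ (ι (cutWords (δ b) (alternating true a) c) +ℚ ι (cutWords (δ b) (alternating false a) c))
      ≡⟨ W-coeff a b 0 0 c ⟨
    W a b 0 0 c
      ≡⟨ collect-ST W W-free a b c ⟨
    Σ∞ (λ i → Σ∞ (evenOdd W i)) a b c ∎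
    where open ≡-Reasoning

  H-sum : ∀ n → ΣL (perms n) permTerm ≃ H n
  H-sum n = ≃-refl

  -- The prefactor may be moved under the infinite sum because Xⁿ gives the n-th summand order n.
  tail-terms : ∀ f (F : ℕ → FPS) → (∀ m → f ⊛ (F (suc (suc m)) ⊛ (X ^^ suc (suc m))) ≃ H (suc (suc m)) ⊛ (X ^^ suc (suc m))) →
    f ⊛ Σ∞ (from2 λ n → F n ⊛ (X ^^ n)) ≃ Σ∞ (from2 λ n → H n ⊛ (X ^^ n))
  tail-terms f F p = ≃-trans (⊛-Σ∞ f (from2 λ n → F n ⊛ (X ^^ n)) order) (Σ∞-cong terms)
    where
    order : ∀ k → Order k (from2 (λ n → F n ⊛ (X ^^ n)) k)
    order zero          a b c ()
    order (suc zero)    a b c _ = refl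
    order (suc (suc k)) = Order-⊛X^ (F (suc (suc k))) (suc (suc k))
    terms : ∀ k → f ⊛ from2 (λ n → F n ⊛ (X ^^ n)) k ≃ from2 (λ n → H n ⊛ (X ^^ n)) k
    terms zero          = R.zeroʳ f
    terms (suc zero)    = R.zeroʳ f
    terms (suc (suc k)) = p k

-- The left-hand sides

length-pattern : ∀ x r → length (ascents (x ∷ r)) ≡ length r
length-pattern x []      = refl
length-pattern x (y ∷ r) = cong suc (length-pattern y r)

birunCuts-[] : 𝕊 (birunCuts []) ≃ inv1-s ⊕ inv1-s
birunCuts-[] = ≃-trans (gf-cong (λ a → cong₂ ℕ._+_ (cutSum-[] (alternating true a) (const 1)) (cutSum-[] (alternating false a) (const 1))))
  (≃-trans (gf-+ (λ _ → 1) (λ _ → 1)) (⊕-cong (gf-const-1 geo-s) (gf-const-1 geo-s)))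
  where open IsOGF ogf-S

birunCuts-∷ : ∀ x r → 𝕊 (birunCuts (x ∷ r)) ≃ BirunSeries.bothCuts (ascents (x ∷ r))
birunCuts-∷ x r = IsOGF.gf-cong ogf-S (λ a → cong₂ ℕ._+_ (cutCount≡cuts (alternating true a) x r) (cutCount≡cuts (alternating false a) x r))

-- Of the m + 1 steps of π the first is the initial state and only m remain in the pattern; this
-- matches the exponents n - 1 and n with n = m + 2.
birun-series : ∀ π m → length π ≡ suc (suc m) → Linked Comparable π →
  ((𝟙 ⊕ S) ^^ 3) ⊛ inv1-s ⊛ (((𝟙 ⊕ S ⊛ S) ^^ (suc (suc m) ∸ 1)) ⊛ (inv1-s² ^^ suc (suc m)) ⊛ (sArg ^^ br π))
  ≃ 𝕊 (birunCuts π) ⊕ 𝕊 (birunCuts π)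
birun-series (x ∷ y ∷ r) m eq ls =
  BirunSeries.bothCuts-series ((𝟙 ⊕ S) ^^ 3) ((𝟙 ⊕ S ⊛ S) ^^ (suc (suc m) ∸ 1)) (inv1-s² ^^ suc (suc m))
    (sArg ^^ br (x ∷ y ∷ r)) (𝕊 (birunCuts (x ∷ y ∷ r))) (x <ᵇ y) (ascents (y ∷ r))
    (^^≃^ (𝟙 ⊕ S) 3 3 refl) (^^≃^ (𝟙 ⊕ S ⊛ S) (suc (suc m) ∸ 1) (suc (length (ascents (y ∷ r)))) (cong suc len))
    (^^≃^ inv1-s² (suc (suc m)) (suc (suc (length (ascents (y ∷ r))))) (cong (λ k → suc (suc k)) len))
    (^^≃^ sArg (br (x ∷ y ∷ r)) (suc (changesFrom (x <ᵇ y) (ascents (y ∷ r)))) (br≡changes ls)) (birunCuts-∷ x (y ∷ r))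
  where
  len : m ≡ length (ascents (y ∷ r))
  len = trans (sym (ℕ.suc-injective (ℕ.suc-injective eq))) (sym (length-pattern y r))

module ipk = Comparison descAsc

-- To be applied to σ = π⁻¹. The initial state is fixed here, so all n steps of a word of n + 1
-- letters stay in the pattern.
peak-series : ∀ σ n → length σ ≡ suc n → Linked Comparable σ →
  ((𝟙 ⊕ T) ^^ suc (suc n)) ⊛ (inv1-t ^^ suc (suc n)) ⊛ (tArg ^^ suc (pk σ)) ≃ 𝕋 (ipk.inverseCuts σ) ⊕ 𝕋 (ipk.inverseCuts σ)
peak-series (x ∷ r) n eq ls =
  PeakSeries.peakCuts-series ((𝟙 ⊕ T) ^^ suc (suc n)) (inv1-t ^^ suc (suc n))
    (tArg ^^ suc (pk (x ∷ r))) (𝕋 (ipk.inverseCuts (x ∷ r))) (ascents (x ∷ r))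
    (^^≃^ (𝟙 ⊕ T) (suc (suc n)) (suc (suc (length (ascents (x ∷ r))))) (cong (λ k → suc (suc k)) len))
    (^^≃^ inv1-t (suc (suc n)) (suc (suc (length (ascents (x ∷ r))))) (cong (λ k → suc (suc k)) len))
    (^^≃^ tArg (suc (pk (x ∷ r))) (suc (peaksFrom false (ascents (x ∷ r)))) (cong suc (pk≡peaks ls)))
    (IsOGF.gf-cong ogf-T (λ b → cutCount≡cuts (descAsc b) x r))
  where
  len : n ≡ length (ascents (x ∷ r))
  len = trans (sym (ℕ.suc-injective eq)) (sym (length-pattern x r))

module ides = Comparison (λ b → replicate b true)

descent-series : ∀ σ n → length σ ≡ suc n → Linked Comparable σ →
  (inv1-t ^^ suc (suc n)) ⊛ (T ^^ suc (des σ)) ≃ 𝕋 (ides.inverseCuts σ)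
descent-series (x ∷ r) n eq ls =
  DescentSeries.descentCuts-series (inv1-t ^^ suc (suc n)) (T ^^ suc (des (x ∷ r)))
    (𝕋 (ides.inverseCuts (x ∷ r))) (ascents (x ∷ r))
    (^^≃^ inv1-t (suc (suc n)) (suc (suc (length (ascents (x ∷ r))))) (cong (λ k → suc (suc k)) len))
    (^^≃^ T (suc (des (x ∷ r))) (suc (descents (ascents (x ∷ r)))) (cong suc (des≡descents ls)))
    (IsOGF.gf-cong ogf-T (λ b → cutCount≡cuts (replicate b true) x r))
  where
  len : n ≡ length (ascents (x ∷ r))
  len = trans (sym (ℕ.suc-injective eq)) (sym (length-pattern x r))

ipk-zero : inv1-s ⊛ inv1-t ≃ ipk.H 0 ⊛ (X ^^ 0)
ipk-zero = term-zero {inv1-s} {inv1-t} {𝕊 (birunCuts [])} {𝕋 (ipk.inverseCuts [])} birunCuts-[]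
  (≃-trans (gf-cong (λ b → cutSum-[] (descAsc b) (const 1))) (gf-const-1 geo-t))
  where open IsOGF ogf-T

ipk-one : q 2 1 · S ⊛ T ⊛ X ⊛ (inv1-s ^^ 2) ⊛ (inv1-t ^^ 2) ≃ ipk.H 1 ⊛ (X ^^ 1)
ipk-one = term-one-ipk {S} {q 2 1 · S} {T} {X} {inv1-s} {inv1-t} {𝕊 (birunCuts (1 ∷ []))} {𝕋 (ipk.inverseCuts (1 ∷ []))} (2·≃ S)
  (≃-trans (birunCuts-∷ 1 []) BirunSeries.bothCuts-[])
  (≃-trans (IsOGF.gf-cong ogf-T (λ b → cutCount≡cuts (descAsc b) 1 [])) PeakSeries.peakCuts-[])

ides-zero : inv1-s ⊛ inv1-t ≃ ides.H 0 ⊛ (X ^^ 0)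
ides-zero = term-zero {inv1-s} {inv1-t} {𝕊 (birunCuts [])} {𝕋 (ides.inverseCuts [])} birunCuts-[]
  (≃-trans (gf-cong (λ b → cutSum-[] (replicate b true) (const 1))) (gf-const-1 geo-t))
  where open IsOGF ogf-T

ides-one : S ⊛ T ⊛ X ⊛ (inv1-s ^^ 2) ⊛ (inv1-t ^^ 2) ≃ ides.H 1 ⊛ (X ^^ 1)
ides-one = term-one-ides {S} {T} {X} {inv1-s} {inv1-t} {𝕊 (birunCuts (1 ∷ []))} {𝕋 (ides.inverseCuts (1 ∷ []))}
  (≃-trans (birunCuts-∷ 1 []) BirunSeries.bothCuts-[])
  (≃-trans (IsOGF.gf-cong ogf-T (λ b → cutCount≡cuts (replicate b true) 1 [])) DescentSeries.descentCuts-[])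

P-br-ipk-def : ∀ n U V → P-br-ipk n U V ≃ ΣL (perms n) (λ π → (U ^^ br π) ⊛ (V ^^ suc (ipk π)))
P-br-ipk-def n U V = ≡⇒≃ (cong (λ πs → ΣL πs (λ π → (U ^^ br π) ⊛ (V ^^ suc (ipk π)))) (𝔖≡perms n))

P-br-ides-def : ∀ n U V → P-br-ides n U V ≃ ΣL (perms n) (λ π → (U ^^ br π) ⊛ (V ^^ suc (ides π)))
P-br-ides-def n U V = ≡⇒≃ (cong (λ πs → ΣL πs (λ π → (U ^^ br π) ⊛ (V ^^ suc (ides π)))) (𝔖≡perms n))

-- The regrouping is done with arbitrary series in place of the concrete ones: u and v stand for the
-- weights of π and of its inverse, k and l for the series of their cuts.
module _ (n : ℕ) (P Hₙ : FPS) (u v k l H : List ℕ → FPS) (P≃ : P ≃ ΣL (perms n) (λ π → u π ⊛ v π))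
  (H≃ : ∀ π → ½ ⊛ (k π ⊛ l π) ≃ H π) (Hₙ≃ : ΣL (perms n) H ≃ Hₙ) where

  private
    distribute : ∀ g → (∀ π → IsPerm n π → g ⊛ (u π ⊛ v π) ≃ ½ ⊛ (k π ⊛ l π)) → g ⊛ P ⊛ (X ^^ n) ≃ Hₙ ⊛ (X ^^ n)
    distribute g p = ⊛-cong {g ⊛ P} {Hₙ} {X ^^ n} {X ^^ n}
      (≃-trans {g ⊛ P} {g ⊛ ΣL (perms n) (λ π → u π ⊛ v π)} {Hₙ} (⊛-cong {g} {g} {P} {ΣL (perms n) (λ π → u π ⊛ v π)} ≃-refl P≃)
      (≃-trans {g ⊛ ΣL (perms n) (λ π → u π ⊛ v π)} {ΣL (perms n) (λ π → g ⊛ (u π ⊛ v π))} {Hₙ} (⊛-ΣL g (perms n) (λ π → u π ⊛ v π))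
      (≃-trans {ΣL (perms n) (λ π → g ⊛ (u π ⊛ v π))} {ΣL (perms n) H} {Hₙ}
        (ΣL-congᴬ {F = λ π → g ⊛ (u π ⊛ v π)} {H}
          (All.map (λ {π} i → ≃-trans {g ⊛ (u π ⊛ v π)} {½ ⊛ (k π ⊛ l π)} {H π} (p π i) (H≃ π)) (perms-IsPerm n))) Hₙ≃)))
      ≃-refl

  sum-ipk : ∀ f c i sm tm en jn → f ≃ ½ ⊛ ½ ⊛ ½ ⊛ c →
    (∀ π → IsPerm n π → c ⊛ i ⊛ (sm ⊛ en ⊛ u π) ≃ k π ⊕ k π) → (∀ π → IsPerm n π → tm ⊛ jn ⊛ v π ≃ l π ⊕ l π) →
    f ⊛ i ⊛ (sm ⊛ tm ⊛ P ⊛ en ⊛ jn ⊛ (X ^^ n)) ≃ Hₙ ⊛ (X ^^ n)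
  sum-ipk f c i sm tm en jn pf pk pl =
    ≃-trans {f ⊛ i ⊛ (sm ⊛ tm ⊛ P ⊛ en ⊛ jn ⊛ (X ^^ n))} {f ⊛ i ⊛ (sm ⊛ tm ⊛ en ⊛ jn) ⊛ P ⊛ (X ^^ n)} {Hₙ ⊛ (X ^^ n)}
      (collect-ipk (f ⊛ i) sm tm P en jn (X ^^ n))
      (distribute (f ⊛ i ⊛ (sm ⊛ tm ⊛ en ⊛ jn))
        (λ π p → term-ipk {f} {c} {i} {sm} {tm} {en} {jn} {u π} {v π} {k π} {l π} pf (pk π p) (pl π p)))

  sum-ides : ∀ f c i sm en jn → f ≃ ½ ⊛ ½ ⊛ c →
    (∀ π → IsPerm n π → c ⊛ i ⊛ (sm ⊛ en ⊛ u π) ≃ k π ⊕ k π) → (∀ π → IsPerm n π → jn ⊛ v π ≃ l π) →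
    f ⊛ i ⊛ (sm ⊛ P ⊛ en ⊛ jn ⊛ (X ^^ n)) ≃ Hₙ ⊛ (X ^^ n)
  sum-ides f c i sm en jn pf pk pl =
    ≃-trans {f ⊛ i ⊛ (sm ⊛ P ⊛ en ⊛ jn ⊛ (X ^^ n))} {f ⊛ i ⊛ (sm ⊛ en ⊛ jn) ⊛ P ⊛ (X ^^ n)} {Hₙ ⊛ (X ^^ n)}
      (collect-ides (f ⊛ i) sm P en jn (X ^^ n))
      (distribute (f ⊛ i ⊛ (sm ⊛ en ⊛ jn))
        (λ π p → term-ides {f} {c} {i} {sm} {en} {jn} {u π} {v π} {k π} {l π} pf (pk π p) (pl π p)))

coefficient-ipk : q 1 8 · ((𝟙 ⊕ S) ^^ 3) ≃ ½ ⊛ ½ ⊛ ½ ⊛ ((𝟙 ⊕ S) ^^ 3)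
coefficient-ipk = ≃-trans {q 1 8 · ((𝟙 ⊕ S) ^^ 3)} {(q 1 8 · 𝟙) ⊛ ((𝟙 ⊕ S) ^^ 3)} {½ ⊛ ½ ⊛ ½ ⊛ ((𝟙 ⊕ S) ^^ 3)}
  (·≃⊛ (q 1 8) ((𝟙 ⊕ S) ^^ 3)) (⊛-cong {q 1 8 · 𝟙} {½ ⊛ ½ ⊛ ½} {(𝟙 ⊕ S) ^^ 3} {(𝟙 ⊕ S) ^^ 3} ⅛≃½³ ≃-refl)

coefficient-ides : q 1 4 · ((𝟙 ⊕ S) ^^ 3) ≃ ½ ⊛ ½ ⊛ ((𝟙 ⊕ S) ^^ 3)
coefficient-ides = ≃-trans {q 1 4 · ((𝟙 ⊕ S) ^^ 3)} {(q 1 4 · 𝟙) ⊛ ((𝟙 ⊕ S) ^^ 3)} {½ ⊛ ½ ⊛ ((𝟙 ⊕ S) ^^ 3)}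
  (·≃⊛ (q 1 4) ((𝟙 ⊕ S) ^^ 3)) (⊛-cong {q 1 4 · 𝟙} {½ ⊛ ½} {(𝟙 ⊕ S) ^^ 3} {(𝟙 ⊕ S) ^^ 3} ¼≃½² ≃-refl)

ipk-rest : ∀ m → let n = suc (suc m) in
  q 1 8 · ((𝟙 ⊕ S) ^^ 3) ⊛ inv1-s ⊛
    (((𝟙 ⊕ S ⊛ S) ^^ (n ∸ 1)) ⊛ ((𝟙 ⊕ T) ^^ suc n) ⊛ P-br-ipk n sArg tArg ⊛ (inv1-s² ^^ n) ⊛ (inv1-t ^^ suc n) ⊛ (X ^^ n))
  ≃ ipk.H n ⊛ (X ^^ n)
ipk-rest m = sum-ipk (suc (suc m)) (P-br-ipk (suc (suc m)) sArg tArg) (ipk.H (suc (suc m)))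
  (λ π → sArg ^^ br π) (λ π → tArg ^^ suc (ipk π)) (λ π → 𝕊 (birunCuts π)) (λ π → 𝕋 (ipk.inverseCuts (inverse π))) ipk.permTerm
  (P-br-ipk-def (suc (suc m)) sArg tArg) (λ π → ≃-refl) (ipk.H-sum (suc (suc m)))
  (q 1 8 · ((𝟙 ⊕ S) ^^ 3)) ((𝟙 ⊕ S) ^^ 3) inv1-s ((𝟙 ⊕ S ⊛ S) ^^ (suc (suc m) ∸ 1)) ((𝟙 ⊕ T) ^^ suc (suc (suc m)))
  (inv1-s² ^^ suc (suc m)) (inv1-t ^^ suc (suc (suc m))) coefficient-ipk
  (λ π p → let open IsPerm p in birun-series π m len comparable)
  (λ π p → let open IsPerm p in peak-series (inverse π) (suc m) (trans (length-inverse π) len) inverse-comparable)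

ides-rest : ∀ m → let n = suc (suc m) in
  q 1 4 · ((𝟙 ⊕ S) ^^ 3) ⊛ inv1-s ⊛
    (((𝟙 ⊕ S ⊛ S) ^^ (n ∸ 1)) ⊛ P-br-ides n sArg T ⊛ (inv1-s² ^^ n) ⊛ (inv1-t ^^ suc n) ⊛ (X ^^ n))
  ≃ ides.H n ⊛ (X ^^ n)
ides-rest m = sum-ides (suc (suc m)) (P-br-ides (suc (suc m)) sArg T) (ides.H (suc (suc m)))
  (λ π → sArg ^^ br π) (λ π → T ^^ suc (ides π)) (λ π → 𝕊 (birunCuts π)) (λ π → 𝕋 (ides.inverseCuts (inverse π))) ides.permTerm
  (P-br-ides-def (suc (suc m)) sArg T) (λ π → ≃-refl) (ides.H-sum (suc (suc m)))
  (q 1 4 · ((𝟙 ⊕ S) ^^ 3)) ((𝟙 ⊕ S) ^^ 3) inv1-s ((𝟙 ⊕ S ⊛ S) ^^ (suc (suc m) ∸ 1))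
  (inv1-s² ^^ suc (suc m)) (inv1-t ^^ suc (suc (suc m))) coefficient-ides
  (λ π p → let open IsPerm p in birun-series π m len comparable)
  (λ π p → let open IsPerm p in descent-series (inverse π) (suc m) (trans (length-inverse π) len) inverse-comparable)

-- The right-hand sides

Y^-descAsc : ∀ j τ k → 𝕏 (cutWords (descAsc j) (alternating τ k)) ≃ Y ^^ (k ℕ.* j)
Y^-descAsc j τ k = ≃-trans (WordSeries.cutWords-descAsc j (alternating τ k))
  (≃-trans (GF.^-assocʳ Y j k) (≃-sym (^^≃^ Y (k ℕ.* j) (j ℕ.* k) (ℕ.*-comm k j))))

-- One block is split off so that its factor stands apart, as the coefficient of s in the summand
-- requires.
Y^-descAsc-suc : ∀ j τ k → 𝕏 (cutWords (descAsc j) (alternating τ (suc k))) ≃ (Y ^^ j) ⊛ (Y ^^ (k ℕ.* j))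
Y^-descAsc-suc j τ k = ≃-trans (WordSeries.cutWords≈ (descAsc j) τ (alternating (not τ) k))
  (⊛-cong (≃-trans (WordSeries.mono-descAsc j τ) (≃-sym (^^≃^ Y j j refl))) (Y^-descAsc j (not τ) k))

rhs-ipk : ∀ i j → (Y ^^ (2 ℕ.* i ℕ.* j)) ⊛ (𝟙 ⊕ S ⊛ (Y ^^ j)) ⊛ (S ^^ (2 ℕ.* i)) ⊛ (T ^^ j) ≃ evenOdd ipk.W i j
rhs-ipk i j = rhs-term-ipk {Y ^^ (2 ℕ.* i ℕ.* j)} {Y ^^ j} {S} {S ^^ (2 ℕ.* i)} {T ^^ j} {w (2 ℕ.* i)} {w (suc (2 ℕ.* i))}
  (half (Y^-descAsc j true (2 ℕ.* i)) (Y^-descAsc j false (2 ℕ.* i)))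
  (half (Y^-descAsc-suc j true (2 ℕ.* i)) (Y^-descAsc-suc j false (2 ℕ.* i)))
  where
  w : ℕ → FPS
  w k = 𝕏 (cutWords (descAsc j) (alternating true k)) ⊕ 𝕏 (cutWords (descAsc j) (alternating false k))
  -- Both alternating sequences give the same series z, so their average is z itself.
  half : ∀ {f g z} → f ≃ z → g ≃ z → ½ ⊛ (f ⊕ g) ≃ z
  half {f} {g} {z} p q = ≃-trans {½ ⊛ (f ⊕ g)} {½ ⊛ (z ⊕ z)} {z} (⊛-cong {½} {½} {f ⊕ g} {z ⊕ z} ≃-refl (⊕-cong {f} {z} {g} {z} p q)) (halve z)

Y^^-even : ∀ j τ i → 𝕏 (cutWords (replicate j true) (alternating τ (2 ℕ.* i))) ≃ Y ^^ (i ℕ.* j)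
Y^^-even j τ i = ≃-trans (WordSeries.cutWords-even j τ i)
  (≃-trans (GF.^-assocʳ Y j i) (≃-sym (^^≃^ Y (i ℕ.* j) (j ℕ.* i) (ℕ.*-comm i j))))

-- The first of the 2i + 1 blocks stays unpaired and keeps the dependence on τ; the other 2i pair up
-- to Y^(ij). Leaving z open serves both values of τ.
mono-ides : ∀ j τ z → z ≃ 𝕏 (monoWords (replicate j true) τ) → ∀ i →
  𝕏 (cutWords (replicate j true) (alternating τ (suc (2 ℕ.* i)))) ≃ z ⊛ (Y ^^ (i ℕ.* j))
mono-ides j τ z p i = ≃-trans (WordSeries.cutWords≈ (replicate j true) τ (alternating (not τ) (2 ℕ.* i)))
  (⊛-cong {𝕏 (monoWords (replicate j true) τ)} {z} (≃-sym p) (Y^^-even j (not τ) i))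

rhs-ides : ∀ i j → q 1 2 · ((Y ^^ (i ℕ.* j)) ⊛ (q 2 1 · 𝟙 ⊕ S ⊛ (inv1-x ^^ j) ⊕ S ⊛ ((𝟙 ⊕ X) ^^ j)) ⊛ (S ^^ (2 ℕ.* i)) ⊛ (T ^^ j))
  ≃ evenOdd ides.W i j
rhs-ides i j = ≃-trans {q 1 2 · t} {½ ⊛ t} {evenOdd ides.W i j} (·≃⊛ (q 1 2) t)
  (rhs-term-ides {Y ^^ (i ℕ.* j)} {q 2 1 · 𝟙} {inv1-x ^^ j} {(𝟙 ⊕ X) ^^ j} {S} {S ^^ (2 ℕ.* i)} {T ^^ j} {w (2 ℕ.* i)} {w (suc (2 ℕ.* i))}
    (2·≃ 𝟙) (⊕-cong (Y^^-even j true i) (Y^^-even j false i))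
    (⊕-cong (mono-ides j true (inv1-x ^^ j) (≃-trans (^^≃^ inv1-x j j refl) (≃-sym (WordSeries.mono-replicate j true))) i)
            (mono-ides j false ((𝟙 ⊕ X) ^^ j) (≃-trans (^^≃^ (𝟙 ⊕ X) j j refl) (≃-sym (WordSeries.mono-replicate j false))) i)))
  where
  t : FPS
  t = (Y ^^ (i ℕ.* j)) ⊛ (q 2 1 · 𝟙 ⊕ S ⊛ (inv1-x ^^ j) ⊕ S ⊛ ((𝟙 ⊕ X) ^^ j)) ⊛ (S ^^ (2 ℕ.* i)) ⊛ (T ^^ j)
  w : ℕ → FPS
  w k = 𝕏 (cutWords (replicate j true) (alternating true k)) ⊕ 𝕏 (cutWords (replicate j true) (alternating false k))

-- Assembling the two identities

Σ∞²-cong : ∀ (F G : ℕ → ℕ → FPS) → (∀ i j → F i j ≃ G i j) → Σ∞ (λ i → Σ∞ (F i)) ≃ Σ∞ (λ i → Σ∞ (G i))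
Σ∞²-cong F G p = Σ∞-cong {λ i → Σ∞ (F i)} {λ i → Σ∞ (G i)} (λ i → Σ∞-cong {F i} {G i} (p i))

·-Σ∞² : ∀ r (F : ℕ → ℕ → FPS) → r · Σ∞ (λ i → Σ∞ (F i)) ≃ Σ∞ (λ i → Σ∞ (λ j → r · F i j))
·-Σ∞² r F = ≃-trans {r · Σ∞ (λ i → Σ∞ (F i))} {Σ∞ (λ i → r · Σ∞ (F i))} {Σ∞ (λ i → Σ∞ (λ j → r · F i j))}
  (·-Σ∞ r (λ i → Σ∞ (F i))) (Σ∞-cong {λ i → r · Σ∞ (F i)} {λ i → Σ∞ (λ j → r · F i j)} (λ i → ·-Σ∞ r (F i)))

theorem-ipk : LHS-a ≃ RHS-a
theorem-ipk = ≃-trans {LHS-a} {(ipk.H 0 ⊛ (X ^^ 0)) ⊕ (ipk.H 1 ⊛ (X ^^ 1)) ⊕ Σ∞ (from2 λ n → ipk.H n ⊛ (X ^^ n))} {RHS-a}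
  (⊕-cong (⊕-cong ipk-zero ipk-one)
    (ipk.tail-terms (q 1 8 · ((𝟙 ⊕ S) ^^ 3) ⊛ inv1-s)
      (λ n → ((𝟙 ⊕ S ⊛ S) ^^ (n ∸ 1)) ⊛ ((𝟙 ⊕ T) ^^ suc n) ⊛ P-br-ipk n sArg tArg ⊛ (inv1-s² ^^ n) ⊛ (inv1-t ^^ suc n)) ipk-rest))
  (≃-trans {g = Σ∞ (λ i → Σ∞ (evenOdd ipk.W i))} ipk.comparison
    (≃-sym (Σ∞²-cong (λ i j → (Y ^^ (2 ℕ.* i ℕ.* j)) ⊛ (𝟙 ⊕ S ⊛ (Y ^^ j)) ⊛ (S ^^ (2 ℕ.* i)) ⊛ (T ^^ j)) (evenOdd ipk.W) rhs-ipk)))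

theorem-ides : LHS-b ≃ RHS-b
theorem-ides = ≃-trans {LHS-b} {(ides.H 0 ⊛ (X ^^ 0)) ⊕ (ides.H 1 ⊛ (X ^^ 1)) ⊕ Σ∞ (from2 λ n → ides.H n ⊛ (X ^^ n))} {RHS-b}
  (⊕-cong (⊕-cong ides-zero ides-one)
    (ides.tail-terms (q 1 4 · ((𝟙 ⊕ S) ^^ 3) ⊛ inv1-s)
      (λ n → ((𝟙 ⊕ S ⊛ S) ^^ (n ∸ 1)) ⊛ P-br-ides n sArg T ⊛ (inv1-s² ^^ n) ⊛ (inv1-t ^^ suc n)) ides-rest))
  (≃-trans {g = Σ∞ (λ i → Σ∞ (evenOdd ides.W i))} ides.comparison (≃-sym
    (≃-trans {RHS-b} {Σ∞ (λ i → Σ∞ (λ j → q 1 2 · F i j))} {Σ∞ (λ i → Σ∞ (evenOdd ides.W i))}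
      (·-Σ∞² (q 1 2) F) (Σ∞²-cong (λ i j → q 1 2 · F i j) (evenOdd ides.W) rhs-ides))))
  where
  F : ℕ → ℕ → FPS
  F i j = (Y ^^ (i ℕ.* j)) ⊛ (q 2 1 · 𝟙 ⊕ S ⊛ (inv1-x ^^ j) ⊕ S ⊛ ((𝟙 ⊕ X) ^^ j)) ⊛ (S ^^ (2 ℕ.* i)) ⊛ (T ^^ j)

theorem5p8 : (LHS-a ≈ₛ RHS-a) × (LHS-b ≈ₛ RHS-b)
theorem5p8 = coeff theorem-ipk , coeff theorem-ides
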